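{- For positive integers $\lambda_1,\ldots,\lambda_r$ (with $r\ge1$), $$\mathrm{AO}(K_{\lambda_1,\ldots,\lambda_r})=\int_0^\infty e^{ -t}\prod_{i=1}^r P_{\lambda_i}(t)\,dt .$$
   Context: $\mathrm{AO}(G)$ is the number of acyclic orientations of a graph $G$. $K_{\lambda_1,\ldots,\lambda_r}$ is the complete multipartite graph with parts of sizes $\lambda_1,\ldots,\lambda_r$ (for $r=1$, the edgeless graph). For $m\ge1$, $$P_m(t)=\sum_{j=1}^m(-1)^{m+j}S(m,j)t^j,$$ where $S(m,j)$ is the Stirling number of the second kind. -}

module Defs where

open import Algebra.Bundles.Raw using (RawSemiring)
open import Data.Bool.Base using (Bool; true; false; T)
open import Data.Bool.Properties using (T?)
open import Data.Fin.Base as Fin using (Fin; zero; suc; toℕ; inject₁; splitAt)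
import Data.Fin.Properties as Fin
open import Data.Integer.Base as ℤ using (ℤ; +_; -1ℤ)
import Data.Integer.Properties as ℤ
open import Data.List.Base as List using (List; []; _∷_; length; filter; allFin; cartesianProductWith)
open import Data.List.Membership.Propositional using (_∈_)
open import Data.List.Membership.Propositional.Properties using (∈-allFin)
open import Data.List.Relation.Unary.Any using (here; there)
open import Data.Nat.Base as ℕ using (ℕ; zero; suc; _!)
import Data.Nat.Properties as ℕ
open import Data.Product.Base using (Σ-syntax; ∃-syntax; _×_; _,_; proj₁; proj₂)
open import Data.Rational.Base as ℚ using (ℚ; mkℚ; 0ℚ; 1ℚ; ½; _/_; toℚᵘ; positive; nonNegative)
import Data.Rational.Properties as ℚ
open import Data.Rational.Solver using (module +-*-Solver)
import Data.Rational.Unnormalised.Base as ℚᵘ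
import Data.Rational.Unnormalised.Properties as ℚᵘ
open import Data.Sum.Base using (_⊎_; inj₁; inj₂; [_,_]′)
open import Data.Vec.Base as Vec using (Vec; []; _∷_; lookup)
open import Data.Vec.Functional using (Vector)
open import Function.Base using (_∘_; const)
open import Level using (0ℓ)
open import Relation.Binary.Construct.Closure.Transitive using (TransClosure; [_]; _∷_)
open import Relation.Binary.Core using (Rel)
open import Relation.Binary.Definitions using (Decidable; Symmetric; Irreflexive)
open import Relation.Binary.PropositionalEquality
  using (_≡_; _≢_; refl; sym; trans; cong; cong₂; subst; subst₂; ≢-sym)
open import Relation.Nullary.Decidable using (Dec; map′; ¬?; _×-dec_; _⊎-dec_; _→-dec_)
open import Relation.Nullary.Negation using (¬_)

import Algebra.Definitions.RawSemiring as RawSemiringDefs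

------------------------------------------------------------------------
-- Graphs and acyclic orientations

record Graph (n : ℕ) : Set₁ where
  field
    Adj    : Rel (Fin n) 0ℓ
    adj?   : Decidable Adj
    symm   : Symmetric Adj
    irrefl : Irreflexive _≡_ Adj

-- Boolean adjacency matrices, so that the digraphs on n vertices can be listed.
Digraph : ℕ → Set
Digraph n = Vec (Vec Bool n) n

Arc : ∀ {n} → Digraph n → Rel (Fin n) 0ℓ
Arc D u v = T (lookup (lookup D u) v)

arc? : ∀ {n} (D : Digraph n) → Decidable (Arc D)
arc? D u v = T? (lookup (lookup D u) v)

IsOrientation : ∀ {n} → Graph n → Digraph n → Set
IsOrientation G D = ∀ u v →
  (Arc D u v → Adj u v) ×
  (Adj u v → (Arc D u v × ¬ Arc D v u) ⊎ (Arc D v u × ¬ Arc D u v))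
  where open Graph G

Acyclic : ∀ {n} → Digraph n → Set
Acyclic D = ∀ v → ¬ TransClosure (Arc D) v v

isOrientation? : ∀ {n} (G : Graph n) (D : Digraph n) → Dec (IsOrientation G D)
isOrientation? G D = Fin.all? λ u → Fin.all? λ v →
  (arc? D u v →-dec adj? u v) ×-dec
  (adj? u v →-dec ((arc? D u v ×-dec ¬? (arc? D v u)) ⊎-dec (arc? D v u ×-dec ¬? (arc? D u v))))
  where open Graph G

-- Warshall's algorithm: Walk xs u v is a walk of positive length from u to v
-- whose interior vertices lie in xs.
module _ {n} {_⟶_ : Rel (Fin n) 0ℓ} (_⟶?_ : Decidable _⟶_) where

  Walk : List (Fin n) → Rel (Fin n) 0ℓ
  Walk []       u v = u ⟶ v
  Walk (x ∷ xs) u v = Walk xs u v ⊎ (Walk xs u x × Walk xs x v)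

  walk? : ∀ xs → Decidable (Walk xs)
  walk? []       u v = u ⟶? v
  walk? (x ∷ xs) u v = walk? xs u v ⊎-dec (walk? xs u x ×-dec walk? xs x v)

  _++⁺_ : ∀ {u v w} → TransClosure _⟶_ u v → TransClosure _⟶_ v w → TransClosure _⟶_ u w
  [ e ]   ++⁺ q = e ∷ q
  (e ∷ p) ++⁺ q = e ∷ (p ++⁺ q)

  sound : ∀ xs {u v} → Walk xs u v → TransClosure _⟶_ u v
  sound []       e              = [ e ]
  sound (x ∷ xs) (inj₁ p)       = sound xs p
  sound (x ∷ xs) (inj₂ (p , q)) = sound xs p ++⁺ sound xs q

  to-head : ∀ {x} xs {u} → Walk (x ∷ xs) u x → Walk xs u x
  to-head xs (inj₁ p)       = p
  to-head xs (inj₂ (p , _)) = p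

  from-head : ∀ {x} xs {v} → Walk (x ∷ xs) x v → Walk xs x v
  from-head xs (inj₁ p)       = p
  from-head xs (inj₂ (_ , p)) = p

  join : ∀ xs {u w v} → w ∈ xs → Walk xs u w → Walk xs w v → Walk xs u v
  join (x ∷ xs) (here refl) p q = inj₂ (to-head xs p , from-head xs q)
  join (x ∷ xs) (there i) (inj₁ p)       (inj₁ q)       = inj₁ (join xs i p q)
  join (x ∷ xs) (there i) (inj₁ p)       (inj₂ (q , s)) = inj₂ (join xs i p q , s)
  join (x ∷ xs) (there i) (inj₂ (p , r)) (inj₁ q)       = inj₂ (p , join xs i r q)
  join (x ∷ xs) (there i) (inj₂ (p , r)) (inj₂ (q , s)) = inj₂ (p , s)

  edge : ∀ xs {u v} → u ⟶ v → Walk xs u v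
  edge []       e = e
  edge (x ∷ xs) e = inj₁ (edge xs e)

  complete : ∀ {u v} → TransClosure _⟶_ u v → Walk (allFin n) u v
  complete [ e ]         = edge (allFin n) e
  complete (_∷_ {_} {w} e p) = join (allFin n) (∈-allFin w) (edge (allFin n) e) (complete p)

  transClosure? : Decidable (TransClosure _⟶_)
  transClosure? u v = map′ (sound (allFin n)) complete (walk? (allFin n) u v)

acyclic? : ∀ {n} (D : Digraph n) → Dec (Acyclic D)
acyclic? D = Fin.all? λ v → ¬? (transClosure? (arc? D) v v)

vectors : {A : Set} → List A → ∀ n → List (Vec A n)
vectors xs zero    = [] ∷ []
vectors xs (suc n) = cartesianProductWith _∷_ xs (vectors xs n)

digraphs : ∀ n → List (Digraph n)
digraphs n = vectors (vectors (false ∷ true ∷ []) n) n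

AO : ∀ {n} → Graph n → ℕ
AO {n} G = length (filter (λ D → isOrientation? G D ×-dec acyclic? D) (digraphs n))

-- The vertices of a complete multipartite graph are listed part by part.
part : ∀ {r} (λs : Vec ℕ r) → Fin (Vec.sum λs) → Fin r
part (l ∷ λs) = [ const zero , suc ∘ part λs ]′ ∘ splitAt l

K : ∀ {r} (λs : Vec ℕ r) → Graph (Vec.sum λs)
K λs = record
  { Adj    = λ u v → part λs u ≢ part λs v
  ; adj?   = λ u v → ¬? (part λs u Fin.≟ part λs v)
  ; symm   = ≢-sym
  ; irrefl = λ u≡v p → p (cong (part λs) u≡v)
  }

------------------------------------------------------------------------
-- Stirling numbers of the second kind

S : ℕ → ℕ → ℕ
S zero    zero    = 1
S zero    (suc k) = 0
S (suc n) zero    = 0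
S (suc n) (suc k) = suc k ℕ.* S n (suc k) ℕ.+ S n k

------------------------------------------------------------------------
-- Cauchy sequences of rationals and real numbers

IsCauchy : (ℕ → ℚ) → Set
IsCauchy x = ∀ ε → 0ℚ ℚ.< ε →
  ∃[ N ] ∀ m n → N ℕ.≤ m → N ℕ.≤ n → ℚ.∣ x m ℚ.- x n ∣ ℚ.< ε

record ℝ : Set where
  constructor mkℝ
  field
    seq    : ℕ → ℚ
    cauchy : IsCauchy seq

open ℝ public

open RawSemiringDefs ℚ.+-*-rawSemiring using () renaming (_^_ to _^ℚ_)

1/_! : ℕ → ℚ
1/ k ! = _/_ (+ 1) (k !) {{k ℕ.!≢0}}

expTerm : ℚ → ℕ → ℚ
expTerm q n = (q ^ℚ n) ℚ.* 1/ n !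

expSum : ℚ → ℕ → ℚ
expSum q zero    = 0ℚ
expSum q (suc n) = expSum q n ℚ.+ expTerm q n

ι : ℕ → ℚ
ι n = + n / 1

abstract

  half+half : ∀ ε → ε ℚ.* ½ ℚ.+ ε ℚ.* ½ ≡ ε
  half+half ε = trans (sym (ℚ.*-distribˡ-+ ε ½ ½)) (ℚ.*-identityʳ ε)

  half>0 : ∀ {ε} → 0ℚ ℚ.< ε → 0ℚ ℚ.< ε ℚ.* ½
  half>0 {ε} ε>0 = subst (ℚ._< ε ℚ.* ½) (ℚ.*-zeroˡ ½) (ℚ.*-monoˡ-<-pos ½ ε>0)

  -- Any ε > 0 is C * δ for some δ > 0.
  shrink : ∀ {C ε} → 0ℚ ℚ.< C → 0ℚ ℚ.< ε → Σ[ δ ∈ ℚ ] 0ℚ ℚ.< δ × C ℚ.* δ ≡ ε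
  shrink {C} {ε} C>0 ε>0 = 1/C ℚ.* ε , δ>0 , C*δ≡ε
    where
    C⁺ : ℚ.Positive C
    C⁺ = positive C>0
    C≢0 : ℚ.NonZero C
    C≢0 = ℚ.pos⇒nonZero C {{C⁺}}
    1/C : ℚ
    1/C = ℚ.1/_ C {{C≢0}}
    δ>0 : 0ℚ ℚ.< 1/C ℚ.* ε
    δ>0 = subst (ℚ._< 1/C ℚ.* ε) (ℚ.*-zeroʳ 1/C)
            (ℚ.*-monoʳ-<-pos 1/C {{ℚ.1/pos⇒pos C {{C⁺}}}} ε>0)
    C*δ≡ε : C ℚ.* (1/C ℚ.* ε) ≡ ε
    C*δ≡ε = trans (sym (ℚ.*-assoc C 1/C ε))
              (trans (cong (ℚ._* ε) (ℚ.*-inverseʳ C {{C≢0}})) (ℚ.*-identityˡ ε))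

  ≤-monoʳ : ∀ {r p q} → 0ℚ ℚ.≤ r → p ℚ.≤ q → r ℚ.* p ℚ.≤ r ℚ.* q
  ≤-monoʳ {r} r≥0 = ℚ.*-monoˡ-≤-nonNeg r {{nonNegative r≥0}}

  ≤-monoˡ : ∀ {r p q} → 0ℚ ℚ.≤ r → p ℚ.≤ q → p ℚ.* r ℚ.≤ q ℚ.* r
  ≤-monoˡ {r} r≥0 = ℚ.*-monoʳ-≤-nonNeg r {{nonNegative r≥0}}

  *-mono-≤ : ∀ {p p′ q q′} → 0ℚ ℚ.≤ p′ → 0ℚ ℚ.≤ q → p ℚ.≤ p′ → q ℚ.≤ q′ → p ℚ.* q ℚ.≤ p′ ℚ.* q′
  *-mono-≤ p′≥0 q≥0 p≤p′ q≤q′ = ℚ.≤-trans (≤-monoˡ q≥0 p≤p′) (≤-monoʳ p′≥0 q≤q′)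

  *-nonNeg : ∀ {p q} → 0ℚ ℚ.≤ p → 0ℚ ℚ.≤ q → 0ℚ ℚ.≤ p ℚ.* q
  *-nonNeg {p} {q} p≥0 q≥0 = subst (ℚ._≤ p ℚ.* q) (ℚ.*-zeroʳ p) (≤-monoʳ p≥0 q≥0)

  p≤p+q : ∀ {p q} → 0ℚ ℚ.≤ q → p ℚ.≤ p ℚ.+ q
  p≤p+q {p} {q} q≥0 = subst (ℚ._≤ p ℚ.+ q) (ℚ.+-identityʳ p) (ℚ.+-monoʳ-≤ p q≥0)

  p≤q+p : ∀ {p q} → 0ℚ ℚ.≤ q → p ℚ.≤ q ℚ.+ p
  p≤q+p {p} {q} q≥0 = subst (p ℚ.≤_) (ℚ.+-comm p q) (p≤p+q q≥0)

  ∣p-p∣≡0 : ∀ p → ℚ.∣ p ℚ.- p ∣ ≡ 0ℚ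
  ∣p-p∣≡0 p = cong ℚ.∣_∣ (ℚ.+-inverseʳ p)

  ∣p-q∣≡∣q-p∣ : ∀ p q → ℚ.∣ p ℚ.- q ∣ ≡ ℚ.∣ q ℚ.- p ∣
  ∣p-q∣≡∣q-p∣ p q = trans (sym (ℚ.∣-p∣≡∣p∣ (p ℚ.- q)))
    (cong ℚ.∣_∣ (solve 2 (λ p q → :- (p :- q) := q :- p) refl p q))
    where open +-*-Solver

  triangle : ∀ p q r → ℚ.∣ p ℚ.- r ∣ ℚ.≤ ℚ.∣ p ℚ.- q ∣ ℚ.+ ℚ.∣ q ℚ.- r ∣
  triangle p q r = subst (ℚ._≤ ℚ.∣ p ℚ.- q ∣ ℚ.+ ℚ.∣ q ℚ.- r ∣)
    (cong ℚ.∣_∣ (solve 3 (λ p q r → (p :- q) :+ (q :- r) := p :- r) refl p q r))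
    (ℚ.∣p+q∣≤∣p∣+∣q∣ (p ℚ.- q) (q ℚ.- r))
    where open +-*-Solver

  ∣p∣≤∣q∣+∣p-q∣ : ∀ p q → ℚ.∣ p ∣ ℚ.≤ ℚ.∣ q ∣ ℚ.+ ℚ.∣ p ℚ.- q ∣
  ∣p∣≤∣q∣+∣p-q∣ p q = subst (ℚ._≤ ℚ.∣ q ∣ ℚ.+ ℚ.∣ p ℚ.- q ∣)
    (cong ℚ.∣_∣ (solve 2 (λ p q → q :+ (p :- q) := p) refl p q))
    (ℚ.∣p+q∣≤∣p∣+∣q∣ q (p ℚ.- q))
    where open +-*-Solver

  ≤⇒∣∣≤ : ∀ {p r} → p ℚ.≤ r → ℚ.- p ℚ.≤ r → ℚ.∣ p ∣ ℚ.≤ r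
  ≤⇒∣∣≤ {p} {r} p≤r -p≤r = [ (λ e → subst (ℚ._≤ r) (sym e) p≤r)
                           , (λ e → subst (ℚ._≤ r) (sym e) -p≤r) ]′ (ℚ.∣p∣≡p∨∣p∣≡-p p)

  ≤⇒-≤ : ∀ {p q r} → p ℚ.≤ q ℚ.+ r → p ℚ.- q ℚ.≤ r
  ≤⇒-≤ {p} {q} {r} h = subst (p ℚ.- q ℚ.≤_)
    (solve 2 (λ q r → (q :+ r) :- q := r) refl q r) (ℚ.+-monoˡ-≤ (ℚ.- q) h)
    where open +-*-Solver

  ∣∣p∣-∣q∣∣≤∣p-q∣ : ∀ p q → ℚ.∣ ℚ.∣ p ∣ ℚ.- ℚ.∣ q ∣ ∣ ℚ.≤ ℚ.∣ p ℚ.- q ∣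
  ∣∣p∣-∣q∣∣≤∣p-q∣ p q = ≤⇒∣∣≤ (≤⇒-≤ (∣p∣≤∣q∣+∣p-q∣ p q))
    (subst₂ ℚ._≤_ (solve 2 (λ a b → b :- a := :- (a :- b)) refl ℚ.∣ p ∣ ℚ.∣ q ∣)
      (∣p-q∣≡∣q-p∣ q p) (≤⇒-≤ (∣p∣≤∣q∣+∣p-q∣ q p)))
    where open +-*-Solver

  const-cauchy : ∀ q → IsCauchy (const q)
  const-cauchy q ε ε>0 = 0 , λ _ _ _ _ → subst (ℚ._< ε) (sym (∣p-p∣≡0 q)) ε>0

  neg-cauchy : ∀ x → IsCauchy (λ n → ℚ.- seq x n)
  neg-cauchy (mkℝ x cx) ε ε>0 = let N , h = cx ε ε>0 in N , λ m n N≤m N≤n →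
    subst (ℚ._< ε) (trans (sym (ℚ.∣-p∣≡∣p∣ (x m ℚ.- x n))) (cong ℚ.∣_∣ (ℚ.neg-distrib-+ (x m) (ℚ.- x n))))
      (h m n N≤m N≤n)

  abs-cauchy : ∀ x → IsCauchy (λ n → ℚ.∣ seq x n ∣)
  abs-cauchy (mkℝ x cx) ε ε>0 = let N , h = cx ε ε>0 in N , λ m n N≤m N≤n →
    ℚ.≤-<-trans (∣∣p∣-∣q∣∣≤∣p-q∣ (x m) (x n)) (h m n N≤m N≤n)

  +-cauchy : ∀ x y → IsCauchy (λ n → seq x n ℚ.+ seq y n)
  +-cauchy (mkℝ x cx) (mkℝ y cy) ε ε>0 =
    let M , h = cx (ε ℚ.* ½) (half>0 ε>0)
        N , k = cy (ε ℚ.* ½) (half>0 ε>0)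
    in M ℕ.⊔ N , λ m n le le′ →
      ℚ.≤-<-trans
        (subst (ℚ._≤ ℚ.∣ x m ℚ.- x n ∣ ℚ.+ ℚ.∣ y m ℚ.- y n ∣)
          (cong ℚ.∣_∣ (solve 4 (λ a b c d → (a :- b) :+ (c :- d) := (a :+ c) :- (b :+ d)) refl (x m) (x n) (y m) (y n)))
          (ℚ.∣p+q∣≤∣p∣+∣q∣ (x m ℚ.- x n) (y m ℚ.- y n)))
        (subst (ℚ.∣ x m ℚ.- x n ∣ ℚ.+ ℚ.∣ y m ℚ.- y n ∣ ℚ.<_) (half+half ε)
          (ℚ.+-mono-< (h m n (ℕ.m⊔n≤o⇒m≤o M N le) (ℕ.m⊔n≤o⇒m≤o M N le′))
                      (k m n (ℕ.m⊔n≤o⇒n≤o M N le) (ℕ.m⊔n≤o⇒n≤o M N le′))))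
    where open +-*-Solver

  cauchy-bounded : ∀ x → Σ[ B ∈ ℚ ] 0ℚ ℚ.< B × (∀ n → ℚ.∣ seq x n ∣ ℚ.≤ B)
  cauchy-bounded (mkℝ x cx) =
      b N ℚ.+ 1ℚ
    , ℚ.<-≤-trans (ℚ.positive⁻¹ 1ℚ) (p≤q+p (b≥0 N))
    , λ n → [ (λ n≤N → ℚ.≤-trans (b-bound n≤N) (p≤p+q (ℚ.nonNegative⁻¹ 1ℚ)))
            , (λ N≤n → ℚ.≤-trans (∣p∣≤∣q∣+∣p-q∣ (x n) (x N))
                (ℚ.+-mono-≤ (b-bound ℕ.≤-refl) (ℚ.<⇒≤ (proj₂ (cx 1ℚ (ℚ.positive⁻¹ 1ℚ)) n N N≤n ℕ.≤-refl)))) ]′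
            (ℕ.≤-total n N)
    where
    N : ℕ
    N = proj₁ (cx 1ℚ (ℚ.positive⁻¹ 1ℚ))
    b : ℕ → ℚ
    b zero    = ℚ.∣ x zero ∣
    b (suc n) = b n ℚ.+ ℚ.∣ x (suc n) ∣
    b≥0 : ∀ n → 0ℚ ℚ.≤ b n
    b≥0 zero    = ℚ.0≤∣p∣ (x zero)
    b≥0 (suc n) = ℚ.+-mono-≤ (b≥0 n) (ℚ.0≤∣p∣ (x (suc n)))
    b-last : ∀ n → ℚ.∣ x n ∣ ℚ.≤ b n
    b-last zero    = ℚ.≤-refl
    b-last (suc n) = p≤q+p (b≥0 n)
    b-bound′ : ∀ {m n} → m ℕ.≤′ n → ℚ.∣ x m ∣ ℚ.≤ b n
    b-bound′ {m} (ℕ.≤′-reflexive refl) = b-last m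
    b-bound′ {m} {suc n} (ℕ.≤′-step le) = ℚ.≤-trans (b-bound′ le) (p≤p+q (ℚ.0≤∣p∣ (x (suc n))))
    b-bound : ∀ {m n} → m ℕ.≤ n → ℚ.∣ x m ∣ ℚ.≤ b n
    b-bound = b-bound′ ∘ ℕ.≤⇒≤′

  *-diff : ∀ {A B} p p′ q q′ → ℚ.∣ p ∣ ℚ.≤ A → ℚ.∣ q′ ∣ ℚ.≤ B →
           ℚ.∣ p ℚ.* q ℚ.- p′ ℚ.* q′ ∣ ℚ.≤ A ℚ.* ℚ.∣ q ℚ.- q′ ∣ ℚ.+ B ℚ.* ℚ.∣ p ℚ.- p′ ∣
  *-diff {A} {B} p p′ q q′ p≤A q′≤B = ℚ.≤-trans
    (subst (ℚ._≤ ℚ.∣ p ℚ.* (q ℚ.- q′) ∣ ℚ.+ ℚ.∣ q′ ℚ.* (p ℚ.- p′) ∣)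
      (cong ℚ.∣_∣ (solve 4 (λ p p′ q q′ → p :* (q :- q′) :+ q′ :* (p :- p′) := p :* q :- p′ :* q′) refl p p′ q q′))
      (ℚ.∣p+q∣≤∣p∣+∣q∣ (p ℚ.* (q ℚ.- q′)) (q′ ℚ.* (p ℚ.- p′))))
    (ℚ.+-mono-≤
      (subst (ℚ._≤ A ℚ.* ℚ.∣ q ℚ.- q′ ∣) (sym (ℚ.∣p*q∣≡∣p∣*∣q∣ p (q ℚ.- q′))) (≤-monoˡ (ℚ.0≤∣p∣ (q ℚ.- q′)) p≤A))
      (subst (ℚ._≤ B ℚ.* ℚ.∣ p ℚ.- p′ ∣) (sym (ℚ.∣p*q∣≡∣p∣*∣q∣ q′ (p ℚ.- p′))) (≤-monoˡ (ℚ.0≤∣p∣ (p ℚ.- p′)) q′≤B)))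
    where open +-*-Solver

  <-monoʳ : ∀ {r p q} → 0ℚ ℚ.< r → p ℚ.< q → r ℚ.* p ℚ.< r ℚ.* q
  <-monoʳ {r} r>0 = ℚ.*-monoʳ-<-pos r {{positive r>0}}

  *-cauchy : ∀ x y → IsCauchy (λ n → seq x n ℚ.* seq y n)
  *-cauchy (mkℝ x cx) (mkℝ y cy) ε ε>0 =
    let A , A>0 , x≤A = cauchy-bounded (mkℝ x cx)
        B , B>0 , y≤B = cauchy-bounded (mkℝ y cy)
        δ , δ>0 , Aδ  = shrink A>0 (half>0 ε>0)
        η , η>0 , Bη  = shrink B>0 (half>0 ε>0)
        M , h = cx η η>0
        N , k = cy δ δ>0
    in M ℕ.⊔ N , λ m n le le′ →
      ℚ.≤-<-trans (*-diff (x m) (x n) (y m) (y n) (x≤A m) (y≤B n))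
        (subst (A ℚ.* ℚ.∣ y m ℚ.- y n ∣ ℚ.+ B ℚ.* ℚ.∣ x m ℚ.- x n ∣ ℚ.<_)
          (trans (cong₂ ℚ._+_ Aδ Bη) (half+half ε))
          (ℚ.+-mono-<
            (<-monoʳ A>0 (k m n (ℕ.m⊔n≤o⇒n≤o M N le) (ℕ.m⊔n≤o⇒n≤o M N le′)))
            (<-monoʳ B>0 (h m n (ℕ.m⊔n≤o⇒m≤o M N le) (ℕ.m⊔n≤o⇒m≤o M N le′)))))

  ιᵘ : ∀ n → toℚᵘ (ι n) ℚᵘ.≃ ℚᵘ.mkℚᵘ (+ n) 0
  ιᵘ n = ℚ.toℚᵘ-fromℚᵘ (ℚᵘ.mkℚᵘ (+ n) 0)

  ι-suc : ∀ n → ι (suc n) ≡ ι n ℚ.+ 1ℚ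
  ι-suc n = ℚ.toℚᵘ-injective (ℚᵘ.≃-trans (ιᵘ (suc n)) (ℚᵘ.≃-sym
    (ℚᵘ.≃-trans (ℚ.toℚᵘ-homo-+ (ι n) 1ℚ)
      (ℚᵘ.≃-trans (ℚᵘ.+-congˡ ℚᵘ.1ℚᵘ (ιᵘ n)) (ℚᵘ.*≡* (cong (ℤ._* + 1) eq))))))
    where
    eq : + n ℤ.* + 1 ℤ.+ + 1 ≡ + suc n
    eq = trans (cong (ℤ._+ + 1) (ℤ.*-identityʳ (+ n))) (cong +_ (ℕ.+-comm n 1))

  ι≥0 : ∀ n → 0ℚ ℚ.≤ ι n
  ι≥0 zero    = ℚ.≤-refl
  ι≥0 (suc n) = subst (0ℚ ℚ.≤_) (sym (ι-suc n)) (ℚ.≤-trans (ι≥0 n) (p≤p+q (ℚ.nonNegative⁻¹ 1ℚ)))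

  ι-suc>0 : ∀ n → 0ℚ ℚ.< ι (suc n)
  ι-suc>0 n = subst (0ℚ ℚ.<_) (sym (ι-suc n)) (ℚ.<-≤-trans (ℚ.positive⁻¹ 1ℚ) (p≤q+p (ι≥0 n)))

  ι-mono : ∀ {m n} → m ℕ.≤ n → ι m ℚ.≤ ι n
  ι-mono = go ∘ ℕ.≤⇒≤′
    where
    go : ∀ {m n} → m ℕ.≤′ n → ι m ℚ.≤ ι n
    go (ℕ.≤′-reflexive refl) = ℚ.≤-refl
    go {m} {suc n} (ℕ.≤′-step le) =
      subst (ι m ℚ.≤_) (sym (ι-suc n)) (ℚ.≤-trans (go le) (p≤p+q (ℚ.nonNegative⁻¹ 1ℚ)))

  archimedean : ∀ q → ∃[ n ] q ℚ.≤ ι n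
  archimedean q@(mkℚ i d _) = ℤ.∣ i ∣ , ℚ.toℚᵘ-cancel-≤
    (ℚᵘ.≤-respʳ-≃ (ℚᵘ.≃-sym (ιᵘ ℤ.∣ i ∣)) (ℚᵘ.*≤* (ℤ.≤-trans (ℤ.≤-reflexive (ℤ.*-identityʳ i)) (bound i))))
    where
    bound : ∀ i → i ℤ.≤ + ℤ.∣ i ∣ ℤ.* + suc d
    bound (+ n)        = subst (+ n ℤ.≤_) (ℤ.pos-* n (suc d)) (ℤ.+≤+ (ℕ.m≤m*n n (suc d)))
    bound (ℤ.-[1+ n ]) = ℤ.-≤+

  ι*1/ : ∀ a b .{{_ : ℕ.NonZero a}} .{{_ : ℕ.NonZero b}} .{{_ : ℕ.NonZero (a ℕ.* b)}} →
         ι a ℚ.* (+ 1 / (a ℕ.* b)) ≡ + 1 / b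
  ι*1/ a@(suc _) b@(suc b-1) = ℚ.toℚᵘ-injective
    (ℚᵘ.≃-trans (ℚ.toℚᵘ-homo-* (ι a) (+ 1 / (a ℕ.* b)))
      (ℚᵘ.≃-trans (ℚᵘ.*-cong (ιᵘ a) (ℚ.toℚᵘ-fromℚᵘ (ℚᵘ.mkℚᵘ (+ 1) (ℕ.pred (a ℕ.* b)))))
        (ℚᵘ.≃-trans (ℚᵘ.*≡* eq) (ℚᵘ.≃-sym (ℚ.toℚᵘ-fromℚᵘ (ℚᵘ.mkℚᵘ (+ 1) b-1))))))
    where
    eq : (+ a ℤ.* + 1) ℤ.* + b ≡ + 1 ℤ.* + (1 ℕ.* (a ℕ.* b))
    eq = trans (cong (ℤ._* + b) (ℤ.*-identityʳ (+ a)))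
          (trans (sym (ℤ.pos-* a b))
            (sym (trans (ℤ.*-identityˡ (+ (1 ℕ.* (a ℕ.* b)))) (cong +_ (ℕ.*-identityˡ (a ℕ.* b))))))

  1/!-suc : ∀ k → ι (suc k) ℚ.* 1/ suc k ! ≡ 1/ k !
  1/!-suc k = ι*1/ (suc k) (k !) {{_}} {{k ℕ.!≢0}} {{suc k ℕ.!≢0}}

  1/!≥0 : ∀ k → 0ℚ ℚ.≤ 1/ k !
  1/!≥0 k = ℚ.nonNegative⁻¹ (1/ k !) {{ℚ.normalize-nonNeg 1 (k !) {{k ℕ.!≢0}}}}

  ^-nonNeg : ∀ {B} → 0ℚ ℚ.≤ B → ∀ n → 0ℚ ℚ.≤ B ^ℚ n
  ^-nonNeg B≥0 zero    = ℚ.nonNegative⁻¹ 1ℚ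
  ^-nonNeg B≥0 (suc n) = *-nonNeg B≥0 (^-nonNeg B≥0 n)

  ∣^∣≤ : ∀ {q B} → ℚ.∣ q ∣ ℚ.≤ B → ∀ n → ℚ.∣ q ^ℚ n ∣ ℚ.≤ B ^ℚ n
  ∣^∣≤ q≤B zero            = ℚ.≤-refl
  ∣^∣≤ {q} {B} q≤B (suc n) = subst (ℚ._≤ B ℚ.* B ^ℚ n) (sym (ℚ.∣p*q∣≡∣p∣*∣q∣ q (q ^ℚ n)))
    (*-mono-≤ (ℚ.≤-trans (ℚ.0≤∣p∣ q) q≤B) (ℚ.0≤∣p∣ (q ^ℚ n)) q≤B (∣^∣≤ q≤B n))

  ^-lipschitz : ∀ {p q B} → ℚ.∣ p ∣ ℚ.≤ B → ℚ.∣ q ∣ ℚ.≤ B → ∀ n →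
    ℚ.∣ p ^ℚ suc n ℚ.- q ^ℚ suc n ∣ ℚ.≤ ℚ.∣ p ℚ.- q ∣ ℚ.* (ι (suc n) ℚ.* B ^ℚ n)
  ^-lipschitz {p} {q} {B} p≤B q≤B zero = ℚ.≤-reflexive (trans
    (cong₂ (λ a b → ℚ.∣ a ℚ.- b ∣) (ℚ.*-identityʳ p) (ℚ.*-identityʳ q))
    (sym (ℚ.*-identityʳ ℚ.∣ p ℚ.- q ∣)))
  ^-lipschitz {p} {q} {B} p≤B q≤B (suc n) = ℚ.≤-trans
    (*-diff p q (p ^ℚ suc n) (q ^ℚ suc n) p≤B (∣^∣≤ q≤B (suc n)))
    (ℚ.≤-trans
      (ℚ.+-monoˡ-≤ (B ^ℚ suc n ℚ.* ℚ.∣ p ℚ.- q ∣)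
        (≤-monoʳ (ℚ.≤-trans (ℚ.0≤∣p∣ p) p≤B) (^-lipschitz p≤B q≤B n)))
      (ℚ.≤-reflexive (trans
        (solve 4 (λ B d i b → B :* (d :* (i :* b)) :+ (B :* b) :* d := d :* ((i :+ con 1ℚ) :* (B :* b)))
          refl B ℚ.∣ p ℚ.- q ∣ (ι (suc n)) (B ^ℚ n))
        (cong (λ i → ℚ.∣ p ℚ.- q ∣ ℚ.* (i ℚ.* B ^ℚ suc n)) (sym (ι-suc (suc n)))))))
    where open +-*-Solver

  expTerm-suc : ∀ B n → ι (suc n) ℚ.* expTerm B (suc n) ≡ B ℚ.* expTerm B n
  expTerm-suc B n = trans
    (solve 4 (λ i B b c → i :* ((B :* b) :* c) := B :* (b :* (i :* c))) refl
      (ι (suc n)) B (B ^ℚ n) (1/ suc n !))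
    (cong (λ c → B ℚ.* (B ^ℚ n ℚ.* c)) (1/!-suc n))
    where open +-*-Solver

  expTerm-diff : ∀ {p q B} → ℚ.∣ p ∣ ℚ.≤ B → ℚ.∣ q ∣ ℚ.≤ B → ∀ n →
    ℚ.∣ expTerm p (suc n) ℚ.- expTerm q (suc n) ∣ ℚ.≤ ℚ.∣ p ℚ.- q ∣ ℚ.* expTerm B n
  expTerm-diff {p} {q} {B} p≤B q≤B n = ℚ.≤-trans
    (ℚ.≤-reflexive (trans
      (cong ℚ.∣_∣ (solve 3 (λ a b c → a :* c :- b :* c := (a :- b) :* c) refl (p ^ℚ suc n) (q ^ℚ suc n) c))
      (trans (ℚ.∣p*q∣≡∣p∣*∣q∣ (p ^ℚ suc n ℚ.- q ^ℚ suc n) c)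
        (cong (ℚ.∣ p ^ℚ suc n ℚ.- q ^ℚ suc n ∣ ℚ.*_) (ℚ.0≤p⇒∣p∣≡p (1/!≥0 (suc n)))))))
    (ℚ.≤-trans (≤-monoˡ (1/!≥0 (suc n)) (^-lipschitz p≤B q≤B n))
      (ℚ.≤-reflexive (trans
        (solve 4 (λ d i b c → (d :* (i :* b)) :* c := d :* (b :* (i :* c))) refl
          ℚ.∣ p ℚ.- q ∣ (ι (suc n)) (B ^ℚ n) c)
        (cong (λ c → ℚ.∣ p ℚ.- q ∣ ℚ.* (B ^ℚ n ℚ.* c)) (1/!-suc n)))))
    where
    open +-*-Solver
    c : ℚ
    c = 1/ suc n !

  ∣expTerm∣≤ : ∀ {q B} → ℚ.∣ q ∣ ℚ.≤ B → ∀ n → ℚ.∣ expTerm q n ∣ ℚ.≤ expTerm B n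
  ∣expTerm∣≤ {q} {B} q≤B n = subst (ℚ._≤ expTerm B n)
    (sym (trans (ℚ.∣p*q∣≡∣p∣*∣q∣ (q ^ℚ n) (1/ n !)) (cong (ℚ.∣ q ^ℚ n ∣ ℚ.*_) (ℚ.0≤p⇒∣p∣≡p (1/!≥0 n)))))
    (≤-monoˡ (1/!≥0 n) (∣^∣≤ q≤B n))

  +-diff : ∀ a b c d → ℚ.∣ (a ℚ.+ c) ℚ.- (b ℚ.+ d) ∣ ℚ.≤ ℚ.∣ a ℚ.- b ∣ ℚ.+ ℚ.∣ c ℚ.- d ∣
  +-diff a b c d = subst (ℚ._≤ ℚ.∣ a ℚ.- b ∣ ℚ.+ ℚ.∣ c ℚ.- d ∣)
    (cong ℚ.∣_∣ (solve 4 (λ a b c d → (a :- b) :+ (c :- d) := (a :+ c) :- (b :+ d)) refl a b c d))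
    (ℚ.∣p+q∣≤∣p∣+∣q∣ (a ℚ.- b) (c ℚ.- d))
    where open +-*-Solver

  expSum-lipschitz : ∀ {p q B} → ℚ.∣ p ∣ ℚ.≤ B → ℚ.∣ q ∣ ℚ.≤ B → ∀ n →
    ℚ.∣ expSum p (suc n) ℚ.- expSum q (suc n) ∣ ℚ.≤ ℚ.∣ p ℚ.- q ∣ ℚ.* expSum B n
  expSum-lipschitz {p} {q} {B} p≤B q≤B zero =
    ℚ.≤-reflexive (sym (ℚ.*-zeroʳ ℚ.∣ p ℚ.- q ∣))
  expSum-lipschitz {p} {q} {B} p≤B q≤B (suc n) = ℚ.≤-trans
    (+-diff (expSum p (suc n)) (expSum q (suc n)) (expTerm p (suc n)) (expTerm q (suc n)))
    (ℚ.≤-trans (ℚ.+-mono-≤ (expSum-lipschitz p≤B q≤B n) (expTerm-diff p≤B q≤B n))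
      (ℚ.≤-reflexive (sym (ℚ.*-distribˡ-+ ℚ.∣ p ℚ.- q ∣ (expSum B n) (expTerm B n)))))

  expSum-tail : ∀ {q B} → ℚ.∣ q ∣ ℚ.≤ B → ∀ {m n} → m ℕ.≤′ n →
    expSum B m ℚ.+ ℚ.∣ expSum q m ℚ.- expSum q n ∣ ℚ.≤ expSum B n
  expSum-tail {q} {B} q≤B {m} (ℕ.≤′-reflexive refl) = ℚ.≤-reflexive
    (trans (cong (expSum B m ℚ.+_) (∣p-p∣≡0 (expSum q m))) (ℚ.+-identityʳ (expSum B m)))
  expSum-tail {q} {B} q≤B {m} {suc n} (ℕ.≤′-step le) = ℚ.≤-trans
    (ℚ.+-monoʳ-≤ (expSum B m) (triangle (expSum q m) (expSum q n) (expSum q (suc n))))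
    (ℚ.≤-trans
      (ℚ.≤-reflexive (sym (ℚ.+-assoc (expSum B m) ℚ.∣ expSum q m ℚ.- expSum q n ∣ ℚ.∣ expSum q n ℚ.- expSum q (suc n) ∣)))
      (ℚ.+-mono-≤ (expSum-tail q≤B le)
        (subst (ℚ._≤ expTerm B n)
          (trans (sym (ℚ.∣-p∣≡∣p∣ (expTerm q n)))
            (cong ℚ.∣_∣ (solve 2 (λ e t → :- t := e :- (e :+ t)) refl (expSum q n) (expTerm q n))))
          (∣expTerm∣≤ q≤B n))))
    where open +-*-Solver

module ExpCauchy {x : ℕ → ℚ} (cx : IsCauchy x) where

  B : ℚ
  B = proj₁ (cauchy-bounded (mkℝ x cx))

  B>0 : 0ℚ ℚ.< B
  B>0 = proj₁ (proj₂ (cauchy-bounded (mkℝ x cx)))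

  x≤B : ∀ n → ℚ.∣ x n ∣ ℚ.≤ B
  x≤B = proj₂ (proj₂ (cauchy-bounded (mkℝ x cx)))

  t s D : ℕ → ℚ
  t = expTerm B
  s = expSum B
  D n = s n ℚ.+ (t n ℚ.+ t n)

  t≥0 : ∀ n → 0ℚ ℚ.≤ t n
  t≥0 n = *-nonNeg {B ^ℚ n} {1/ n !} (^-nonNeg (ℚ.<⇒≤ B>0) n) (1/!≥0 n)

  K₀ : ℕ
  K₀ = proj₁ (archimedean (B ℚ.+ B))

  t-halves : ∀ n → K₀ ℕ.≤ n → t (suc n) ℚ.+ t (suc n) ℚ.≤ t n
  t-halves n K≤n = ℚ.*-cancelˡ-≤-pos B {{positive B>0}}
    (ℚ.≤-trans (ℚ.≤-reflexive (solve 2 (λ B t → B :* (t :+ t) := (B :+ B) :* t) refl B (t (suc n))))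
      (ℚ.≤-trans (≤-monoˡ (t≥0 (suc n))
          (ℚ.≤-trans (proj₂ (archimedean (B ℚ.+ B))) (ι-mono (ℕ.m≤n⇒m≤1+n K≤n))))
        (ℚ.≤-reflexive (expTerm-suc B n))))
    where open +-*-Solver

  D-antitone : ∀ {m n} → K₀ ℕ.≤ m → m ℕ.≤′ n → D n ℚ.≤ D m
  D-antitone K≤m (ℕ.≤′-reflexive refl) = ℚ.≤-refl
  D-antitone {m} {suc n} K≤m (ℕ.≤′-step le) = ℚ.≤-trans
    (ℚ.+-monoʳ-≤ (s n ℚ.+ t n) (t-halves n (ℕ.≤-trans K≤m (ℕ.≤′⇒≤ le))))
    (ℚ.≤-trans (ℚ.≤-reflexive (ℚ.+-assoc (s n) (t n) (t n))) (D-antitone K≤m le))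

  s≤D : ∀ n → s n ℚ.≤ D n
  s≤D n = p≤p+q (ℚ.+-mono-≤ (t≥0 n) (t≥0 n))

  s-mono : ∀ {m n} → m ℕ.≤′ n → s m ℚ.≤ s n
  s-mono (ℕ.≤′-reflexive refl) = ℚ.≤-refl
  s-mono {m} {suc n} (ℕ.≤′-step le) = ℚ.≤-trans (s-mono le) (p≤p+q (t≥0 n))

  s≤DK : ∀ n → s n ℚ.≤ D K₀
  s≤DK n = [ (λ n≤K → ℚ.≤-trans (s-mono (ℕ.≤⇒≤′ n≤K)) (s≤D K₀))
           , (λ K≤n → ℚ.≤-trans (s≤D n) (D-antitone ℕ.≤-refl (ℕ.≤⇒≤′ K≤n))) ]′ (ℕ.≤-total n K₀)

  C : ℚ
  C = D K₀ ℚ.+ 1ℚ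

  s≤C : ∀ n → s n ℚ.≤ C
  s≤C n = ℚ.≤-trans (s≤DK n) (p≤p+q (ℚ.nonNegative⁻¹ 1ℚ))

  C>0 : 0ℚ ℚ.< C
  C>0 = ℚ.<-≤-trans (ℚ.positive⁻¹ 1ℚ) (p≤q+p (s≤DK 0))

  t≤tK : ∀ {n} → K₀ ℕ.≤′ n → t n ℚ.≤ t K₀
  t≤tK (ℕ.≤′-reflexive refl) = ℚ.≤-refl
  t≤tK {suc n} (ℕ.≤′-step le) = ℚ.≤-trans (p≤p+q (t≥0 (suc n)))
    (ℚ.≤-trans (t-halves n (ℕ.≤′⇒≤ le)) (t≤tK le))

  t-small : ∀ {η} → 0ℚ ℚ.< η → ∃[ J ] ∀ n → J ℕ.≤ n → t (suc n) ℚ.≤ η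
  t-small {η} η>0 = K₀ ℕ.⊔ J , λ n le →
    ℚ.*-cancelˡ-≤-pos (ι (suc n)) {{positive (ι-suc>0 n)}}
      (ℚ.≤-trans (ℚ.≤-reflexive (expTerm-suc B n))
        (ℚ.≤-trans (≤-monoʳ (ℚ.<⇒≤ B>0) (t≤tK (ℕ.≤⇒≤′ (ℕ.m⊔n≤o⇒m≤o K₀ J le))))
          (ℚ.≤-trans (ℚ.≤-reflexive (sym ηδB))
            (ℚ.≤-trans (≤-monoʳ (ℚ.<⇒≤ η>0) (ℚ.≤-trans (proj₂ A) (ι-mono (ℕ.m≤n⇒m≤1+n (ℕ.m⊔n≤o⇒n≤o K₀ J le)))))
              (ℚ.≤-reflexive (ℚ.*-comm η (ι (suc n))))))))
    where
    δ : ℚ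
    δ = proj₁ (shrink η>0 (ℚ.positive⁻¹ 1ℚ))
    A : ∃[ n ] δ ℚ.* (B ℚ.* t K₀) ℚ.≤ ι n
    A = archimedean (δ ℚ.* (B ℚ.* t K₀))
    J : ℕ
    J = proj₁ A
    ηδB : η ℚ.* (δ ℚ.* (B ℚ.* t K₀)) ≡ B ℚ.* t K₀
    ηδB = trans (sym (ℚ.*-assoc η δ (B ℚ.* t K₀)))
      (trans (cong (ℚ._* (B ℚ.* t K₀)) (proj₂ (proj₂ (shrink η>0 (ℚ.positive⁻¹ 1ℚ)))))
        (ℚ.*-identityˡ (B ℚ.* t K₀)))

  tail≤ : ∀ {q m n} → ℚ.∣ q ∣ ℚ.≤ B → K₀ ℕ.≤ m → m ℕ.≤ n →
          ℚ.∣ expSum q m ℚ.- expSum q n ∣ ℚ.≤ t m ℚ.+ t m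
  tail≤ {q} {m} {n} q≤B K≤m m≤n = subst₂ ℚ._≤_ (cancel d) (cancel (t m ℚ.+ t m))
    (ℚ.+-monoʳ-≤ (ℚ.- s m)
      (ℚ.≤-trans (expSum-tail q≤B (ℕ.≤⇒≤′ m≤n)) (ℚ.≤-trans (s≤D n) (D-antitone K≤m (ℕ.≤⇒≤′ m≤n)))))
    where
    open +-*-Solver
    d : ℚ
    d = ℚ.∣ expSum q m ℚ.- expSum q n ∣
    cancel : ∀ d → ℚ.- s m ℚ.+ (s m ℚ.+ d) ≡ d
    cancel d = solve 2 (λ s d → :- s :+ (s :+ d) := d) refl (s m) d

  module _ {ε} (ε>0 : 0ℚ ℚ.< ε) where

    δ : ℚ
    δ = proj₁ (shrink C>0 (half>0 ε>0))

    δ>0 : 0ℚ ℚ.< δ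
    δ>0 = proj₁ (proj₂ (shrink C>0 (half>0 ε>0)))

    M J N : ℕ
    M = proj₁ (cx δ δ>0)
    J = proj₁ (t-small (half>0 (half>0 ε>0)))
    N = suc (M ℕ.⊔ (K₀ ℕ.⊔ J))

    close : ∀ m n → N ℕ.≤ m → m ℕ.≤ n → ℚ.∣ expSum (x m) m ℚ.- expSum (x n) n ∣ ℚ.< ε
    close m@(suc m-1) n (ℕ.s≤s N≤m) m≤n = ℚ.≤-<-trans
      (triangle (expSum (x m) m) (expSum (x n) m) (expSum (x n) n))
      (subst (ℚ.∣ expSum (x m) m ℚ.- expSum (x n) m ∣ ℚ.+ ℚ.∣ expSum (x n) m ℚ.- expSum (x n) n ∣ ℚ.<_)
        (half+half ε)
        (ℚ.+-mono-<-≤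
          (ℚ.≤-<-trans (expSum-lipschitz (x≤B m) (x≤B n) m-1)
            (ℚ.≤-<-trans (≤-monoʳ (ℚ.0≤∣p∣ (x m ℚ.- x n)) (s≤C m-1))
              (subst₂ ℚ._<_ (ℚ.*-comm C ℚ.∣ x m ℚ.- x n ∣) (proj₂ (proj₂ (shrink C>0 (half>0 ε>0))))
                (<-monoʳ C>0 (proj₂ (cx δ δ>0) m n M≤m (ℕ.≤-trans M≤m m≤n))))))
          (ℚ.≤-trans (tail≤ (x≤B n) K≤m m≤n)
            (subst (t m ℚ.+ t m ℚ.≤_) (half+half (ε ℚ.* ½)) (ℚ.+-mono-≤ t≤ t≤)))))
      where
      M≤m : M ℕ.≤ m
      M≤m = ℕ.m≤n⇒m≤1+n (ℕ.m⊔n≤o⇒m≤o M (K₀ ℕ.⊔ J) N≤m)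
      K≤m : K₀ ℕ.≤ m
      K≤m = ℕ.m≤n⇒m≤1+n (ℕ.m⊔n≤o⇒m≤o K₀ J (ℕ.m⊔n≤o⇒n≤o M (K₀ ℕ.⊔ J) N≤m))
      t≤ : t m ℚ.≤ ε ℚ.* ½ ℚ.* ½
      t≤ = proj₂ (t-small (half>0 (half>0 ε>0))) m-1 (ℕ.m⊔n≤o⇒n≤o K₀ J (ℕ.m⊔n≤o⇒n≤o M (K₀ ℕ.⊔ J) N≤m))

abstract

  exp-cauchy : ∀ x → IsCauchy (λ n → expSum (seq x n) n)
  exp-cauchy (mkℝ x cx) ε ε>0 = N ε>0 , λ m n N≤m N≤n →
    [ close ε>0 m n N≤m
    , (λ n≤m → subst (ℚ._< ε) (∣p-q∣≡∣q-p∣ (expSum (x n) n) (expSum (x m) m)) (close ε>0 n m N≤n n≤m)) ]′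
    (ℕ.≤-total m n)
    where open ExpCauchy {x} cx

infix 4 _≃_ _≤_ _<_

record _≃_ (x y : ℝ) : Set where
  constructor *≃*
  field
    eventually : ∀ ε → 0ℚ ℚ.< ε →
      ∃[ N ] ∀ n → N ℕ.≤ n → ℚ.∣ seq x n ℚ.- seq y n ∣ ℚ.< ε

record _≤_ (x y : ℝ) : Set where
  constructor *≤*
  field
    eventually : ∀ ε → 0ℚ ℚ.< ε →
      ∃[ N ] ∀ n → N ℕ.≤ n → seq x n ℚ.< seq y n ℚ.+ ε

record _<_ (x y : ℝ) : Set where
  constructor *<*
  field
    gap        : ℚ
    gap>0      : 0ℚ ℚ.< gap
    eventually : ∃[ N ] ∀ n → N ℕ.≤ n → seq x n ℚ.+ gap ℚ.< seq y n

infixl 6 _+_ _-_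
infixl 7 _*_
infix  8 -_

fromℚ : ℚ → ℝ
fromℚ q = mkℝ (const q) (const-cauchy q)

fromℤ : ℤ → ℝ
fromℤ i = fromℚ (i / 1)

fromℕ : ℕ → ℝ
fromℕ n = fromℤ (+ n)

0ℝ 1ℝ : ℝ
0ℝ = fromℚ 0ℚ
1ℝ = fromℚ 1ℚ

-_ ∣_∣ : ℝ → ℝ
- x   = mkℝ (λ n → ℚ.- seq x n) (neg-cauchy x)
∣ x ∣ = mkℝ (λ n → ℚ.∣ seq x n ∣) (abs-cauchy x)

_+_ _*_ _-_ : ℝ → ℝ → ℝ
x + y = mkℝ (λ n → seq x n ℚ.+ seq y n) (+-cauchy x y)
x * y = mkℝ (λ n → seq x n ℚ.* seq y n) (*-cauchy x y)
x - y = x + (- y)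

ℝ-rawSemiring : RawSemiring 0ℓ 0ℓ
ℝ-rawSemiring = record
  { Carrier = ℝ ; _≈_ = _≃_ ; _+_ = _+_ ; _*_ = _*_ ; 0# = 0ℝ ; 1# = 1ℝ }

open RawSemiringDefs ℝ-rawSemiring public using (_^_; sum; product)

-- The exponential series, with the approximation of x and the number of
-- terms increasing together.
exp : ℝ → ℝ
exp x = mkℝ (λ n → expSum (seq x n) n) (exp-cauchy x)

------------------------------------------------------------------------
-- Riemann integration

record TaggedPartition (a b : ℝ) : Set where
  field
    size  : ℕ
    point : Vector ℝ (suc size)
    tag   : Vector ℝ size
    first : point zero ≃ a
    last  : point (Fin.fromℕ size) ≃ b
    left  : ∀ i → point (inject₁ i) ≤ tag i
    right : ∀ i → tag i ≤ point (suc i)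

  width : Vector ℝ size
  width i = point (suc i) - point (inject₁ i)

  Finer : ℝ → Set
  Finer δ = ∀ i → width i < δ

  riemannSum : (ℝ → ℝ) → ℝ
  riemannSum f = sum λ i → f (tag i) * width i

IsIntegral : ℝ → ℝ → (ℝ → ℝ) → ℝ → Set
IsIntegral a b f I = ∀ ε → 0ℝ < ε → Σ[ δ ∈ ℝ ] 0ℝ < δ ×
  ((π : TaggedPartition a b) → let open TaggedPartition π in
    Finer δ → ∣ riemannSum f - I ∣ < ε)

-- ∫₀^∞ f ≈ L: f is integrable on [0 , b] for every b ≥ 0, and the integrals
-- converge to L as b → ∞.
∫₀^∞_≈_ : (ℝ → ℝ) → ℝ → Set
∫₀^∞ f ≈ L = Σ[ I ∈ (∀ b → 0ℝ ≤ b → ℝ) ]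
  (∀ b (0≤b : 0ℝ ≤ b) → IsIntegral 0ℝ b f (I b 0≤b)) ×
  (∀ ε → 0ℝ < ε → ∃[ B ] ∀ b (0≤b : 0ℝ ≤ b) → B ≤ b → ∣ I b 0≤b - L ∣ < ε)

P : ℕ → ℝ → ℝ
P m t = sum {m} λ i → let j = suc (toℕ i) in
  fromℤ (-1ℤ ℤ.^ (m ℕ.+ j) ℤ.* + S m j) * t ^ j

{-# OPTIONS --safe #-}
-- Combinatorial side.  Let K∣W be the subgraph of K_λ induced on a set W of
-- vertices with n_i members in part i, and let p_W = ∏ P_{n_i}.  The sources of
-- an acyclic orientation of K∣W with W ≠ ∅ form a nonempty subset of a single
-- part, and the acyclic orientations having all of A among their sources
-- correspond to those of K∣(W ∖ A).  Inclusion–exclusion gives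
--   AO(K∣W) = − Σ_A (−1)^|A| AO(K∣(W ∖ A)),
-- summed over the nonempty A ⊆ W inside one part.  The operator identity
-- P_{m+1} = t (P_m − P_m′) gives p_W′ = − Σ_A (−1)^|A| p_{W ∖ A} over the same
-- A.  Integration by parts, ∫ e⁻ᵗ p = p(0) + ∫ e⁻ᵗ p′, with p_W(0) = 0 for
-- W ≠ ∅, then proves ∫ e⁻ᵗ p_W = AO(K∣W) by induction on |W|.
--
-- Analytic side.  All real operations act termwise on Cauchy sequences, so the
-- estimates are made on rationals, at a fixed index n, for the truncated
-- exponential: with Q − Q′ = p, the function − e⁻ᵗ Q(t) has derivative e⁻ᵗ p(t)
-- up to a quadratic error and a term vanishing as n → ∞, which bounds the
-- Riemann sums by telescoping.  Decay at infinity comes from eᵗ e⁻ᵗ = 1, where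
-- the left-hand side is constant because its derivative vanishes.
module Submission where

open import Defs hiding (_+_; _*_; _-_; -_; ∣_∣; _≤_; _<_; _^_; sum; product)
import Defs as Real
import Algebra.Definitions.RawSemiring as RawSemiringDefs
open import Data.Bool.Base using (Bool; true; false; T; not; _∧_; _∨_)
open import Data.Bool.Properties using (T?)
open import Data.Empty using (⊥; ⊥-elim)
open import Data.Fin.Base as Fin using (Fin; zero; suc; toℕ; inject₁; _↑ˡ_; _↑ʳ_; splitAt)
open import Data.Fin.Induction using (<-weakInduction; >-weakInduction; spo-wellFounded)
import Data.Fin.Properties as Fin
open import Data.Integer.Base as ℤ using (ℤ; -1ℤ) renaming (+_ to pos)
import Data.Integer.Properties as ℤ
import Data.Integer.Solver as ℤ
open import Data.List.Base using (List; []; _∷_; length; filter; map; _++_)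
open import Data.List.Membership.Propositional using (_∈_)
open import Data.List.Membership.Propositional.Properties
  using (∈-∃++; ∈-++⁺ˡ; ∈-++⁺ʳ; ∈-++⁻; ∈-map⁻; ∈-filter⁺; ∈-filter⁻; ∈-cartesianProductWith⁺)
open import Data.List.Properties using (length-++)
open import Data.List.Relation.Unary.All as ListAll using ([]; _∷_)
open import Data.List.Relation.Unary.AllPairs using ([]; _∷_)
open import Data.List.Relation.Unary.Any using (here; there)
open import Data.List.Relation.Unary.Unique.Propositional using (Unique)
import Data.List.Relation.Unary.Unique.Propositional.Properties as Unique
open import Data.Nat.Base as ℕ using (ℕ; zero; suc; _⊔_; NonZero)
open import Data.Nat.Induction using (<-wellFounded)
import Data.Nat.Properties as ℕ
open import Data.Product.Base using (Σ-syntax; ∃-syntax; _×_; _,_; proj₁; proj₂)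
open import Data.Rational.Base as ℚ using (ℚ; 0ℚ; 1ℚ; ½; _/_; toℚᵘ; positive)
import Data.Rational.Properties as ℚ
open import Data.Rational.Solver using (module +-*-Solver)
open +-*-Solver using (solve; con; _:+_; _:*_; _:-_; :-_; _:=_)
import Data.Rational.Unnormalised.Base as ℚᵘ
import Data.Rational.Unnormalised.Properties as ℚᵘ
open import Data.Sum.Base using (_⊎_; inj₁; inj₂; [_,_]′)
open import Data.Vec.Base as Vec using (Vec; []; _∷_; lookup; tabulate)
open import Data.Vec.Functional using (Vector)
import Data.Vec.Properties as Vec
open import Data.Vec.Relation.Unary.All using (All; []; _∷_)
open import Function.Base using (_∘_; const)
open import Function.Bundles using (mk⇔)
open import Induction.WellFounded using (Acc; acc)
open import Level using (0ℓ)
open import Relation.Binary.Construct.Closure.Transitive as Closure using (TransClosure; [_]; _∷_)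
open import Relation.Binary.Core using (Rel)
open import Relation.Binary.Definitions using (Decidable)
open import Relation.Binary.PropositionalEquality
  using (_≡_; _≗_; refl; sym; trans; cong; cong₂; subst; subst₂; isEquivalence; module ≡-Reasoning)
open import Relation.Binary.Structures using (IsStrictPartialOrder)
open import Relation.Nullary.Decidable
  using (Dec; yes; no; does; does-⇔; isYes; toWitness; fromWitness; ¬?; _×-dec_; _⊎-dec_; _→-dec_)
open import Relation.Nullary.Negation using (¬_)
import Relation.Unary as Unary

-- No integral is transformed along the induction. A value `L` is carried together with a polynomial
-- `Q` such that `Q - Q′ = p` and `Q 0ℚ ≡ L`. Such pairs are closed under linear combinations and
-- integration by parts, and the Riemann integral is computed once, from the final `Q`. The
-- truncated exponential is not its own derivative, since differentiation drops the last term. This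
-- is why `Derivative` allows an error `e n`, and why estimates hold only from some index on.
-- Likewise an inequality between reals constrains the `n`-th approximations only up to a positive
-- slack; the slack can be chosen after the partition and so may depend on its number of intervals.
-- On the combinatorial side, deleting vertices would change the vertex type, and with it the list
-- of digraphs. Instead the vertex set stays fixed, deleted vertices become isolated, and the
-- induction runs over families of subsets of the parts.

-- Uniform derivatives of sequences of rational functions.

module Calculus where

  open import Data.Rational.Base using (_+_; _*_; _-_; -_; ∣_∣; _≤_; _<_)
  open RawSemiringDefs ℚ.+-*-rawSemiring using () renaming (_^_ to _^ℚ_)

  Eventually : (ℕ → Set) → Set
  Eventually Q = ∃[ N ] ∀ n → N ℕ.≤ n → Q n

  private
    variable
      Q R : ℕ → Set

  eventually-map : (∀ {n} → Q n → R n) → Eventually Q → Eventually R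
  eventually-map f (N , h) = N , λ n N≤n → f (h n N≤n)

  eventually-∧ : Eventually Q → Eventually R → Eventually (λ n → Q n × R n)
  eventually-∧ (M , h) (N , k) = M ⊔ N , λ n le →
    h n (ℕ.m⊔n≤o⇒m≤o M N le) , k n (ℕ.m⊔n≤o⇒n≤o M N le)

  eventually-∀ : ∀ {k} {Q : Fin k → ℕ → Set} → (∀ i → Eventually (Q i)) → Eventually (λ n → ∀ i → Q i n)
  eventually-∀ {zero}  h = 0 , λ _ _ ()
  eventually-∀ {suc k} h = eventually-map (λ { (q , r) zero → q ; (q , r) (suc i) → r i })
    (eventually-∧ (h zero) (eventually-∀ (h ∘ suc)))

  private
    variable
      a b c d p q x y B ε : ℚ

  0≤1 : 0ℚ ≤ 1ℚ
  0≤1 = ℚ.nonNegative⁻¹ 1ℚ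

  0<1 : 0ℚ < 1ℚ
  0<1 = ℚ.positive⁻¹ 1ℚ

  p≤∣p∣ : ∀ p → p ≤ ∣ p ∣
  p≤∣p∣ p = [ (λ 0≤p → ℚ.≤-reflexive (sym (ℚ.0≤p⇒∣p∣≡p 0≤p)))
            , (λ p≤0 → ℚ.≤-trans p≤0 (ℚ.0≤∣p∣ p)) ]′ (ℚ.≤-total 0ℚ p)

  *-pos : 0ℚ < p → 0ℚ < q → 0ℚ < p * q
  *-pos {p} {q} 0<p 0<q = subst (_< p * q) (ℚ.*-zeroʳ p) (<-monoʳ 0<p 0<q)

  +-pos-nonNeg : 0ℚ < p → 0ℚ ≤ q → 0ℚ < p + q
  +-pos-nonNeg 0<p 0≤q = ℚ.<-≤-trans 0<p (p≤p+q 0≤q)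

  +-nonNeg : 0ℚ ≤ p → 0ℚ ≤ q → 0ℚ ≤ p + q
  +-nonNeg 0≤p 0≤q = ℚ.≤-trans 0≤p (p≤p+q 0≤q)

  ∣+∣≤ : ∀ p q → ∣ p ∣ ≤ a → ∣ q ∣ ≤ b → ∣ p + q ∣ ≤ a + b
  ∣+∣≤ p q p≤a q≤b = ℚ.≤-trans (ℚ.∣p+q∣≤∣p∣+∣q∣ p q) (ℚ.+-mono-≤ p≤a q≤b)

  ∣*∣≤ : ∀ p q → ∣ p ∣ ≤ a → ∣ q ∣ ≤ b → ∣ p * q ∣ ≤ a * b
  ∣*∣≤ p q p≤a q≤b = subst (_≤ _) (sym (ℚ.∣p*q∣≡∣p∣*∣q∣ p q))
    (*-mono-≤ (ℚ.≤-trans (ℚ.0≤∣p∣ p) p≤a) (ℚ.0≤∣p∣ q) p≤a q≤b)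

  ∣-∣≤ : ∀ p → ∣ p ∣ ≤ a → ∣ - p ∣ ≤ a
  ∣-∣≤ p = subst (_≤ _) (sym (ℚ.∣-p∣≡∣p∣ p))

  ∣p-q∣≤B+B : ∀ p q → ∣ p ∣ ≤ B → ∣ q ∣ ≤ B → ∣ p - q ∣ ≤ B + B
  ∣p-q∣≤B+B p q p≤B q≤B = ∣+∣≤ p (- q) p≤B (∣-∣≤ q q≤B)

  -- F′ is the derivative of F on [- B , B], uniformly in n, up to an error e n
  -- that vanishes as n → ∞.
  record Derivative (B : ℚ) (F F′ : ℕ → ℚ → ℚ) : Set where
    field
      C    : ℚ
      0<C  : 0ℚ < C
      e    : ℕ → ℚ
      0≤e  : ∀ n → 0ℚ ≤ e n
      e≤C  : ∀ n → e n ≤ C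
      e→0  : ∀ {ε} → 0ℚ < ε → Eventually (λ n → e n ≤ ε)
      F≤C  : ∀ n x → ∣ x ∣ ≤ B → ∣ F n x ∣ ≤ C
      F′≤C : ∀ n x → ∣ x ∣ ≤ B → ∣ F′ n x ∣ ≤ C
      est  : ∀ n x y → ∣ x ∣ ≤ B → ∣ y ∣ ≤ B →
             ∣ F n y - F n x - F′ n x * (y - x) ∣ ≤ (C * ∣ y - x ∣ + e n) * ∣ y - x ∣

    0≤C : 0ℚ ≤ C
    0≤C = ℚ.<⇒≤ 0<C

    -- On `[- B , B]` the factor `C * ∣ y - x ∣ + e n` is at most `C * (B + B) + C`; the last `C`
    -- bounds `F′`.
    L : ℚ
    L = C * (B + B) + C + C

    0≤L : 0ℚ ≤ B → 0ℚ ≤ L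
    0≤L 0≤B = +-nonNeg (+-nonNeg (*-nonNeg 0≤C (+-nonNeg 0≤B 0≤B)) 0≤C) 0≤C

    lipschitz : ∀ n x y → ∣ x ∣ ≤ B → ∣ y ∣ ≤ B → ∣ F n y - F n x ∣ ≤ L * ∣ y - x ∣
    lipschitz n x y x≤B y≤B = subst₂ _≤_
      (cong ∣_∣ (solve 4 (λ u v f d → (v :- u :- f :* d) :+ f :* d := v :- u) refl (F n x) (F n y) (F′ n x) (y - x)))
      (sym (ℚ.*-distribʳ-+ ∣ y - x ∣ (C * (B + B) + C) C))
      (∣+∣≤ (F n y - F n x - F′ n x * (y - x)) (F′ n x * (y - x))
        (ℚ.≤-trans (est n x y x≤B y≤B)
          (≤-monoˡ (ℚ.0≤∣p∣ (y - x)) (ℚ.+-mono-≤ (≤-monoʳ 0≤C (∣p-q∣≤B+B y x y≤B x≤B)) (e≤C n))))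
        (∣*∣≤ (F′ n x) (y - x) (F′≤C n x x≤B) ℚ.≤-refl))

  private
    variable
      F F′ G G′ : ℕ → ℚ → ℚ

  derivative-ext : (∀ n x → F n x ≡ G n x) → (∀ n x → F′ n x ≡ G′ n x) → Derivative B F F′ → Derivative B G G′
  derivative-ext F≡G F′≡G′ D = record
    { C = C ; 0<C = 0<C ; e = e ; 0≤e = 0≤e ; e≤C = e≤C ; e→0 = e→0
    ; F≤C  = λ n x x≤B → subst (λ v → ∣ v ∣ ≤ C) (F≡G n x) (F≤C n x x≤B)
    ; F′≤C = λ n x x≤B → subst (λ v → ∣ v ∣ ≤ C) (F′≡G′ n x) (F′≤C n x x≤B)
    ; est  = λ n x y x≤B y≤B → subst (λ v → ∣ v ∣ ≤ (C * ∣ y - x ∣ + e n) * ∣ y - x ∣)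
        (cong₂ _-_ (cong₂ _-_ (F≡G n y) (F≡G n x)) (cong (_* (y - x)) (F′≡G′ n x))) (est n x y x≤B y≤B)
    }
    where open Derivative D

  derivative-affine : (C : ℚ) → 0ℚ < C → (∀ n x → ∣ x ∣ ≤ B → ∣ F n x ∣ ≤ C) →
    (∀ n x → ∣ x ∣ ≤ B → ∣ F′ n x ∣ ≤ C) →
    (∀ n x y → F n y - F n x - F′ n x * (y - x) ≡ 0ℚ) → Derivative B F F′
  derivative-affine C 0<C F≤C F′≤C affine = record
    { C = C ; 0<C = 0<C ; e = λ _ → 0ℚ ; 0≤e = λ _ → ℚ.≤-refl ; e≤C = λ _ → ℚ.<⇒≤ 0<C
    ; e→0 = λ 0<ε → 0 , λ _ _ → ℚ.<⇒≤ 0<ε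
    ; F≤C = F≤C ; F′≤C = F′≤C
    ; est = λ n x y _ _ → subst (λ v → ∣ v ∣ ≤ (C * ∣ y - x ∣ + 0ℚ) * ∣ y - x ∣) (sym (affine n x y))
        (*-nonNeg (+-nonNeg (*-nonNeg (ℚ.<⇒≤ 0<C) (ℚ.0≤∣p∣ (y - x))) (ℚ.≤-refl {0ℚ})) (ℚ.0≤∣p∣ (y - x)))
    }

  derivative-const : ∀ c → Derivative B (λ _ _ → c) (λ _ _ → 0ℚ)
  -- The summand 1 keeps the constant positive when `c` is 0.
  derivative-const c = derivative-affine (1ℚ + ∣ c ∣) (+-pos-nonNeg 0<1 (ℚ.0≤∣p∣ c))
    (λ _ _ _ → p≤q+p 0≤1) (λ _ _ _ → +-nonNeg 0≤1 (ℚ.0≤∣p∣ c))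
    (λ _ x y → solve 3 (λ c x y → c :- c :- con 0ℚ :* (y :- x) := con 0ℚ) refl c x y)

  derivative-id : 0ℚ ≤ B → Derivative B (λ _ x → x) (λ _ _ → 1ℚ)
  derivative-id {B} 0≤B = derivative-affine (1ℚ + B) (+-pos-nonNeg 0<1 0≤B)
    (λ _ _ x≤B → ℚ.≤-trans x≤B (p≤q+p 0≤1)) (λ _ _ _ → p≤p+q 0≤B)
    (λ _ x y → solve 2 (λ x y → y :- x :- con 1ℚ :* (y :- x) := con 0ℚ) refl x y)

  derivative-+ : Derivative B F F′ → Derivative B G G′ →
    Derivative B (λ n x → F n x + G n x) (λ n x → F′ n x + G′ n x)
  derivative-+ {F = F} {F′} {G} {G′} DF DG = record
    { C = F.C + G.C ; 0<C = +-pos-nonNeg F.0<C G.0≤C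
    ; e = λ n → F.e n + G.e n
    ; 0≤e = λ n → +-nonNeg (F.0≤e n) (G.0≤e n)
    ; e≤C = λ n → ℚ.+-mono-≤ (F.e≤C n) (G.e≤C n)
    ; e→0 = λ {ε} 0<ε → eventually-map (λ (h , k) → subst (_ ≤_) (half+half ε) (ℚ.+-mono-≤ h k))
        (eventually-∧ (F.e→0 (half>0 0<ε)) (G.e→0 (half>0 0<ε)))
    ; F≤C = λ n x x≤B → ∣+∣≤ (F n x) (G n x) (F.F≤C n x x≤B) (G.F≤C n x x≤B)
    ; F′≤C = λ n x x≤B → ∣+∣≤ (F′ n x) (G′ n x) (F.F′≤C n x x≤B) (G.F′≤C n x x≤B)
    ; est = λ n x y x≤B y≤B → subst₂ _≤_
        (cong ∣_∣ (solve 7 (λ u v f a b g d → (v :- u :- f :* d) :+ (b :- a :- g :* d) := (v :+ b) :- (u :+ a) :-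
          (f :+ g) :* d)
          refl (F n x) (F n y) (F′ n x) (G n x) (G n y) (G′ n x) (y - x)))
        (solve 5 (λ C e C′ e′ d → (C :* d :+ e) :* d :+ (C′ :* d :+ e′) :* d := ((C :+ C′) :* d :+ (e :+ e′)) :* d)
          refl F.C (F.e n) G.C (G.e n) ∣ y - x ∣)
        (∣+∣≤ (F n y - F n x - F′ n x * (y - x)) (G n y - G n x - G′ n x * (y - x)) (F.est n x y x≤B y≤B)
          (G.est n x y x≤B y≤B))
    }
    where
    module F = Derivative DF
    module G = Derivative DG

  *-vanishes : {e : ℕ → ℚ} → 0ℚ < c → (∀ {ε} → 0ℚ < ε → Eventually (λ n → e n ≤ ε)) →
    0ℚ < ε → Eventually (λ n → c * e n ≤ ε)
  *-vanishes {c = c} 0<c e→0 0<ε with shrink 0<c 0<ε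
  ... | δ , 0<δ , cδ≡ε = eventually-map (λ e≤δ → subst (c * _ ≤_) cδ≡ε (≤-monoʳ (ℚ.<⇒≤ 0<c) e≤δ)) (e→0 0<δ)

  -- With remainders `ρF` and `ρG` of the factors, the remainder of the product is `F x * ρG + G x *
  -- ρF + (F y - F x) * (G y - G x)`. The last term is quadratic because both factors are Lipschitz,
  -- hence the summand `F.L * G.L` in the constant.
  derivative-* : 0ℚ ≤ B → Derivative B F F′ → Derivative B G G′ →
    Derivative B (λ n x → F n x * G n x) (λ n x → F n x * G′ n x + F′ n x * G n x)
  derivative-* {F = F} {F′} {G} {G′} 0≤B DF DG = record
    { C = CC ; 0<C = +-pos-nonNeg (+-pos-nonNeg 0<FG (ℚ.<⇒≤ 0<FG)) (*-nonNeg (F.0≤L 0≤B) (G.0≤L 0≤B))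
    ; e = λ n → F.C * G.e n + G.C * F.e n
    ; 0≤e = λ n → +-nonNeg (*-nonNeg F.0≤C (G.0≤e n)) (*-nonNeg G.0≤C (F.0≤e n))
    ; e≤C = λ n → ℚ.≤-trans (ℚ.+-mono-≤ (≤-monoʳ F.0≤C (G.e≤C n))
        (ℚ.≤-trans (≤-monoʳ G.0≤C (F.e≤C n)) (ℚ.≤-reflexive (ℚ.*-comm G.C F.C)))) 2FG≤CC
    ; e→0 = λ {ε} 0<ε → eventually-map (λ (h , k) → subst (_ ≤_) (half+half ε) (ℚ.+-mono-≤ h k))
        (eventually-∧ (*-vanishes F.0<C G.e→0 (half>0 0<ε)) (*-vanishes G.0<C F.e→0 (half>0 0<ε)))
    ; F≤C = λ n x x≤B → ℚ.≤-trans (∣*∣≤ (F n x) (G n x) (F.F≤C n x x≤B) (G.F≤C n x x≤B))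
        (ℚ.≤-trans (p≤p+q (ℚ.<⇒≤ 0<FG)) 2FG≤CC)
    ; F′≤C = λ n x x≤B → ℚ.≤-trans (∣+∣≤ (F n x * G′ n x) (F′ n x * G n x)
        (∣*∣≤ (F n x) (G′ n x) (F.F≤C n x x≤B) (G.F′≤C n x x≤B))
        (∣*∣≤ (F′ n x) (G n x) (F.F′≤C n x x≤B) (G.F≤C n x x≤B))) 2FG≤CC
    ; est = λ n x y x≤B y≤B → subst₂ _≤_
        (cong ∣_∣ (solve 7 (λ u v f a b g d →
            u :* (b :- a :- g :* d) :+ a :* (v :- u :- f :* d) :+ (v :- u) :* (b :- a)
              := v :* b :- u :* a :- (u :* g :+ f :* a) :* d)
          refl (F n x) (F n y) (F′ n x) (G n x) (G n y) (G′ n x) (y - x)))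
        (solve 7 (λ C e L C′ e′ L′ d →
            C :* ((C′ :* d :+ e′) :* d) :+ C′ :* ((C :* d :+ e) :* d) :+ (L :* d) :* (L′ :* d)
              := ((C :* C′ :+ C :* C′ :+ L :* L′) :* d :+ (C :* e′ :+ C′ :* e)) :* d)
          refl F.C (F.e n) F.L G.C (G.e n) G.L ∣ y - x ∣)
        (∣+∣≤ (F n x * (G n y - G n x - G′ n x * (y - x)) + G n x * (F n y - F n x - F′ n x * (y - x)))
              ((F n y - F n x) * (G n y - G n x))
          (∣+∣≤ (F n x * (G n y - G n x - G′ n x * (y - x))) (G n x * (F n y - F n x - F′ n x * (y - x)))
            (∣*∣≤ (F n x) (G n y - G n x - G′ n x * (y - x)) (F.F≤C n x x≤B) (G.est n x y x≤B y≤B))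
            (∣*∣≤ (G n x) (F n y - F n x - F′ n x * (y - x)) (G.F≤C n x x≤B) (F.est n x y x≤B y≤B)))
          (∣*∣≤ (F n y - F n x) (G n y - G n x) (F.lipschitz n x y x≤B y≤B) (G.lipschitz n x y x≤B y≤B)))
    }
    where
    module F = Derivative DF
    module G = Derivative DG
    CC : ℚ
    CC = F.C * G.C + F.C * G.C + F.L * G.L
    0<FG : 0ℚ < F.C * G.C
    0<FG = *-pos F.0<C G.0<C
    2FG≤CC : F.C * G.C + F.C * G.C ≤ CC
    2FG≤CC = p≤p+q (*-nonNeg (F.0≤L 0≤B) (G.0≤L 0≤B))

  derivative-reflect : Derivative B F F′ → Derivative B (λ n x → F n (- x)) (λ n x → - F′ n (- x))
  derivative-reflect {B} {F} {F′} D = record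
    { C = C ; 0<C = 0<C ; e = e ; 0≤e = 0≤e ; e≤C = e≤C ; e→0 = e→0
    ; F≤C  = λ n x x≤B → F≤C n (- x) (∣-∣≤ x x≤B)
    ; F′≤C = λ n x x≤B → ∣-∣≤ (F′ n (- x)) (F′≤C n (- x) (∣-∣≤ x x≤B))
    ; est  = λ n x y x≤B y≤B → subst₂ _≤_
        (cong ∣_∣ (solve 5 (λ u v f x y → v :- u :- f :* (:- y :- :- x) := v :- u :- (:- f) :* (y :- x))
          refl (F n (- x)) (F n (- y)) (F′ n (- x)) x y))
        (cong (λ d → (C * d + e n) * d) (∣-∣-reflect x y))
        (est n (- x) (- y) (∣-∣≤ x x≤B) (∣-∣≤ y y≤B))
    }
    where
    open Derivative D
    ∣-∣-reflect : ∀ x y → ∣ - y - - x ∣ ≡ ∣ y - x ∣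
    ∣-∣-reflect x y = trans (cong ∣_∣ (solve 2 (λ x y → :- y :- :- x := :- (y :- x)) refl x y)) (ℚ.∣-p∣≡∣p∣ (y - x))

  -- Second-order estimates for powers and exponential sums.

  -- The next remainder is `y` times the present one plus `(k + 2) * x ^ (k + 1) * (y - x)²`. The
  -- constant is twice the sharp one, so that division by `(k + 2)!` turns it into `B ^ k / k!`, a
  -- term of the exponential series.
  ^-taylor : 0ℚ ≤ B → ∣ x ∣ ≤ B → ∣ y ∣ ≤ B → ∀ k →
    ∣ y ^ℚ suc (suc k) - x ^ℚ suc (suc k) - ι (suc (suc k)) * x ^ℚ suc k * (y - x) ∣
      ≤ ι (suc (suc k)) * ι (suc k) * B ^ℚ k * (∣ y - x ∣ * ∣ y - x ∣)
  ^-taylor {B} {x} {y} 0≤B x≤B y≤B zero = subst₂ _≤_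
    (cong ∣_∣ (solve 2 (λ x y → (y :- x) :* (y :- x)
        := y :* (y :* con 1ℚ) :- x :* (x :* con 1ℚ) :- con (ι 2) :* (x :* con 1ℚ) :* (y :- x)) refl x y))
    (solve 1 (λ D → D :* D :+ D :* D := con (ι 2) :* con (ι 1) :* con 1ℚ :* (D :* D)) refl D)
    (ℚ.≤-trans (ℚ.≤-reflexive (ℚ.∣p*q∣≡∣p∣*∣q∣ (y - x) (y - x)))
      (p≤p+q (*-nonNeg (ℚ.0≤∣p∣ (y - x)) (ℚ.0≤∣p∣ (y - x)))))
    where
    D : ℚ
    D = ∣ y - x ∣
  ^-taylor {B} {x} {y} 0≤B x≤B y≤B (suc k) = ℚ.≤-trans
    (subst₂ _≤_
      (cong ∣_∣ (trans (solve 6 (λ x y u v i w →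
          y :* (v :- u :- i :* w :* (y :- x)) :+ i :* w :* ((y :- x) :* (y :- x))
            := y :* v :- (y :* u :- i :* w :* (y :- x) :* (y :- x) :+ i :* w :* y :* (y :- x)) ) refl
          x y (x * w) (y ^ℚ suc (suc k)) i w)
        (trans (solve 5 (λ x y v i w →
          y :* v :- (y :* (x :* w) :- i :* w :* (y :- x) :* (y :- x) :+ i :* w :* y :* (y :- x))
            := y :* v :- x :* (x :* w) :- (i :+ con 1ℚ) :* (x :* w) :* (y :- x)) refl
          x y (y ^ℚ suc (suc k)) i w)
        (cong (λ j → y * y ^ℚ suc (suc k) - x * (x * w) - j * (x * w) * (y - x)) (sym (ι-suc (suc (suc k))))))))
      (solve 5 (λ i j B b D → B :* (i :* j :* b :* D) :+ i :* (B :* b) :* D := i :* (j :+ con 1ℚ) :* (B :* b) :* D)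
        refl i (ι (suc k)) B (B ^ℚ k) DD)
      (∣+∣≤ (y * (y ^ℚ suc (suc k) - x * w - i * w * (y - x))) (i * w * ((y - x) * (y - x)))
        (∣*∣≤ y (y ^ℚ suc (suc k) - x * w - i * w * (y - x)) y≤B (^-taylor 0≤B x≤B y≤B k))
        (∣*∣≤ (i * w) ((y - x) * (y - x))
          (∣*∣≤ i w (ℚ.≤-reflexive (ℚ.0≤p⇒∣p∣≡p (ι≥0 (suc (suc k))))) (∣^∣≤ x≤B (suc k)))
          (ℚ.≤-reflexive (ℚ.∣p*q∣≡∣p∣*∣q∣ (y - x) (y - x))))))
    (≤-monoˡ (*-nonNeg (ℚ.0≤∣p∣ (y - x)) (ℚ.0≤∣p∣ (y - x)))
      (≤-monoˡ (^-nonNeg 0≤B (suc k))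
        (subst (λ j → i * j ≤ ι (suc (suc (suc k))) * i) (ι-suc (suc k))
          (≤-monoˡ (ι≥0 (suc (suc k))) (ι-mono (ℕ.n≤1+n (suc (suc k))))))))
    where
    DD w i : ℚ
    DD = ∣ y - x ∣ * ∣ y - x ∣
    w = x ^ℚ suc k
    i = ι (suc (suc k))

  expTerm-taylor : 0ℚ ≤ B → ∣ x ∣ ≤ B → ∣ y ∣ ≤ B → ∀ k →
    ∣ expTerm y (suc (suc k)) - expTerm x (suc (suc k)) - expTerm x (suc k) * (y - x) ∣
      ≤ expTerm B k * (∣ y - x ∣ * ∣ y - x ∣)
  expTerm-taylor {B} {x} {y} 0≤B x≤B y≤B k = subst₂ _≤_
    (cong ∣_∣ (trans
      (solve 6 (λ u v i w d f → (v :- u :- i :* w :* d) :* f := v :* f :- u :* f :- w :* (i :* f) :* d)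
        refl (x ^ℚ suc (suc k)) (y ^ℚ suc (suc k)) (ι (suc (suc k))) (x ^ℚ suc k) (y - x) f)
      (cong (λ g → expTerm y (suc (suc k)) - expTerm x (suc (suc k)) - x ^ℚ suc k * g * (y - x)) (1/!-suc (suc k)))))
    (trans
      (solve 5 (λ i j b D f → i :* j :* b :* D :* f := b :* (j :* (i :* f)) :* D)
        refl (ι (suc (suc k))) (ι (suc k)) (B ^ℚ k) DD f)
      (cong (λ g → B ^ℚ k * g * DD) (trans (cong (ι (suc k) *_) (1/!-suc (suc k))) (1/!-suc k))))
    (∣*∣≤ (y ^ℚ suc (suc k) - x ^ℚ suc (suc k) - ι (suc (suc k)) * x ^ℚ suc k * (y - x)) f
      (^-taylor 0≤B x≤B y≤B k) (ℚ.≤-reflexive (ℚ.0≤p⇒∣p∣≡p (1/!≥0 (suc (suc k))))))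
    where
    f DD : ℚ
    f = 1/ suc (suc k) !
    DD = ∣ y - x ∣ * ∣ y - x ∣

  -- The derivative of a sum of `n + 2` terms is the sum of `n + 1` terms. Adding the bounds for the
  -- single terms gives an exponential sum at `B`, which is bounded uniformly in `n`.
  expSum-taylor : 0ℚ ≤ B → ∣ x ∣ ≤ B → ∣ y ∣ ≤ B → ∀ n →
    ∣ expSum y (suc (suc n)) - expSum x (suc (suc n)) - expSum x (suc n) * (y - x) ∣
      ≤ expSum B n * (∣ y - x ∣ * ∣ y - x ∣)
  expSum-taylor {B} {x} {y} 0≤B x≤B y≤B zero = ℚ.≤-reflexive (trans
    (cong ∣_∣ (solve 2 (λ x y → (con 1ℚ :+ y :* con 1ℚ :* con 1ℚ) :- (con 1ℚ :+ x :* con 1ℚ :* con 1ℚ) :- con 1ℚ :*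
      (y :- x) := con 0ℚ) refl x y))
    (sym (ℚ.*-zeroˡ (∣ y - x ∣ * ∣ y - x ∣))))
  expSum-taylor {B} {x} {y} 0≤B x≤B y≤B (suc n) = subst₂ _≤_
    (cong ∣_∣ (solve 7 (λ E e F f G g d → (F :- E :- G :* d) :+ (f :- e :- g :* d) := (F :+ f) :- (E :+ e) :-
      (G :+ g) :* d)
      refl (expSum x (suc (suc n))) (expTerm x (suc (suc n))) (expSum y (suc (suc n))) (expTerm y (suc (suc n)))
        (expSum x (suc n)) (expTerm x (suc n)) (y - x)))
    (sym (ℚ.*-distribʳ-+ (∣ y - x ∣ * ∣ y - x ∣) (expSum B n) (expTerm B n)))
    (∣+∣≤ (expSum y (suc (suc n)) - expSum x (suc (suc n)) - expSum x (suc n) * (y - x))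
      (expTerm y (suc (suc n)) - expTerm x (suc (suc n)) - expTerm x (suc n) * (y - x))
      (expSum-taylor 0≤B x≤B y≤B n) (expTerm-taylor 0≤B x≤B y≤B n))

  E : ℕ → ℚ → ℚ
  E n x = expSum x n

  -- Replacing the true derivative `expSum x (suc n)` of `expSum x (suc (suc n))` by the sum itself
  -- costs the term `expTerm x (suc n)`. So `e` is the sequence of terms of the series at the bound,
  -- shifted by one.
  derivative-exp : 0ℚ ≤ B → Derivative B E E
  derivative-exp {B₀} 0≤B₀ = record
    { C = X.C ; 0<C = X.C>0 ; e = e
    ; 0≤e = λ { zero → ℚ.≤-refl ; (suc m) → X.t≥0 m }
    ; e≤C = λ { zero → ℚ.<⇒≤ X.C>0 ; (suc m) → ℚ.≤-trans (p≤q+p (X.s-mono {0} {m} (ℕ.≤⇒≤′ ℕ.z≤n))) (X.s≤C (suc m)) }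
    ; e→0 = λ 0<ε → let J , h = X.t-small 0<ε in
        suc (suc J) , λ { (suc (suc m)) (ℕ.s≤s (ℕ.s≤s J≤m)) → h m J≤m }
    ; F≤C = F≤C ; F′≤C = F≤C
    ; est = λ n x y x≤B y≤B → est n x y (ℚ.≤-trans x≤B B₀≤B) (ℚ.≤-trans y≤B B₀≤B)
    }
    where
    -- The constant sequence gives access to the bounds on exponential sums; they refer to `X.B`,
    -- which is at least `B₀`.
    module X = ExpCauchy {const B₀} (const-cauchy B₀)
    B₀≤B : B₀ ≤ X.B
    B₀≤B = ℚ.≤-trans (p≤∣p∣ B₀) (X.x≤B 0)
    e : ℕ → ℚ
    e zero    = 0ℚ
    e (suc m) = X.t m
    F≤C : ∀ n x → ∣ x ∣ ≤ B₀ → ∣ expSum x n ∣ ≤ X.C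
    F≤C n x x≤B = ℚ.≤-trans
      (subst (_≤ X.s n)
        (trans (ℚ.+-identityˡ ∣ 0ℚ - expSum x n ∣)
          (trans (cong ∣_∣ (ℚ.+-identityˡ (- expSum x n))) (ℚ.∣-p∣≡∣p∣ (expSum x n))))
        (expSum-tail (ℚ.≤-trans x≤B B₀≤B) {0} {n} (ℕ.≤⇒≤′ ℕ.z≤n)))
      (X.s≤C n)
    est : ∀ n x y → ∣ x ∣ ≤ X.B → ∣ y ∣ ≤ X.B →
          ∣ expSum y n - expSum x n - expSum x n * (y - x) ∣ ≤ (X.C * ∣ y - x ∣ + e n) * ∣ y - x ∣
    est zero x y _ _ = subst (λ v → ∣ v ∣ ≤ (X.C * ∣ y - x ∣ + 0ℚ) * ∣ y - x ∣)
      (solve 1 (λ d → con 0ℚ := con 0ℚ :- con 0ℚ :- con 0ℚ :* d) refl (y - x))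
      (*-nonNeg (+-nonNeg (*-nonNeg (ℚ.<⇒≤ X.C>0) (ℚ.0≤∣p∣ (y - x))) (ℚ.≤-refl {0ℚ})) (ℚ.0≤∣p∣ (y - x)))
    est (suc zero) x y _ _ = subst₂ _≤_
      (trans (trans (ℚ.*-identityˡ ∣ y - x ∣) (sym (ℚ.∣-p∣≡∣p∣ (y - x))))
        (cong ∣_∣ (solve 1 (λ d → :- d := con 1ℚ :- con 1ℚ :- con 1ℚ :* d) refl (y - x))))
      refl
      (≤-monoˡ (ℚ.0≤∣p∣ (y - x)) (p≤q+p {1ℚ} (*-nonNeg (ℚ.<⇒≤ X.C>0) (ℚ.0≤∣p∣ (y - x)))))
    est (suc (suc n)) x y x≤B y≤B = subst₂ _≤_
      (cong ∣_∣ (solve 5 (λ F E G g d → (F :- E :- G :* d) :+ (:- g) :* d := F :- E :- (G :+ g) :* d)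
        refl (expSum y (suc (suc n))) (expSum x (suc (suc n))) (expSum x (suc n)) (expTerm x (suc n)) (y - x)))
      (solve 3 (λ C e d → C :* (d :* d) :+ e :* d := (C :* d :+ e) :* d) refl X.C (X.t (suc n)) ∣ y - x ∣)
      (∣+∣≤ (expSum y (suc (suc n)) - expSum x (suc (suc n)) - expSum x (suc n) * (y - x))
        (- expTerm x (suc n) * (y - x))
        (ℚ.≤-trans (expSum-taylor (ℚ.<⇒≤ X.B>0) x≤B y≤B n)
          (≤-monoˡ (*-nonNeg (ℚ.0≤∣p∣ (y - x)) (ℚ.0≤∣p∣ (y - x))) (X.s≤C n)))
        (∣*∣≤ (- expTerm x (suc n)) (y - x) (∣-∣≤ (expTerm x (suc n)) (∣expTerm∣≤ x≤B (suc n))) ℚ.≤-refl))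

  derivative-exp-neg : 0ℚ ≤ B → Derivative B (λ n x → E n (- x)) (λ n x → - E n (- x))
  derivative-exp-neg 0≤B = derivative-reflect (derivative-exp 0≤B)

  -- Subdivide [0 , x] into steps on which the derivative estimate is applied.
  zero-derivative⇒close : 0ℚ ≤ B → ∀ {F} → Derivative B F (λ _ _ → 0ℚ) →
    Eventually (λ n → ∀ x → ∣ x ∣ ≤ B → ∣ F n x - F n 0ℚ ∣ ≤ 1ℚ)
  zero-derivative⇒close {B} 0≤B {F} D = eventually-map final (e→0 0<η)
    where
    open Derivative D
    -- With `M` steps of size `h = x * r`, where `r = 1 / M`, the accumulated error `M * κ` is at
    -- most `C * B * B * r + B * e n`. The choices `M ≥ 2 * C * B * B` and `(1 + B) * η = ½` make
    -- each part at most one half.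
    CBB : ℚ
    CBB = C * B * B + C * B * B
    M : ℕ
    M = suc (proj₁ (archimedean CBB))
    CBB≤M : CBB ≤ ι M
    CBB≤M = ℚ.≤-trans (proj₂ (archimedean CBB)) (ι-mono (ℕ.n≤1+n (proj₁ (archimedean CBB))))
    r : ℚ
    r = proj₁ (shrink (ι-suc>0 (proj₁ (archimedean CBB))) 0<1)
    0<r : 0ℚ < r
    0<r = proj₁ (proj₂ (shrink (ι-suc>0 (proj₁ (archimedean CBB))) 0<1))
    Mr≡1 : ι M * r ≡ 1ℚ
    Mr≡1 = proj₂ (proj₂ (shrink (ι-suc>0 (proj₁ (archimedean CBB))) 0<1))
    0<B+1 : 0ℚ < 1ℚ + B
    0<B+1 = +-pos-nonNeg 0<1 0≤B
    η : ℚ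
    η = proj₁ (shrink 0<B+1 (half>0 0<1))
    0<η : 0ℚ < η
    0<η = proj₁ (proj₂ (shrink 0<B+1 (half>0 0<1)))
    Bη≤½ : B * η ≤ 1ℚ * ½
    Bη≤½ = ℚ.≤-trans (≤-monoˡ {η} {B} {1ℚ + B} (ℚ.<⇒≤ 0<η) (p≤q+p 0≤1))
      (ℚ.≤-reflexive (proj₂ (proj₂ (shrink 0<B+1 (half>0 0<1)))))
    CBBr≤½ : C * B * B * r ≤ 1ℚ * ½
    CBBr≤½ = subst₂ _≤_
      (solve 2 (λ c r → (c :+ c) :* r :* con ½ := c :* r) refl (C * B * B) r)
      (cong (_* ½) Mr≡1) (≤-monoˡ (ℚ.<⇒≤ (half>0 0<1)) (≤-monoˡ {r} (ℚ.<⇒≤ 0<r) CBB≤M))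
    module _ (n : ℕ) (x : ℚ) (x≤B : ∣ x ∣ ≤ B) where
      h κ : ℚ
      h = x * r
      κ = (C * ∣ h ∣ + e n) * ∣ h ∣
      r≥0 : ∣ r ∣ ≡ r
      r≥0 = ℚ.0≤p⇒∣p∣≡p (ℚ.<⇒≤ 0<r)
      ∣h∣ : ∣ h ∣ ≡ ∣ x ∣ * r
      ∣h∣ = trans (ℚ.∣p*q∣≡∣p∣*∣q∣ x r) (cong (∣ x ∣ *_) r≥0)
      kh≤B : ∀ {k} → k ℕ.≤ M → ∣ ι k * h ∣ ≤ B
      kh≤B {k} k≤M = subst₂ _≤_
        (sym (trans (ℚ.∣p*q∣≡∣p∣*∣q∣ (ι k) h) (cong₂ _*_ (ℚ.0≤p⇒∣p∣≡p (ι≥0 k)) ∣h∣)))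
        (trans (solve 3 (λ m x r → m :* (x :* r) := m :* r :* x) refl (ι M) B r)
          (trans (cong (_* B) Mr≡1) (ℚ.*-identityˡ B)))
        (*-mono-≤ (ι≥0 M) (*-nonNeg (ℚ.0≤∣p∣ x) (ℚ.<⇒≤ 0<r)) (ι-mono k≤M) (≤-monoˡ (ℚ.<⇒≤ 0<r) x≤B))
      steps : ∀ k → k ℕ.≤ M → ∣ F n (ι k * h) - F n 0ℚ ∣ ≤ ι k * κ
      steps zero    _   = ℚ.≤-reflexive (trans
        (cong (λ v → ∣ F n v - F n 0ℚ ∣) (ℚ.*-zeroˡ h)) (trans (∣p-p∣≡0 (F n 0ℚ)) (sym (ℚ.*-zeroˡ κ))))
      steps (suc k) k<M = subst₂ _≤_
        (cong ∣_∣ (solve 4 (λ u v w d → (v :- u :- con 0ℚ :* d) :+ (u :- w) := v :- w) refl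
          (F n (ι k * h)) (F n (ι (suc k) * h)) (F n 0ℚ) (ι (suc k) * h - ι k * h)))
        (trans (solve 2 (λ i κ → κ :+ i :* κ := (i :+ con 1ℚ) :* κ) refl (ι k) κ) (cong (_* κ) (sym (ι-suc k))))
        (∣+∣≤ (F n (ι (suc k) * h) - F n (ι k * h) - 0ℚ * (ι (suc k) * h - ι k * h)) (F n (ι k * h) - F n 0ℚ)
          (subst (λ d → ∣ F n (ι (suc k) * h) - F n (ι k * h) - 0ℚ * (ι (suc k) * h - ι k * h) ∣ ≤
            (C * ∣ d ∣ + e n) * ∣ d ∣)
            (trans (cong (λ j → j * h - ι k * h) (ι-suc k))
              (solve 2 (λ i h → (i :+ con 1ℚ) :* h :- i :* h := h) refl (ι k) h))
            (est n (ι k * h) (ι (suc k) * h) (kh≤B (ℕ.<⇒≤ k<M)) (kh≤B k<M)))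
          (steps k (ℕ.<⇒≤ k<M)))
      Mh≡x : ι M * h ≡ x
      Mh≡x = trans (solve 3 (λ m x r → m :* (x :* r) := m :* r :* x) refl (ι M) x r)
        (trans (cong (_* x) Mr≡1) (ℚ.*-identityˡ x))
      Mκ≤1 : e n ≤ η → ι M * κ ≤ 1ℚ
      Mκ≤1 e≤η = ℚ.≤-trans
        (ℚ.≤-reflexive (trans (cong (λ d → ι M * ((C * d + e n) * d)) ∣h∣)
          (trans (solve 5 (λ m c x r e → m :* ((c :* (x :* r) :+ e) :* (x :* r)) := m :* r :*
            (c :* x :* x :* r :+ x :* e)) refl
              (ι M) C ∣ x ∣ r (e n))
            (trans (cong (_* (C * ∣ x ∣ * ∣ x ∣ * r + ∣ x ∣ * e n)) Mr≡1) (ℚ.*-identityˡ _)))))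
        (subst (C * ∣ x ∣ * ∣ x ∣ * r + ∣ x ∣ * e n ≤_) (half+half 1ℚ)
          (ℚ.+-mono-≤
            (ℚ.≤-trans (≤-monoˡ (ℚ.<⇒≤ 0<r)
              (*-mono-≤ (*-nonNeg 0≤C 0≤B) (ℚ.0≤∣p∣ x) (≤-monoʳ 0≤C x≤B) x≤B)) CBBr≤½)
            (ℚ.≤-trans (*-mono-≤ 0≤B (0≤e n) x≤B e≤η) Bη≤½)))
    final : ∀ {n} → e n ≤ η → ∀ x → ∣ x ∣ ≤ B → ∣ F n x - F n 0ℚ ∣ ≤ 1ℚ
    final {n} e≤η x x≤B = subst (λ v → ∣ F n v - F n 0ℚ ∣ ≤ 1ℚ) (Mh≡x n x x≤B)
      (ℚ.≤-trans (steps n x x≤B M ℕ.≤-refl) (Mκ≤1 n x x≤B e≤η))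

  expSum-0 : ∀ n → expSum 0ℚ (suc n) ≡ 1ℚ
  expSum-0 zero    = refl
  expSum-0 (suc n) = trans (cong₂ _+_ (expSum-0 n)
    (trans (cong (_* 1/ suc n !) (ℚ.*-zeroˡ (0ℚ ^ℚ n))) (ℚ.*-zeroˡ (1/ suc n !)))) refl

  -- For decay a bound suffices, so the product is only kept within 1 of its value at 0. That value
  -- is 1 once `1 ≤ n`; for `n = 0` the sums are empty.
  exp*exp-neg≤2 : 0ℚ ≤ B → Eventually (λ n → ∀ x → ∣ x ∣ ≤ B → ∣ E n (- x) * E n x ∣ ≤ 1ℚ + 1ℚ)
  exp*exp-neg≤2 {B} 0≤B = eventually-map
    (λ { {zero} (() , _) ; {suc n} (_ , close) x x≤B → ℚ.≤-trans
      (∣p∣≤∣q∣+∣p-q∣ (E (suc n) (- x) * E (suc n) x) (E (suc n) (- 0ℚ) * E (suc n) 0ℚ))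
      (ℚ.+-mono-≤ (ℚ.≤-reflexive (cong (λ v → ∣ v * v ∣) (expSum-0 n))) (close x x≤B)) })
    (eventually-∧ {Q = λ n → 1 ℕ.≤ n} (1 , λ _ 1≤n → 1≤n) (zero-derivative⇒close 0≤B
      (derivative-ext (λ _ _ → refl)
        (λ n x → solve 2 (λ u v → u :* v :+ (:- u) :* v := con 0ℚ) refl (E n (- x)) (E n x))
        (derivative-* 0≤B (derivative-exp-neg 0≤B) (derivative-exp 0≤B)))))

  -- Polynomials: derivatives, growth, and decay against the exponential.

  -- Functions paired with their formal derivatives, generated by operations under which both
  -- derivative estimates and growth bounds propagate. `ext` stands in for function extensionality.
  data Polynomial : (ℚ → ℚ) → (ℚ → ℚ) → Set where
    constant : ∀ c → Polynomial (λ _ → c) (λ _ → 0ℚ)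
    var   : Polynomial (λ x → x) (λ _ → 1ℚ)
    _⊕_   : ∀ {f f′ g g′} → Polynomial f f′ → Polynomial g g′ →
            Polynomial (λ x → f x + g x) (λ x → f′ x + g′ x)
    _⊗_   : ∀ {f f′ g g′} → Polynomial f f′ → Polynomial g g′ →
            Polynomial (λ x → f x * g x) (λ x → f x * g′ x + f′ x * g x)
    ext   : ∀ {f f′ g g′} → f ≗ g → f′ ≗ g′ → Polynomial f f′ → Polynomial g g′

  derivative-polynomial : 0ℚ ≤ B → ∀ {f f′} → Polynomial f f′ → Derivative B (λ _ → f) (λ _ → f′)
  derivative-polynomial 0≤B (constant c) = derivative-const c
  derivative-polynomial 0≤B var        = derivative-id 0≤B
  derivative-polynomial 0≤B (p ⊕ q)    = derivative-+ (derivative-polynomial 0≤B p) (derivative-polynomial 0≤B q)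
  derivative-polynomial 0≤B (p ⊗ q)    = derivative-* 0≤B (derivative-polynomial 0≤B p) (derivative-polynomial 0≤B q)
  derivative-polynomial 0≤B (ext f g p) = derivative-ext (λ _ → f) (λ _ → g) (derivative-polynomial 0≤B p)

  ^-distribˡ-+ : ∀ x j k → x ^ℚ (j ℕ.+ k) ≡ x ^ℚ j * x ^ℚ k
  ^-distribˡ-+ x zero    k = sym (ℚ.*-identityˡ (x ^ℚ k))
  ^-distribˡ-+ x (suc j) k = trans (cong (x *_) (^-distribˡ-+ x j k)) (sym (ℚ.*-assoc x (x ^ℚ j) (x ^ℚ k)))

  1≤^ : 1ℚ ≤ x → ∀ k → 1ℚ ≤ x ^ℚ k
  1≤^ 1≤x zero    = ℚ.≤-refl
  1≤^ {x} 1≤x (suc k) = *-mono-≤ {1ℚ} {x} {1ℚ} {x ^ℚ k} (ℚ.≤-trans 0≤1 1≤x) 0≤1 1≤x (1≤^ 1≤x k)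

  -- For `1ℚ ≤ x` higher powers dominate lower ones, so the exponents may be added for sums as well
  -- as for products.
  polynomial-growth : ∀ {f f′} → Polynomial f f′ →
    Σ[ M ∈ ℚ ] 0ℚ ≤ M × ∃[ k ] ∀ x → 1ℚ ≤ x → ∣ f x ∣ ≤ M * x ^ℚ k
  polynomial-growth (constant c) = ∣ c ∣ , ℚ.0≤∣p∣ c , 0 , λ _ _ → ℚ.≤-reflexive (sym (ℚ.*-identityʳ ∣ c ∣))
  polynomial-growth var = 1ℚ , 0≤1 , 1 , λ x 1≤x → ℚ.≤-reflexive
    (trans (ℚ.0≤p⇒∣p∣≡p (ℚ.≤-trans 0≤1 1≤x)) (sym (trans (ℚ.*-identityˡ (x ^ℚ 1)) (ℚ.*-identityʳ x))))
  polynomial-growth (_⊕_ {f = f} {g = g} p q) with polynomial-growth p | polynomial-growth q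
  ... | M , 0≤M , j , f≤ | N , 0≤N , k , g≤ = M + N , +-nonNeg 0≤M 0≤N , j ℕ.+ k , λ x 1≤x →
    subst (∣ f x + g x ∣ ≤_) (sym (ℚ.*-distribʳ-+ (x ^ℚ (j ℕ.+ k)) M N)) (∣+∣≤ (f x) (g x)
      (ℚ.≤-trans (f≤ x 1≤x) (≤-monoʳ 0≤M (bound x 1≤x j k)))
      (ℚ.≤-trans (g≤ x 1≤x) (≤-monoʳ 0≤N (subst (λ i → x ^ℚ k ≤ x ^ℚ i) (ℕ.+-comm k j) (bound x 1≤x k j)))))
    where
    bound : ∀ x → 1ℚ ≤ x → ∀ j k → x ^ℚ j ≤ x ^ℚ (j ℕ.+ k)
    bound x 1≤x j k = subst₂ _≤_ (ℚ.*-identityʳ (x ^ℚ j)) (sym (^-distribˡ-+ x j k))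
      (≤-monoʳ (^-nonNeg (ℚ.≤-trans 0≤1 1≤x) j) (1≤^ 1≤x k))
  polynomial-growth (_⊗_ {f = f} {g = g} p q) with polynomial-growth p | polynomial-growth q
  ... | M , 0≤M , j , f≤ | N , 0≤N , k , g≤ = M * N , *-nonNeg 0≤M 0≤N , j ℕ.+ k , λ x 1≤x →
    subst (∣ f x * g x ∣ ≤_)
      (trans (solve 4 (λ m u n v → (m :* u) :* (n :* v) := m :* n :* (u :* v)) refl M (x ^ℚ j) N (x ^ℚ k))
        (cong (M * N *_) (sym (^-distribˡ-+ x j k))))
      (∣*∣≤ (f x) (g x) (f≤ x 1≤x) (g≤ x 1≤x))
  polynomial-growth (ext f≗g _ p) with polynomial-growth p
  ... | M , 0≤M , k , f≤ = M , 0≤M , k , λ x 1≤x → subst (λ v → ∣ v ∣ ≤ M * x ^ℚ k) (f≗g x) (f≤ x 1≤x)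

  expTerm≥0 : 0ℚ ≤ x → ∀ k → 0ℚ ≤ expTerm x k
  expTerm≥0 {x} 0≤x k = *-nonNeg {x ^ℚ k} {1/ k !} (^-nonNeg 0≤x k) (1/!≥0 k)

  expSum≥0 : 0ℚ ≤ x → ∀ n → 0ℚ ≤ expSum x n
  expSum≥0 0≤x zero    = ℚ.≤-refl
  expSum≥0 0≤x (suc n) = +-nonNeg (expSum≥0 0≤x n) (expTerm≥0 0≤x n)

  expTerm≤expSum : 0ℚ ≤ x → ∀ {k n} → k ℕ.<′ n → expTerm x k ≤ expSum x n
  expTerm≤expSum 0≤x {k} (ℕ.≤′-reflexive refl) = p≤q+p (expSum≥0 0≤x k)
  expTerm≤expSum 0≤x {n = suc n} (ℕ.≤′-step k<n) = ℚ.≤-trans (expTerm≤expSum 0≤x k<n) (p≤p+q (expTerm≥0 0≤x n))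

  -- The witness is `k !` as a rational, built factor by factor so that `1/!-suc` cancels one factor
  -- at a time.
  k!>0 : ∀ k → Σ[ c ∈ ℚ ] 0ℚ < c × c * 1/ k ! ≡ 1ℚ
  k!>0 zero    = 1ℚ , 0<1 , refl
  k!>0 (suc k) with k!>0 k
  ... | c , 0<c , c/k!≡1 = c * ι (suc k) , *-pos 0<c (ι-suc>0 k) ,
    trans (ℚ.*-assoc c (ι (suc k)) (1/ suc k !)) (trans (cong (c *_) (1/!-suc k)) c/k!≡1)

  -- With `c = (k + 1)!`, the product `∣ e⁻ˣ * f x ∣ * x` is at most `M * e⁻ˣ * x ^ (k + 1)`, hence
  -- at most `M * c * e⁻ˣ * eˣ ≤ N`, because `x ^ (k + 1) / (k + 1)!` is a single term of the series
  -- of `eˣ`. Beyond `X` one has `N ≤ ε * x`. The point `X` is independent of `B`; only the index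
  -- depends on it.
  exp-beats-polynomial : ∀ {f f′} → Polynomial f f′ → 0ℚ < ε →
    Σ[ X ∈ ℚ ] ∀ {B} → 0ℚ ≤ B → Eventually (λ n → ∀ x → X ≤ x → ∣ x ∣ ≤ B → ∣ E n (- x) * f x ∣ ≤ ε)
  exp-beats-polynomial {ε} {f} p 0<ε with polynomial-growth p
  ... | M , 0≤M , k , f≤ with shrink 0<ε 0<1 | k!>0 (suc k)
  ... | δ , 0<δ , εδ≡1 | c , 0<c , c/k!≡1 = 1ℚ + δ * N , λ {B} 0≤B →
    eventually-map (λ (k<n , ≤2) x X≤x x≤B → bound k<n x X≤x (≤2 x x≤B))
      (eventually-∧ (suc (suc k) , λ _ k<n → k<n) (exp*exp-neg≤2 0≤B))
    where
    N : ℚ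
    N = M * c * (1ℚ + 1ℚ)
    0≤N : 0ℚ ≤ N
    0≤N = *-nonNeg {M * c} {1ℚ + 1ℚ} (*-nonNeg 0≤M (ℚ.<⇒≤ 0<c)) (+-nonNeg 0≤1 0≤1)
    0≤δN : 0ℚ ≤ δ * N
    0≤δN = *-nonNeg (ℚ.<⇒≤ 0<δ) 0≤N
    bound : ∀ {n} → suc k ℕ.< n → ∀ x → 1ℚ + δ * N ≤ x → ∣ E n (- x) * E n x ∣ ≤ 1ℚ + 1ℚ → ∣ E n (- x) * f x ∣ ≤ ε
    bound {n} k<n x X≤x ≤2 = ℚ.*-cancelʳ-≤-pos x {{positive (ℚ.<-≤-trans 0<1 1≤x)}} (begin
      ∣ E n (- x) * f x ∣ * x                          ≡⟨ cong (_* x) (ℚ.∣p*q∣≡∣p∣*∣q∣ (E n (- x)) (f x)) ⟩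
      ∣ E n (- x) ∣ * ∣ f x ∣ * x                      ≤⟨ ≤-monoˡ 0≤x (≤-monoʳ (ℚ.0≤∣p∣ (E n (- x))) (f≤ x 1≤x)) ⟩
      ∣ E n (- x) ∣ * (M * x ^ℚ k) * x                 ≡⟨ solve 4
        (λ e m v x → e :* (m :* v) :* x := m :* con 1ℚ :* (e :* (x :* v))) refl ∣ E n (- x) ∣ M (x ^ℚ k) x ⟩
      M * 1ℚ * (∣ E n (- x) ∣ * x ^ℚ suc k)            ≡⟨ cong (λ u → M * u * (∣ E n (- x) ∣ * x ^ℚ suc k)) c/k!≡1 ⟨
      M * (c * 1/ suc k !) * (∣ E n (- x) ∣ * x ^ℚ suc k) ≡⟨ solve 5
        (λ m c i e v → m :* (c :* i) :* (e :* v) := m :* c :* (e :* (v :* i))) refl M c (1/ suc k !) ∣ E n (- x) ∣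
          (x ^ℚ suc k) ⟩
      M * c * (∣ E n (- x) ∣ * expTerm x (suc k))      ≤⟨ ≤-monoʳ (*-nonNeg 0≤M (ℚ.<⇒≤ 0<c))
        (≤-monoʳ (ℚ.0≤∣p∣ (E n (- x))) (expTerm≤expSum 0≤x (ℕ.≤⇒≤′ k<n))) ⟩
      M * c * (∣ E n (- x) ∣ * E n x)                  ≤⟨ ≤-monoʳ (*-nonNeg 0≤M (ℚ.<⇒≤ 0<c))
        (ℚ.≤-trans (≤-monoʳ (ℚ.0≤∣p∣ (E n (- x))) (p≤∣p∣ (E n x)))
          (ℚ.≤-reflexive (sym (ℚ.∣p*q∣≡∣p∣*∣q∣ (E n (- x)) (E n x))))) ⟩
      M * c * ∣ E n (- x) * E n x ∣                    ≤⟨ ≤-monoʳ (*-nonNeg 0≤M (ℚ.<⇒≤ 0<c)) ≤2 ⟩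
      N                                                ≡⟨ ℚ.*-identityˡ N ⟨
      1ℚ * N                                           ≡⟨ cong (_* N) εδ≡1 ⟨
      ε * δ * N                                        ≡⟨ ℚ.*-assoc ε δ N ⟩
      ε * (δ * N)                                      ≤⟨ ≤-monoʳ (ℚ.<⇒≤ 0<ε) (ℚ.≤-trans (p≤q+p 0≤1) X≤x) ⟩
      ε * x                                            ∎)
      where
      open ℚ.≤-Reasoning
      1≤x : 1ℚ ≤ x
      1≤x = ℚ.≤-trans (p≤p+q 0≤δN) X≤x
      0≤x : 0ℚ ≤ x
      0≤x = ℚ.≤-trans 0≤1 1≤x

-- Riemann sums and the improper integral.

module Integration where

  open import Data.Rational.Base using (_+_; _*_; _-_; -_; ∣_∣; _≤_; _<_)
  open RawSemiringDefs ℚ.+-*-rawSemiring using (sum)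
  open Calculus

  private
    variable
      p q B ε : ℚ
      F F′ : ℕ → ℚ → ℚ

  -- Reduces an inequality to a ring identity that writes the difference of its sides as an
  -- expression known to be nonnegative.
  ≤-by : ∀ {z} → 0ℚ ≤ z → z ≡ q - p → p ≤ q
  ≤-by {q} {p} 0≤z refl = subst₂ _≤_ (ℚ.+-identityʳ p)
    (solve 2 (λ p q → p :+ (q :- p) := q) refl p q) (ℚ.+-monoʳ-≤ p 0≤z)

  0≤difference : p ≤ q → 0ℚ ≤ q - p
  0≤difference {p} {q} p≤q = subst (_≤ q - p) (ℚ.+-inverseʳ p) (ℚ.+-monoˡ-≤ (- p) p≤q)

  module _ (D : Derivative B F F′) where
    open Derivative D

    -- The step of a Riemann sum over [x , y] with tag s, where the inequalities
    -- x ≤ s ≤ y hold only up to η.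
    riemann-step : ∀ n {x s y δ η} → ∣ x ∣ ≤ B → ∣ s ∣ ≤ B → ∣ y ∣ ≤ B → 0ℚ ≤ δ → 0ℚ ≤ η →
      x ≤ s + η → s ≤ y + η → y - x ≤ δ →
      ∣ F′ n s * (y - x) - (F n y - F n x) ∣ ≤ (C * (δ + η) + e n) * (y - x + (η + η + (η + η)))
    riemann-step n {x} {s} {y} {δ} {η} x≤B s≤B y≤B 0≤δ 0≤η x≤s s≤y y-x≤δ = subst₂ _≤_
      (cong ∣_∣ (solve 7 (λ u v w f x s y → (u :- w :- f :* (x :- s)) :+ :- (v :- w :- f :* (y :- s))
          := f :* (y :- x) :- (v :- u)) refl (F n x) (F n y) (F n s) (F′ n s) x s y))
      (solve 5 (λ κ x s y η → κ :* (s :- x :+ (η :+ η)) :+ κ :* (y :- s :+ (η :+ η))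
        := κ :* (y :- x :+ (η :+ η :+ (η :+ η)))) refl (C * (δ + η) + e n) x s y η)
      (∣+∣≤ (F n x - F n s - F′ n s * (x - s)) (- (F n y - F n s - F′ n s * (y - s)))
        (ℚ.≤-trans (est n s x s≤B x≤B) (bound (x - s)
          (≤-by (+-nonNeg hx 0≤δ) (solve 4 (λ x s δ η → (s :+ η :- x) :+ δ := δ :+ η :- (x :- s)) refl x s δ η))
          (≤-by (+-nonNeg hy hd) (solve 5 (λ x s y δ η → (y :+ η :- s) :+ (δ :- (y :- x)) := δ :+ η :- :- (x :- s))
            refl x s y δ η))
          (≤-by (+-nonNeg hx hx) (solve 3
            (λ x s η → (s :+ η :- x) :+ (s :+ η :- x) := s :- x :+ (η :+ η) :- (x :- s)) refl x s η))
          (≤-by (+-nonNeg 0≤η 0≤η) (solve 3 (λ x s η → η :+ η := s :- x :+ (η :+ η) :- :- (x :- s)) refl x s η))))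
        (∣-∣≤ (F n y - F n s - F′ n s * (y - s)) (ℚ.≤-trans (est n s y s≤B y≤B) (bound (y - s)
          (≤-by (+-nonNeg hx hd) (solve 5 (λ x s y δ η → (s :+ η :- x) :+ (δ :- (y :- x)) := δ :+ η :- (y :- s))
            refl x s y δ η))
          (≤-by (+-nonNeg hy 0≤δ) (solve 4 (λ y s δ η → (y :+ η :- s) :+ δ := δ :+ η :- :- (y :- s)) refl y s δ η))
          (≤-by (+-nonNeg 0≤η 0≤η) (solve 3 (λ y s η → η :+ η := y :- s :+ (η :+ η) :- (y :- s)) refl y s η))
          (≤-by (+-nonNeg hy hy) (solve 3
            (λ y s η → (y :+ η :- s) :+ (y :+ η :- s) := y :- s :+ (η :+ η) :- :- (y :- s)) refl y s η))))))
      where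
      hx = 0≤difference x≤s
      hy = 0≤difference s≤y
      hd = 0≤difference y-x≤δ
      -- The distance `∣ d ∣` from the tag is estimated twice: by `δ + η` inside the bracket, where
      -- smallness counts, and by `l`, a signed length plus `η + η`, so that the two halves of the
      -- step add up to `y - x` plus four times `η`.
      bound : ∀ d {l} → d ≤ δ + η → - d ≤ δ + η → d ≤ l → - d ≤ l →
        (C * ∣ d ∣ + e n) * ∣ d ∣ ≤ (C * (δ + η) + e n) * l
      bound d h k u v = *-mono-≤ (+-nonNeg (*-nonNeg 0≤C (+-nonNeg 0≤δ 0≤η)) (0≤e n)) (ℚ.0≤∣p∣ d)
        (ℚ.+-monoˡ-≤ (e n) (≤-monoʳ 0≤C (≤⇒∣∣≤ h k))) (≤⇒∣∣≤ u v)

  telescope : ∀ N (a : Vector ℚ N) (x : Vector ℚ (suc N)) (F : ℚ → ℚ) κ h →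
    (∀ i → ∣ a i - (F (x (suc i)) - F (x (inject₁ i))) ∣ ≤ κ * (x (suc i) - x (inject₁ i) + h)) →
    ∣ sum a - (F (x (Fin.fromℕ N)) - F (x zero)) ∣ ≤ κ * (x (Fin.fromℕ N) - x zero + ι N * h)
  telescope zero a x F κ h _ = ℚ.≤-reflexive (trans
    (cong ∣_∣ (solve 1 (λ u → con 0ℚ :- (u :- u) := con 0ℚ) refl (F (x zero))))
    (solve 3 (λ κ x h → con 0ℚ := κ :* (x :- x :+ con 0ℚ :* h)) refl κ (x zero) h))
  telescope (suc N) a x F κ h step = subst₂ _≤_
    (cong ∣_∣ (solve 5 (λ a s u v w → (a :- (v :- u)) :+ (s :- (w :- v)) := a :+ s :- (w :- u)) refl
      (a zero) (sum (a ∘ suc)) (F (x zero)) (F (x (suc zero))) (F (x (Fin.fromℕ (suc N))))))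
    (trans (solve 6 (λ κ x y z h i → κ :* (y :- x :+ h) :+ κ :* (z :- y :+ i :* h) := κ :*
      (z :- x :+ (i :+ con 1ℚ) :* h)) refl
        κ (x zero) (x (suc zero)) (x (Fin.fromℕ (suc N))) h (ι N))
      (cong (λ i → κ * (x (Fin.fromℕ (suc N)) - x zero + i * h)) (sym (ι-suc N))))
    (∣+∣≤ (a zero - (F (x (suc zero)) - F (x zero))) (sum (a ∘ suc) - (F (x (Fin.fromℕ (suc N))) - F (x (suc zero))))
      (step zero) (telescope N (a ∘ suc) (x ∘ suc) F κ h (step ∘ suc)))

  seq-sum : ∀ {N} (v : Vector ℝ N) n → seq (Real.sum v) n ≡ sum (λ i → seq (v i) n)
  seq-sum {zero}  v n = refl
  seq-sum {suc N} v n = cong (seq (v zero) n +_) (seq-sum (v ∘ suc) n)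

  sum-cong : ∀ {k} {u v : Vector ℚ k} → (∀ i → u i ≡ v i) → sum u ≡ sum v
  sum-cong {zero}  _   = refl
  sum-cong {suc k} u≡v = cong₂ _+_ (u≡v zero) (sum-cong (u≡v ∘ suc))

  ≤ℝ-trans : ∀ {x y z} → x Real.≤ y → y Real.≤ z → x Real.≤ z
  ≤ℝ-trans {x} {y} {z} (*≤* x≤y) (*≤* y≤z) = *≤* λ ε 0<ε → eventually-map
    (λ {n} (h , k) → subst (seq x n <_)
      (trans (ℚ.+-assoc (seq z n) (ε * ½) (ε * ½)) (cong (seq z n +_) (half+half ε)))
      (ℚ.<-trans h (ℚ.+-monoˡ-< (ε * ½) k)))
    (eventually-∧ (x≤y (ε * ½) (half>0 0<ε)) (y≤z (ε * ½) (half>0 0<ε)))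

  p<q+∣p-q∣ : ∣ p - q ∣ < ε → p < q + ε
  p<q+∣p-q∣ {p} {q} h = ℚ.≤-<-trans
    (subst (_≤ q + ∣ p - q ∣) (solve 2 (λ p q → q :+ (p :- q) := p) refl p q) (ℚ.+-monoʳ-≤ q (p≤∣p∣ (p - q))))
    (ℚ.+-monoʳ-< q h)

  ≃⇒≤ : ∀ {x y} → x ≃ y → x Real.≤ y
  ≃⇒≤ (*≃* x≃y) = *≤* λ ε 0<ε → eventually-map p<q+∣p-q∣ (x≃y ε 0<ε)

  ≃⇒≥ : ∀ {x y} → x ≃ y → y Real.≤ x
  ≃⇒≥ {x} {y} (*≃* x≃y) = *≤* λ ε 0<ε → eventually-map
    (λ {n} h → p<q+∣p-q∣ (subst (_< ε) (∣p-q∣≡∣q-p∣ (seq x n) (seq y n)) h)) (x≃y ε 0<ε)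

  module _ {a b : ℝ} (π : TaggedPartition a b) where
    open TaggedPartition π

    -- These four bounds keep all points and tags, at late indices, in the interval where the
    -- derivative estimate applies.
    a≤point : ∀ i → a Real.≤ point i
    a≤point = <-weakInduction (λ i → a Real.≤ point i) (≃⇒≥ first)
      λ i a≤p → ≤ℝ-trans a≤p (≤ℝ-trans (left i) (right i))

    point≤b : ∀ i → point i Real.≤ b
    point≤b = >-weakInduction (λ i → point i Real.≤ b) (≃⇒≤ last)
      λ i p≤b → ≤ℝ-trans (≤ℝ-trans (left i) (right i)) p≤b

    a≤tag : ∀ i → a Real.≤ tag i
    a≤tag i = ≤ℝ-trans (a≤point (inject₁ i)) (left i)

    tag≤b : ∀ i → tag i Real.≤ b
    tag≤b i = ≤ℝ-trans (right i) (point≤b (suc i))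

  -- The integrand enters only through its `n`-th approximation at `t`, which is a function of
  -- `seq t n`. So a real Riemann sum is, index by index, a rational one.
  module LaplaceIntegral {p Q Q′ : ℚ → ℚ} (poly : Polynomial Q Q′) (Q-Q′≡p : ∀ x → Q x - Q′ x ≡ p x)
    (f : ℝ → ℝ) (f≡ : ∀ t n → seq (f t) n ≡ E n (- seq t n) * p (seq t n)) where

    F₀ : ℕ → ℚ → ℚ
    F₀ n x = - (E n (- x) * Q x)

    abstract
      derivative : 0ℚ ≤ B → Derivative B F₀ (λ n x → E n (- x) * p x)
      derivative 0≤B = derivative-ext
        (λ n x → solve 1 (λ u → con (- 1ℚ) :* u := :- u) refl (E n (- x) * Q x))
        (λ n x → trans
          (solve 3 (λ u q q′ → con (- 1ℚ) :* (u :* q′ :+ (:- u) :* q) :+ con 0ℚ :* (u :* q) := u :* (q :- q′)) refl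
            (E n (- x)) (Q x) (Q′ x))
          (cong (E n (- x) *_) (Q-Q′≡p x)))
        (derivative-* 0≤B (derivative-const (- 1ℚ))
          (derivative-* 0≤B (derivative-exp-neg 0≤B) (derivative-polynomial 0≤B poly)))

    Q-cauchy : ∀ b → IsCauchy (λ n → Q (seq b n))
    Q-cauchy b ε 0<ε = N , λ m n N≤m N≤n → ℚ.≤-<-trans
      (lipschitz 0 (seq b n) (seq b m) (b≤β n) (b≤β m))
      (ℚ.≤-<-trans (≤-monoˡ (ℚ.0≤∣p∣ (seq b m - seq b n)) (p≤q+p {L} {1ℚ} 0≤1))
        (subst ((1ℚ + L) * ∣ seq b m - seq b n ∣ <_) Lδ≡ε (<-monoʳ 0<1+L (close m n N≤m N≤n))))
      where
      β = proj₁ (cauchy-bounded b)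
      0<β = proj₁ (proj₂ (cauchy-bounded b))
      b≤β = proj₂ (proj₂ (cauchy-bounded b))
      open Derivative (derivative-polynomial (ℚ.<⇒≤ 0<β) poly)
      0<1+L : 0ℚ < 1ℚ + L
      0<1+L = +-pos-nonNeg 0<1 (0≤L (ℚ.<⇒≤ 0<β))
      δ = proj₁ (shrink 0<1+L 0<ε)
      Lδ≡ε = proj₂ (proj₂ (shrink 0<1+L 0<ε))
      N = proj₁ (cauchy b δ (proj₁ (proj₂ (shrink 0<1+L 0<ε))))
      close = proj₂ (cauchy b δ (proj₁ (proj₂ (shrink 0<1+L 0<ε))))

    Qℝ : ℝ → ℝ
    Qℝ b = mkℝ (λ n → Q (seq b n)) (Q-cauchy b)

    I : ℝ → ℝ
    I b = fromℚ (Q 0ℚ) Real.- (exp (Real.- b) Real.* Qℝ b)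

    F₀-0 : ∀ n → F₀ (suc n) 0ℚ ≡ - Q 0ℚ
    F₀-0 n = cong -_ (trans (cong (_* Q 0ℚ) (expSum-0 n)) (ℚ.*-identityˡ (Q 0ℚ)))

    module _ (b : ℝ) (ε₀ : ℚ) (0<ε₀ : 0ℚ < ε₀) where

      B₀ B₁ : ℚ
      B₀ = proj₁ (cauchy-bounded b)
      B₁ = B₀ + 1ℚ

      0≤B₁ : 0ℚ ≤ B₁
      0≤B₁ = +-nonNeg (ℚ.<⇒≤ (proj₁ (proj₂ (cauchy-bounded b)))) 0≤1

      b≤B₀ : ∀ n → ∣ seq b n ∣ ≤ B₀
      b≤B₀ = proj₂ (proj₂ (cauchy-bounded b))

      D : Derivative B₁ F₀ (λ n x → E n (- x) * p x)
      D = derivative 0≤B₁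

      open Derivative D

      -- The error `ε₀ / 2` is split into `ε₀ / 4` for the steps and `ε₀ / 8` for each end. `W`
      -- bounds the length of the partition plus the slack, so a unit of length may cost `τ`, half
      -- of which pays for `e n`. With `K₀ * δ = τ / 2`, the two summands of `K₀` give `δ ≤ 1ℚ` and
      -- `2 * C * δ ≤ τ / 2`.
      W K₀ : ℚ
      W = 1ℚ + (B₁ + B₁)

      0<W : 0ℚ < W
      0<W = +-pos-nonNeg 0<1 (+-nonNeg 0≤B₁ 0≤B₁)

      τ-spec : Σ[ τ ∈ ℚ ] 0ℚ < τ × W * τ ≡ ε₀ * ½ * ½
      τ-spec = shrink 0<W (half>0 (half>0 0<ε₀))

      τ : ℚ
      τ = proj₁ τ-spec

      0<τ : 0ℚ < τ
      0<τ = proj₁ (proj₂ τ-spec)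

      K₀ = τ * ½ + (C + C)

      δ-spec : Σ[ δ ∈ ℚ ] 0ℚ < δ × K₀ * δ ≡ τ * ½
      δ-spec = shrink (+-pos-nonNeg (half>0 0<τ) (+-nonNeg 0≤C 0≤C)) (half>0 0<τ)

      δ : ℚ
      δ = proj₁ δ-spec

      0<δ : 0ℚ < δ
      0<δ = proj₁ (proj₂ δ-spec)

      0≤δ : 0ℚ ≤ δ
      0≤δ = ℚ.<⇒≤ 0<δ

      2Cδ≤τ½ : C * (δ + δ) ≤ τ * ½
      2Cδ≤τ½ = ≤-by (*-nonNeg (ℚ.<⇒≤ (half>0 0<τ)) 0≤δ) (trans
        (solve 3 (λ t c d → t :* d := (t :+ (c :+ c)) :* d :- c :* (d :+ d)) refl (τ * ½) C δ)
        (cong (_- C * (δ + δ)) (proj₂ (proj₂ δ-spec))))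

      δ≤1 : δ ≤ 1ℚ
      δ≤1 = ℚ.*-cancelˡ-≤-pos (τ * ½) {{positive (half>0 0<τ)}} (≤-by (*-nonNeg (+-nonNeg 0≤C 0≤C) 0≤δ) (trans
        (solve 3 (λ t c d → (c :+ c) :* d := (t :+ (c :+ c)) :* d :- t :* d) refl (τ * ½) C δ)
        (cong (_- τ * ½ * δ) (trans (proj₂ (proj₂ δ-spec)) (sym (ℚ.*-identityʳ (τ * ½)))))))

      end-spec : Σ[ η ∈ ℚ ] 0ℚ < η × (1ℚ + L) * η ≡ ε₀ * ½ * ½ * ½
      end-spec = shrink (+-pos-nonNeg 0<1 (0≤L 0≤B₁)) (half>0 (half>0 (half>0 0<ε₀)))

      -- The end points of a partition are only equivalent to 0 and `b`, so their `n`-th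
      -- approximations may differ; the Lipschitz bound absorbs this.
      end : ∀ n {x y} → ∣ x ∣ ≤ B₁ → ∣ y ∣ ≤ B₁ → ∣ y - x ∣ < proj₁ end-spec → ∣ F₀ n y - F₀ n x ∣ ≤ ε₀ * ½ * ½ * ½
      end n {x} {y} x≤B y≤B h = ℚ.≤-trans (lipschitz n x y x≤B y≤B)
        (subst (L * ∣ y - x ∣ ≤_) (proj₂ (proj₂ end-spec))
          (*-mono-≤ (+-nonNeg 0≤1 (0≤L 0≤B₁)) (ℚ.0≤∣p∣ (y - x)) (p≤q+p {L} {1ℚ} 0≤1) (ℚ.<⇒≤ h)))

      module _ (π : TaggedPartition 0ℝ b) where
        open TaggedPartition π

        -- The fineness `δ` is fixed before the partition is known, but the slack `η` in comparing
        -- approximations may depend on it: `size` steps with slack `4 * η` each cost at most `δ` in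
        -- total.
        η-spec : Σ[ η ∈ ℚ ] 0ℚ < η × (1ℚ + ι size * (1ℚ + 1ℚ + (1ℚ + 1ℚ))) * η ≡ δ
        η-spec = shrink (+-pos-nonNeg 0<1
          (*-nonNeg {ι size} {1ℚ + 1ℚ + (1ℚ + 1ℚ)} (ι≥0 size) (+-nonNeg (+-nonNeg 0≤1 0≤1) (+-nonNeg 0≤1 0≤1)))) 0<δ

        η h : ℚ
        η = proj₁ η-spec
        h = η + η + (η + η)

        0≤η : 0ℚ ≤ η
        0≤η = ℚ.<⇒≤ (proj₁ (proj₂ η-spec))

        0≤Nh : 0ℚ ≤ ι size * h
        0≤Nh = *-nonNeg {ι size} {h} (ι≥0 size) (+-nonNeg (+-nonNeg 0≤η 0≤η) (+-nonNeg 0≤η 0≤η))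

        η+Nh≡δ : η + ι size * h ≡ δ
        η+Nh≡δ = trans (solve 2 (λ n η → η :+ n :* (η :+ η :+ (η :+ η)) :=
          (con 1ℚ :+ n :* (con 1ℚ :+ con 1ℚ :+ (con 1ℚ :+ con 1ℚ))) :* η) refl (ι size) η)
          (proj₂ (proj₂ η-spec))

        η≤δ : η ≤ δ
        η≤δ = subst (η ≤_) η+Nh≡δ (p≤p+q 0≤Nh)

        Nh≤1 : ι size * h ≤ 1ℚ
        Nh≤1 = ℚ.≤-trans (subst (ι size * h ≤_) η+Nh≡δ (p≤q+p 0≤η)) δ≤1

        within : ∀ {n x} → 0ℚ < x + 1ℚ → x < seq b n + 1ℚ → ∣ x ∣ ≤ B₁
        within {n} {x} 0<x+1 x<b+1 = ≤⇒∣∣≤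
          (ℚ.≤-trans (ℚ.<⇒≤ x<b+1) (ℚ.+-monoˡ-≤ 1ℚ (ℚ.≤-trans (p≤∣p∣ (seq b n)) (b≤B₀ n))))
          (ℚ.≤-trans (≤-by (ℚ.<⇒≤ 0<x+1) (solve 1 (λ x → x :+ con 1ℚ := con 1ℚ :- :- x) refl x))
            (p≤q+p (ℚ.<⇒≤ (proj₁ (proj₂ (cauchy-bounded b))))))

        near : Finer (fromℚ δ) → Eventually (λ n → ∣ seq (riemannSum f) n - seq (I b) n ∣ ≤ ε₀ * ½)
        near finer = eventually-map (λ {n} → estimate n) (eventually-∧
          -- With no terms of the series `E 0` is 0, so the value at 0 is correct only from index 1
          -- on.
          (eventually-∧ {Q = λ n → F₀ n 0ℚ ≡ - Q 0ℚ} (1 , λ { (suc m) _ → F₀-0 m })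
            (eventually-∧ (e→0 (half>0 0<τ)) (eventually-∧
              (eventually-∀ λ i → eventually-∧ (Real._≤_.eventually (a≤point π i) 1ℚ 0<1)
                (Real._≤_.eventually (point≤b π i) 1ℚ 0<1))
              (eventually-∀ λ i → eventually-∧ (Real._≤_.eventually (a≤tag π i) 1ℚ 0<1)
                (Real._≤_.eventually (tag≤b π i) 1ℚ 0<1)))))
          (eventually-∧
            (eventually-∀ λ i → eventually-∧ (Real._≤_.eventually (left i) η (proj₁ (proj₂ η-spec)))
              (eventually-∧ (Real._≤_.eventually (right i) η (proj₁ (proj₂ η-spec))) (Real._<_.eventually (finer i))))
            (eventually-∧ (Real._≃_.eventually first (proj₁ end-spec) (proj₁ (proj₂ end-spec)))
              (Real._≃_.eventually last (proj₁ end-spec) (proj₁ (proj₂ end-spec))))))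
          where
          estimate : ∀ n →
            (F₀ n 0ℚ ≡ - Q 0ℚ × e n ≤ τ * ½ ×
              (∀ i → 0ℚ < seq (point i) n + 1ℚ × seq (point i) n < seq b n + 1ℚ) ×
              (∀ i → 0ℚ < seq (tag i) n + 1ℚ × seq (tag i) n < seq b n + 1ℚ)) ×
            (∀ i → seq (point (inject₁ i)) n < seq (tag i) n + η ×
                   seq (tag i) n < seq (point (suc i)) n + η ×
                   seq (point (suc i)) n - seq (point (inject₁ i)) n + Real._<_.gap (finer i) < δ) ×
            ∣ seq (point zero) n - 0ℚ ∣ < proj₁ end-spec ×
            ∣ seq (point (Fin.fromℕ size)) n - seq b n ∣ < proj₁ end-spec →
            ∣ seq (riemannSum f) n - seq (I b) n ∣ ≤ ε₀ * ½
          estimate n ((F₀0 , e≤ , points , tags) , steps , first≈ , last≈) = subst₂ _≤_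
            (cong ∣_∣ (trans
              (solve 6 (λ s u v w z q → s :- (v :- u) :+ :- (u :- w) :+ (v :- z) := s :- (:- w :+ z)) refl Σa
                (F₀ n (x zero)) (F₀ n (x (Fin.fromℕ size))) (F₀ n 0ℚ) (F₀ n (seq b n)) (Q 0ℚ))
              (cong₂ _-_ (sym riemannSum≡)
                (cong (_+ F₀ n (seq b n)) (trans (cong -_ F₀0) (solve 1 (λ q → :- :- q := q) refl (Q 0ℚ)))))))
            (solve 1 (λ ε → ε :* con ½ :* con ½ :+ ε :* con ½ :* con ½ :* con ½ :+ ε :* con ½ :* con ½ :* con ½ := ε :* con ½) refl ε₀)
            (∣+∣≤ (Σa - (F₀ n (x (Fin.fromℕ size)) - F₀ n (x zero)) + - (F₀ n (x zero) - F₀ n 0ℚ))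
              (F₀ n (x (Fin.fromℕ size)) - F₀ n (seq b n))
              (∣+∣≤ (Σa - (F₀ n (x (Fin.fromℕ size)) - F₀ n (x zero))) (- (F₀ n (x zero) - F₀ n 0ℚ))
                (ℚ.≤-trans (telescope size a x (F₀ n) (C * (δ + η) + e n) h step) total)
                (∣-∣≤ (F₀ n (x zero) - F₀ n 0ℚ) (end n 0≤B₁ (x≤B zero) first≈)))
              (end n (ℚ.≤-trans (b≤B₀ n) (p≤p+q 0≤1)) (x≤B (Fin.fromℕ size)) last≈))
            where
            x : Vector ℚ (suc size)
            x i = seq (point i) n
            a : Vector ℚ size
            a i = E n (- seq (tag i) n) * p (seq (tag i) n) * (x (suc i) - x (inject₁ i))
            Σa : ℚ
            Σa = sum a
            x≤B : ∀ i → ∣ x i ∣ ≤ B₁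
            x≤B i = within {n} (proj₁ (points i)) (proj₂ (points i))
            riemannSum≡ : seq (riemannSum f) n ≡ Σa
            riemannSum≡ = trans (seq-sum (λ i → f (tag i) Real.* width i) n)
              (sum-cong λ i → cong (_* (x (suc i) - x (inject₁ i))) (f≡ (tag i) n))
            step : ∀ i → ∣ a i - (F₀ n (x (suc i)) - F₀ n (x (inject₁ i))) ∣ ≤ (C * (δ + η) + e n) *
              (x (suc i) - x (inject₁ i) + h)
            step i = let l , r , w = steps i in
              riemann-step D n (x≤B (inject₁ i)) (within {n} (proj₁ (tags i)) (proj₂ (tags i))) (x≤B (suc i))
                0≤δ 0≤η (ℚ.<⇒≤ l) (ℚ.<⇒≤ r)
                (ℚ.≤-trans (p≤p+q (ℚ.<⇒≤ (Real._<_.gap>0 (finer i)))) (ℚ.<⇒≤ w))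
            total : (C * (δ + η) + e n) * (x (Fin.fromℕ size) - x zero + ι size * h) ≤ ε₀ * ½ * ½
            total = ℚ.≤-trans
              (≤-monoʳ (+-nonNeg (*-nonNeg 0≤C (+-nonNeg 0≤δ 0≤η)) (0≤e n))
                (ℚ.≤-trans (ℚ.+-mono-≤ (ℚ.≤-trans (p≤∣p∣ (x (Fin.fromℕ size) - x zero))
                  (∣p-q∣≤B+B (x (Fin.fromℕ size)) (x zero) (x≤B (Fin.fromℕ size)) (x≤B zero))) Nh≤1)
                  (ℚ.≤-reflexive (ℚ.+-comm (B₁ + B₁) 1ℚ))))
              (ℚ.≤-trans (≤-monoˡ (ℚ.<⇒≤ 0<W)
                (subst (C * (δ + η) + e n ≤_) (half+half τ)
                  (ℚ.+-mono-≤ (ℚ.≤-trans (≤-monoʳ 0≤C (ℚ.+-monoʳ-≤ δ η≤δ)) 2Cδ≤τ½) e≤)))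
                (ℚ.≤-reflexive (trans (ℚ.*-comm τ W) (proj₂ (proj₂ τ-spec)))))

    -- Strict inequality of reals demands a positive gap: half of `ε₀` bounds the error, the other
    -- half is the gap.
    strictly : ∀ {v ε₀ ε} → 0ℚ < ε₀ → v ≤ ε₀ * ½ → 0ℚ + ε₀ < ε → v + ε₀ * ½ < ε
    strictly {v} {ε₀} 0<ε₀ v≤ ε₀<ε = ℚ.≤-<-trans
      (ℚ.≤-trans (ℚ.+-monoˡ-≤ (ε₀ * ½) v≤) (ℚ.≤-reflexive (trans (half+half ε₀) (sym (ℚ.+-identityˡ ε₀))))) ε₀<ε

    isIntegral : ∀ b → IsIntegral 0ℝ b f (I b)
    isIntegral b ε (*<* ε₀ 0<ε₀ ε₀<ε) = fromℚ (δ b ε₀ 0<ε₀) ,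
      *<* (δ b ε₀ 0<ε₀ * ½) (half>0 (0<δ b ε₀ 0<ε₀)) (0 , λ _ _ → ℚ.<-≤-trans
        (ℚ.+-monoˡ-< (δ b ε₀ 0<ε₀ * ½) (half>0 (0<δ b ε₀ 0<ε₀))) (ℚ.≤-reflexive (half+half (δ b ε₀ 0<ε₀)))) ,
      λ π finer → *<* (ε₀ * ½) (half>0 0<ε₀) (eventually-map (λ (h , k) → strictly 0<ε₀ h k)
        (eventually-∧ (near b ε₀ 0<ε₀ π finer) ε₀<ε))

    integral : ∫₀^∞ f ≈ fromℚ (Q 0ℚ)
    integral = (λ b _ → I b) , (λ b _ → isIntegral b) , λ { ε (*<* ε₀ 0<ε₀ ε₀<ε) →
      let X , small = exp-beats-polynomial poly (half>0 0<ε₀) in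
      -- At index `n` the hypothesis on `b` gives only `X + 1ℚ < seq b n + 1ℚ`, with slack 1; the
      -- extra 1 in the threshold is there to cancel it.
      fromℚ (X + 1ℚ) , λ { b _ (*≤* X<b) → *<* (ε₀ * ½) (half>0 0<ε₀)
        (eventually-map (λ {n} (small , X<b , ε₀<ε) → strictly 0<ε₀
          (subst (λ v → ∣ v ∣ ≤ ε₀ * ½) (solve 2 (λ u q → :- u := q :- u :- q) refl (E n (- seq b n) * Q (seq b n))
            (Q 0ℚ))
            (∣-∣≤ (E n (- seq b n) * Q (seq b n)) (small (seq b n)
              (≤-by (ℚ.<⇒≤ (subst₂ _<_ (ℚ.+-inverseʳ (X + 1ℚ))
                (solve 2 (λ x b → b :+ con 1ℚ :- (x :+ con 1ℚ) := b :- x) refl X (seq b n))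
                (ℚ.+-monoˡ-< (- (X + 1ℚ)) X<b))) refl)
              (proj₂ (proj₂ (cauchy-bounded b)) n))))
          ε₀<ε)
        (eventually-∧ (small (ℚ.<⇒≤ (proj₁ (proj₂ (cauchy-bounded b))))) (eventually-∧ (X<b 1ℚ 0<1) ε₀<ε))) } }

-- Acyclic orientations with prescribed sources.

module SourceCounting where

  module _ {A B : Set} where

    -- Pigeonhole: the image of the head is cut out of `ys`, and injectivity keeps the images of the
    -- tail in what is left.
    injection⇒length-≤ : ∀ {xs : List A} {ys : List B} (f : A → B) → Unique xs →
      (∀ {x} → x ∈ xs → f x ∈ ys) → (∀ {x y} → x ∈ xs → y ∈ xs → f x ≡ f y → x ≡ y) → length xs ℕ.≤ length ys
    injection⇒length-≤ {[]} f _ _ _ = ℕ.z≤n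
    injection⇒length-≤ {x ∷ xs} f (x∉xs ∷ xs!) into inj with ∈-∃++ (into (here refl))
    ... | ys , zs , refl = subst (suc (length xs) ℕ.≤_)
      (sym (trans (length-++ ys) (trans (ℕ.+-suc (length ys) (length zs)) (cong suc (sym (length-++ ys))))))
      (ℕ.s≤s (injection⇒length-≤ f xs! into′ (λ x∈ y∈ → inj (there x∈) (there y∈))))
      where
      into′ : ∀ {y} → y ∈ xs → f y ∈ ys ++ zs
      into′ {y} y∈xs with ∈-++⁻ ys (into (there y∈xs))
      ... | inj₁ fy∈ys         = ∈-++⁺ˡ fy∈ys
      ... | inj₂ (here fy≡fx)  = ⊥-elim (ListAll.lookup x∉xs y∈xs (inj (here refl) (there y∈xs) (sym fy≡fx)))
      ... | inj₂ (there fy∈zs) = ∈-++⁺ʳ ys fy∈zs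

  bijection⇒length-≡ : {A B : Set} {xs : List A} {ys : List B} (f : A → B) (g : B → A) → Unique xs → Unique ys →
    (∀ {x} → x ∈ xs → f x ∈ ys × g (f x) ≡ x) → (∀ {y} → y ∈ ys → g y ∈ xs × f (g y) ≡ y) → length xs ≡ length ys
  bijection⇒length-≡ f g xs! ys! to from = ℕ.≤-antisym
    (injection⇒length-≤ f xs! (proj₁ ∘ to)
      (λ x∈ y∈ eq → trans (sym (proj₂ (to x∈))) (trans (cong g eq) (proj₂ (to y∈)))))
    (injection⇒length-≤ g ys! (proj₁ ∘ from)
      (λ x∈ y∈ eq → trans (sym (proj₂ (from x∈))) (trans (cong f eq) (proj₂ (from y∈)))))

  module _ {A : Set} {xs : List A} where

    vectors-unique : Unique xs → ∀ n → Unique (vectors xs n)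
    vectors-unique xs! zero    = [] ∷ []
    vectors-unique xs! (suc n) = Unique.cartesianProductWith⁺ _∷_ Vec.∷-injective xs! (vectors-unique xs! n)

    ∈-vectors : (∀ x → x ∈ xs) → ∀ {n} (v : Vec A n) → v ∈ vectors xs n
    ∈-vectors all []      = here refl
    ∈-vectors all (x ∷ v) = ∈-cartesianProductWith⁺ _∷_ (all x) (∈-vectors all v)

  digraphs-unique : ∀ n → Unique (digraphs n)
  digraphs-unique n = vectors-unique (vectors-unique (((λ ()) ∷ []) ∷ [] ∷ []) n) n

  ∈-digraphs : ∀ {n} (D : Digraph n) → D ∈ digraphs n
  ∈-digraphs = ∈-vectors (∈-vectors λ { false → here refl ; true → there (here refl) })

  module _ {n : ℕ} where

    digraph-ext : {D D′ : Digraph n} → (∀ u v → Arc D u v → Arc D′ u v) → (∀ u v → Arc D′ u v → Arc D u v) → D ≡ D′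
    digraph-ext {D} {D′} to from = vec-ext λ u → vec-ext λ v → bool-ext (to u v) (from u v)
      where
      bool-ext : ∀ {a b} → (T a → T b) → (T b → T a) → a ≡ b
      bool-ext {false} {false} _ _ = refl
      bool-ext {false} {true}  _ g = ⊥-elim (g _)
      bool-ext {true}  {false} f _ = ⊥-elim (f _)
      bool-ext {true}  {true}  _ _ = refl
      vec-ext : ∀ {A : Set} {k} {v w : Vec A k} → (∀ i → lookup v i ≡ lookup w i) → v ≡ w
      vec-ext {v = v} {w} eq = trans (sym (Vec.tabulate∘lookup v))
        (trans (Vec.tabulate-cong eq) (Vec.tabulate∘lookup w))

    module _ {R : Rel (Fin n) 0ℓ} (R? : Decidable R) where

      fromRel : Digraph n
      fromRel = tabulate λ u → tabulate λ v → isYes (R? u v)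

      lookup-fromRel : ∀ u v → lookup (lookup fromRel u) v ≡ isYes (R? u v)
      lookup-fromRel u v = trans (cong (λ row → lookup row v) (Vec.lookup∘tabulate _ u)) (Vec.lookup∘tabulate _ v)

      arc⇒rel : ∀ {u v} → Arc fromRel u v → R u v
      arc⇒rel {u} {v} a = toWitness {a? = R? u v} (subst T (lookup-fromRel u v) a)

      rel⇒arc : ∀ {u v} → R u v → Arc fromRel u v
      rel⇒arc {u} {v} r = subst T (sym (lookup-fromRel u v)) (fromWitness r)

    closure-map : {R S : Rel (Fin n) 0ℓ} → (∀ {u v} → R u v → S u v) → ∀ {u v} → TransClosure R u v →
      TransClosure S u v
    closure-map f [ r ]   = [ f r ]
    closure-map f (r ∷ p) = f r ∷ closure-map f p

    AcyclicOrientation : Graph n → Digraph n → Set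
    AcyclicOrientation G D = IsOrientation G D × Acyclic D

    acyclicOrientation? : ∀ G D → Dec (AcyclicOrientation G D)
    acyclicOrientation? G D = isOrientation? G D ×-dec acyclic? D

    induced : Graph n → (Fin n → Bool) → Graph n
    induced G W = record
      { Adj    = λ u v → Adj u v × T (W u) × T (W v)
      ; adj?   = λ u v → adj? u v ×-dec T? (W u) ×-dec T? (W v)
      ; symm   = λ (a , u , v) → symm a , v , u
      ; irrefl = λ u≡v (a , _) → irrefl u≡v a
      }
      where open Graph G

    -- Adjacency is a `Set`-valued relation, so graphs with equivalent adjacency need not be equal.
    AO-cong : (G H : Graph n) → (∀ u v → Graph.Adj G u v → Graph.Adj H u v) →
              (∀ u v → Graph.Adj H u v → Graph.Adj G u v) → AO G ≡ AO H
    AO-cong G H G⊆H H⊆G = bijection⇒length-≡ (λ D → D) (λ D → D)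
      (Unique.filter⁺ (acyclicOrientation? G) (digraphs-unique n))
        (Unique.filter⁺ (acyclicOrientation? H) (digraphs-unique n))
      (λ D∈ → move G H G⊆H H⊆G D∈ , refl) (λ D∈ → move H G H⊆G G⊆H D∈ , refl)
      where
      move : (G H : Graph n) → (∀ u v → Graph.Adj G u v → Graph.Adj H u v) →
             (∀ u v → Graph.Adj H u v → Graph.Adj G u v) → ∀ {D} →
             D ∈ filter (acyclicOrientation? G) (digraphs n) → D ∈ filter (acyclicOrientation? H) (digraphs n)
      move G H to from {D} D∈ with ∈-filter⁻ (acyclicOrientation? G) {xs = digraphs n} D∈
      ... | D∈′ , o , a = ∈-filter⁺ (acyclicOrientation? H) D∈′
        ((λ u v → to u v ∘ proj₁ (o u v) , proj₂ (o u v) ∘ from u v) , a)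

    AO-edgeless : (G : Graph n) → (∀ u v → ¬ Graph.Adj G u v) → AO G ≡ 1
    AO-edgeless G edgeless = bijection⇒length-≡ {ys = none ∷ []} (λ _ → none) (λ _ → none)
      (Unique.filter⁺ (acyclicOrientation? G) (digraphs-unique n)) ([] ∷ [])
      (λ D∈ → here refl , digraph-ext (λ u v → ⊥-elim ∘ arc⇒rel ∅?) λ u v a →
        ⊥-elim (edgeless u v (proj₁ (proj₁ (proj₂ (∈-filter⁻ (acyclicOrientation? G) {xs = digraphs n} D∈)) u v) a)))
      λ { (here refl) → ∈-filter⁺ (acyclicOrientation? G) (∈-digraphs none)
            ((λ u v → (λ a → ⊥-elim (arc⇒rel ∅? a)) , λ a → ⊥-elim (edgeless u v a)) ,
             λ { v [ a ] → arc⇒rel ∅? a ; v (a ∷ _) → arc⇒rel ∅? a }) , refl }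
      where
      ∅? : Decidable {A = Fin n} (λ _ _ → ⊥)
      ∅? _ _ = no λ ()
      none : Digraph n
      none = fromRel ∅?

    -- Also true of every vertex outside `W` in an orientation of `induced G W`; the sources meant
    -- in the recurrence are those lying in `W`.
    NoArcInto : Digraph n → Fin n → Set
    NoArcInto D u = ∀ v → ¬ Arc D v u

    noArcInto? : ∀ D u → Dec (NoArcInto D u)
    noArcInto? D u = Fin.all? λ v → ¬? (arc? D v u)

    SourcesContain : (Fin n → Bool) → Digraph n → Set
    SourcesContain A D = ∀ u → T (A u) → NoArcInto D u

    sourcesContain? : ∀ A D → Dec (SourcesContain A D)
    sourcesContain? A D = Fin.all? λ u → T? (A u) →-dec noArcInto? D u

    module _ (G : Graph n) (W A : Fin n → Bool) where
      open Graph G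

      without : Fin n → Bool
      without u = W u ∧ not (A u)

      without⁺ : ∀ {u} → T (W u) → ¬ T (A u) → T (without u)
      without⁺ {u} w ¬a with W u | A u
      ... | true | false = _
      ... | true | true  = ¬a _

      without⁻ : ∀ {u} → T (without u) → T (W u) × ¬ T (A u)
      without⁻ {u} w with W u | A u
      ... | true | false = _ , λ ()

      module _ (A⊆W : ∀ {u} → T (A u) → T (W u)) (A-independent : ∀ {u v} → T (A u) → T (A v) → ¬ Adj u v) where

        -- Removing the arcs out of A is inverse to adding all arcs from A to W.
        cut? : ∀ D → Decidable (λ u v → Arc D u v × ¬ T (A u))
        cut? D u v = arc? D u v ×-dec ¬? (T? (A u))

        paste? : ∀ D → Decidable (λ u v → Arc D u v ⊎ (T (A u) × Adj u v × T (W v)))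
        paste? D u v = arc? D u v ⊎-dec (T? (A u) ×-dec adj? u v ×-dec T? (W v))

        cut paste : Digraph n → Digraph n
        cut D   = fromRel (cut? D)
        paste D = fromRel (paste? D)

        Big Small : Digraph n → Set
        Big D   = AcyclicOrientation (induced G W) D × SourcesContain A D
        Small D = AcyclicOrientation (induced G without) D

        cut-small : ∀ D → Big D → Small (cut D)
        cut-small D ((o , a) , src) = (λ u v → arc⇒adj u v , adj⇒arc u v) ,
          λ v p → a v (closure-map (proj₁ ∘ arc⇒rel (cut? D)) p)
          where
          arc⇒adj : ∀ u v → Arc (cut D) u v → Adj u v × T (without u) × T (without v)
          arc⇒adj u v arc with arc⇒rel (cut? D) arc
          ... | uv , ¬Au with proj₁ (o u v) uv
          ... | adj , Wu , Wv = adj , without⁺ Wu ¬Au , without⁺ Wv (λ Av → src v Av u uv)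
          adj⇒arc : ∀ u v → Adj u v × T (without u) × T (without v) →
            (Arc (cut D) u v × ¬ Arc (cut D) v u) ⊎ (Arc (cut D) v u × ¬ Arc (cut D) u v)
          adj⇒arc u v (adj , u∈ , v∈) with without⁻ u∈ | without⁻ v∈
          ... | Wu , ¬Au | Wv , ¬Av with proj₂ (o u v) (adj , Wu , Wv)
          ... | inj₁ (uv , ¬vu) = inj₁ (rel⇒arc (cut? D) (uv , ¬Au) , ¬vu ∘ proj₁ ∘ arc⇒rel (cut? D))
          ... | inj₂ (vu , ¬uv) = inj₂ (rel⇒arc (cut? D) (vu , ¬Av) , ¬uv ∘ proj₁ ∘ arc⇒rel (cut? D))

        small-avoids : ∀ D → Small D → ∀ {u v} → Arc D u v → ¬ T (A u) × ¬ T (A v)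
        small-avoids D (o , _) {u} {v} uv with proj₁ (o u v) uv
        ... | _ , u∈ , v∈ = proj₂ (without⁻ u∈) , proj₂ (without⁻ v∈)

        paste-sources : ∀ D → Small D → SourcesContain A (paste D)
        paste-sources D s u Au v vu with arc⇒rel (paste? D) vu
        ... | inj₁ vu′            = proj₂ (small-avoids D s vu′) Au
        ... | inj₂ (Av , adj , _) = A-independent Av Au adj

        paste-big : ∀ D → Small D → Big (paste D)
        paste-big D s@(o , a) = ((λ u v → arc⇒adj u v , adj⇒arc u v) , acyclic) , paste-sources D s
          where
          arc⇒adj : ∀ u v → Arc (paste D) u v → Adj u v × T (W u) × T (W v)
          arc⇒adj u v arc with arc⇒rel (paste? D) arc
          ... | inj₂ (Au , adj , Wv) = adj , A⊆W Au , Wv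
          ... | inj₁ uv with proj₁ (o u v) uv
          ... | adj , u∈ , v∈ = adj , proj₁ (without⁻ u∈) , proj₁ (without⁻ v∈)
          adj⇒arc : ∀ u v → Adj u v × T (W u) × T (W v) →
            (Arc (paste D) u v × ¬ Arc (paste D) v u) ⊎ (Arc (paste D) v u × ¬ Arc (paste D) u v)
          adj⇒arc u v (adj , Wu , Wv) with T? (A u) | T? (A v)
          ... | yes Au | _ = inj₁ (rel⇒arc (paste? D) (inj₂ (Au , adj , Wv)) , paste-sources D s u Au v)
          ... | no _ | yes Av = inj₂ (rel⇒arc (paste? D) (inj₂ (Av , symm adj , Wu)) , paste-sources D s v Av u)
          ... | no ¬Au | no ¬Av with proj₂ (o u v) (adj , without⁺ Wu ¬Au , without⁺ Wv ¬Av)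
          ... | inj₁ (uv , ¬vu) = inj₁ (rel⇒arc (paste? D) (inj₁ uv) , [ ¬vu , ¬Av ∘ proj₁ ]′ ∘ arc⇒rel (paste? D))
          ... | inj₂ (vu , ¬uv) = inj₂ (rel⇒arc (paste? D) (inj₁ vu) , [ ¬uv , ¬Au ∘ proj₁ ]′ ∘ arc⇒rel (paste? D))
          -- Arcs never enter A, so a closed walk uses only arcs of D.
          old : ∀ {t u v} → Arc (paste D) t u → Arc (paste D) u v → Arc D u v
          old {t} {u} tu uv with arc⇒rel (paste? D) uv
          ... | inj₁ uv′      = uv′
          ... | inj₂ (Au , _) = ⊥-elim (paste-sources D s u Au t tu)
          old-walk : ∀ {t u v} → Arc (paste D) t u → TransClosure (Arc (paste D)) u v → TransClosure (Arc D) u v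
          old-walk tu [ uv ]   = [ old tu uv ]
          old-walk tu (uv ∷ p) = old tu uv ∷ old-walk uv p
          last-arc : ∀ {u v} → TransClosure (Arc (paste D)) u v → ∃[ t ] Arc (paste D) t v
          last-arc {u} [ uv ] = u , uv
          last-arc (_ ∷ p)    = last-arc p
          acyclic : Acyclic (paste D)
          acyclic v p = a v (old-walk (proj₂ (last-arc p)) p)

        paste∘cut : ∀ {D} → Big D → paste (cut D) ≡ D
        paste∘cut {D} ((o , _) , src) = digraph-ext to from
          where
          to : ∀ u v → Arc (paste (cut D)) u v → Arc D u v
          to u v arc with arc⇒rel (paste? (cut D)) arc
          ... | inj₁ uv = proj₁ (arc⇒rel (cut? D) uv)
          ... | inj₂ (Au , adj , Wv) with proj₂ (o u v) (adj , A⊆W Au , Wv)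
          ... | inj₁ (uv , _) = uv
          ... | inj₂ (vu , _) = ⊥-elim (src u Au v vu)
          from : ∀ u v → Arc D u v → Arc (paste (cut D)) u v
          from u v uv with T? (A u)
          ... | no ¬Au = rel⇒arc (paste? (cut D)) (inj₁ (rel⇒arc (cut? D) (uv , ¬Au)))
          ... | yes Au with proj₁ (o u v) uv
          ... | adj , _ , Wv = rel⇒arc (paste? (cut D)) (inj₂ (Au , adj , Wv))

        cut∘paste : ∀ {D} → Small D → cut (paste D) ≡ D
        cut∘paste {D} s = digraph-ext to from
          where
          to : ∀ u v → Arc (cut (paste D)) u v → Arc D u v
          to u v arc with arc⇒rel (cut? (paste D)) arc
          ... | uv , ¬Au = [ (λ uv′ → uv′) , ⊥-elim ∘ ¬Au ∘ proj₁ ]′ (arc⇒rel (paste? D) uv)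
          from : ∀ u v → Arc D u v → Arc (cut (paste D)) u v
          from u v uv = rel⇒arc (cut? (paste D)) (rel⇒arc (paste? D) (inj₁ uv) , proj₁ (small-avoids D s uv))

        count-with-sources :
          length (filter (λ D → acyclicOrientation? (induced G W) D ×-dec sourcesContain? A D) (digraphs n))
            ≡ AO (induced G without)
        count-with-sources = bijection⇒length-≡ cut paste
          (Unique.filter⁺ big? (digraphs-unique n)) (Unique.filter⁺ small? (digraphs-unique n))
          (λ {D} D∈ → let _ , b = ∈-filter⁻ big? {xs = digraphs n} D∈ in
            ∈-filter⁺ small? (∈-digraphs _) (cut-small D b) , paste∘cut b)
          (λ {D} D∈ → let _ , s = ∈-filter⁻ small? {xs = digraphs n} D∈ in
            ∈-filter⁺ big? (∈-digraphs _) (paste-big D s) , cut∘paste s)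
          where
          big? = λ D → acyclicOrientation? (induced G W) D ×-dec sourcesContain? A D
          small? = acyclicOrientation? (induced G without)

    module _ {G : Graph n} {W : Fin n → Bool} {D : Digraph n} (ao : AcyclicOrientation (induced G W) D) where
      open Graph G

      sources-independent : ∀ {u v} → T (W u) → T (W v) → NoArcInto D u → NoArcInto D v → ¬ Adj u v
      sources-independent {u} {v} Wu Wv ¬u ¬v adj =
        [ (λ (uv , _) → ¬v u uv) , (λ (vu , _) → ¬u v vu) ]′ (proj₂ (proj₁ ao u v) (adj , Wu , Wv))

      -- On a finite set the transitive closure of an acyclic relation is a strict partial order,
      -- hence well-founded, so walking backwards along arcs must stop. The walk stays in `W`
      -- because arcs join members of `W`.
      source-exists : ∀ {u} → T (W u) → ∃[ s ] T (W s) × NoArcInto D s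
      source-exists {u} Wu = go u Wu (spo-wellFounded spo u)
        where
        spo : IsStrictPartialOrder _≡_ (TransClosure (Arc D))
        spo = record
          { isEquivalence = isEquivalence
          ; irrefl        = λ { {x} refl → proj₂ ao x }
          ; trans         = λ p q → p Closure.++ q
          ; <-resp-≈      = (λ { refl p → p }) , (λ { refl p → p })
          }
        go : ∀ u → T (W u) → Acc (TransClosure (Arc D)) u → ∃[ s ] T (W s) × NoArcInto D s
        go u Wu (acc rs) with Fin.any? (λ v → arc? D v u)
        ... | no  none     = u , Wu , λ v vu → none (v , vu)
        ... | yes (v , vu) = go v (proj₁ (proj₂ (proj₁ (proj₁ ao v u) vu))) (rs [ vu ])

-- Signed sums over the subsets of one part.

module Multipartite where

  open import Data.Rational.Base using (_+_; _*_; -_)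
  open SourceCounting

  private
    variable
      r : ℕ
      λs : Vec ℕ r

  module _ {A : Set} where

    ∑ : List A → (A → ℚ) → ℚ
    ∑ []       f = 0ℚ
    ∑ (x ∷ xs) f = f x + ∑ xs f

    ∑-cong : ∀ xs {f g} → (∀ {x} → x ∈ xs → f x ≡ g x) → ∑ xs f ≡ ∑ xs g
    ∑-cong []       _   = refl
    ∑-cong (x ∷ xs) f≡g = cong₂ _+_ (f≡g (here refl)) (∑-cong xs (f≡g ∘ there))

    ∑-++ : ∀ xs ys f → ∑ (xs ++ ys) f ≡ ∑ xs f + ∑ ys f
    ∑-++ []       ys f = sym (ℚ.+-identityˡ (∑ ys f))
    ∑-++ (x ∷ xs) ys f = trans (cong (f x +_) (∑-++ xs ys f)) (sym (ℚ.+-assoc (f x) (∑ xs f) (∑ ys f)))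

    ∑-+ : ∀ xs f g → ∑ xs (λ x → f x + g x) ≡ ∑ xs f + ∑ xs g
    ∑-+ []       f g = refl
    ∑-+ (x ∷ xs) f g = trans (cong (f x + g x +_) (∑-+ xs f g))
      (solve 4 (λ a b c d → a :+ b :+ (c :+ d) := a :+ c :+ (b :+ d)) refl (f x) (g x) (∑ xs f) (∑ xs g))

    ∑-*ˡ : ∀ xs c f → ∑ xs (λ x → c * f x) ≡ c * ∑ xs f
    ∑-*ˡ []       c f = sym (ℚ.*-zeroʳ c)
    ∑-*ˡ (x ∷ xs) c f = trans (cong (c * f x +_) (∑-*ˡ xs c f)) (sym (ℚ.*-distribˡ-+ c (f x) (∑ xs f)))

    ∑-neg : ∀ xs f → ∑ xs (λ x → - f x) ≡ - ∑ xs f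
    ∑-neg []       f = refl
    ∑-neg (x ∷ xs) f = trans (cong (- f x +_) (∑-neg xs f)) (sym (ℚ.neg-distrib-+ (f x) (∑ xs f)))

    ∑-zero : ∀ xs → ∑ xs (λ _ → 0ℚ) ≡ 0ℚ
    ∑-zero []       = refl
    ∑-zero (x ∷ xs) = trans (ℚ.+-identityˡ (∑ xs (λ _ → 0ℚ))) (∑-zero xs)

  ∑-map : {A B : Set} (h : A → B) (xs : List A) (f : B → ℚ) → ∑ (map h xs) f ≡ ∑ xs (f ∘ h)
  ∑-map h []       f = refl
  ∑-map h (x ∷ xs) f = cong (f (h x) +_) (∑-map h xs f)

  ∑-swap : {A B : Set} (xs : List A) (ys : List B) (f : A → B → ℚ) →
    ∑ xs (λ x → ∑ ys (f x)) ≡ ∑ ys (λ y → ∑ xs (λ x → f x y))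
  ∑-swap []       ys f = sym (∑-zero ys)
  ∑-swap (x ∷ xs) ys f = trans (cong (∑ ys (f x) +_) (∑-swap xs ys f)) (sym (∑-+ ys (f x) (λ y → ∑ xs (λ x → f x y))))

  χ : Bool → ℚ
  χ true  = 1ℚ
  χ false = 0ℚ

  χ-∧ : ∀ a b → χ (a ∧ b) ≡ χ a * χ b
  χ-∧ true  b = sym (ℚ.*-identityˡ (χ b))
  χ-∧ false b = sym (ℚ.*-zeroˡ (χ b))

  χ-true : ∀ {b} → T b → χ b ≡ 1ℚ
  χ-true {true} _ = refl

  χ-false : ∀ {b} → ¬ T b → χ b ≡ 0ℚ
  χ-false {true}  ¬t = ⊥-elim (¬t _)
  χ-false {false} _  = refl

  ι-length-filter : {A : Set} {Q : Unary.Pred A 0ℓ} (Q? : Unary.Decidable Q) (xs : List A) →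
    ι (length (filter Q? xs)) ≡ ∑ xs (λ x → χ (does (Q? x)))
  ι-length-filter Q? []       = refl
  ι-length-filter Q? (x ∷ xs) with does (Q? x)
  ... | true  = trans (ι-suc (length (filter Q? xs)))
    (trans (ℚ.+-comm (ι (length (filter Q? xs))) 1ℚ) (cong (1ℚ +_) (ι-length-filter Q? xs)))
  ... | false = trans (ι-length-filter Q? xs) (sym (ℚ.+-identityˡ (∑ xs (λ x → χ (does (Q? x))))))

  Subset : ℕ → Set
  Subset = Vec Bool

  none : ∀ {n} → Subset n
  none = Vec.replicate _ false

  infixl 7 _∖_
  _∖_ : ∀ {n} → Subset n → Subset n → Subset n
  _∖_ = Vec.zipWith (λ w a → w ∧ not a)

  -- Only subsets of `W` are listed, as vectors over the whole part. A set containing the head is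
  -- nonempty whatever its tail, so `nonempty` falls back on `subsets` there.
  subsets nonempty : ∀ {n} → Subset n → List (Subset n)
  subsets []          = [] ∷ []
  subsets (false ∷ W) = map (false ∷_) (subsets W)
  subsets (true ∷ W)  = map (false ∷_) (subsets W) ++ map (true ∷_) (subsets W)
  nonempty []          = []
  nonempty (false ∷ W) = map (false ∷_) (nonempty W)
  nonempty (true ∷ W)  = map (false ∷_) (nonempty W) ++ map (true ∷_) (subsets W)

  ∑-subsets-false : ∀ {n} (W : Subset n) g → ∑ (subsets W) (g ∘ (false ∷_)) ≡ g none + ∑ (nonempty W)
    (g ∘ (false ∷_)) →
    ∑ (map (false ∷_) (subsets W)) g ≡ g none + ∑ (map (false ∷_) (nonempty W)) g
  ∑-subsets-false W g eq = trans (∑-map (false ∷_) (subsets W) g)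
    (trans eq (cong (g none +_) (sym (∑-map (false ∷_) (nonempty W) g))))

  ∑-subsets : ∀ {n} (W : Subset n) g → ∑ (subsets W) g ≡ g none + ∑ (nonempty W) g
  ∑-subsets []          g = refl
  ∑-subsets (false ∷ W) g = ∑-subsets-false W g (∑-subsets W (g ∘ (false ∷_)))
  ∑-subsets (true ∷ W)  g = begin
    ∑ (map (false ∷_) (subsets W) ++ ts) g              ≡⟨ ∑-++ (map (false ∷_) (subsets W)) ts g ⟩
    ∑ (map (false ∷_) (subsets W)) g + ∑ ts g           ≡⟨ cong (_+ ∑ ts g)
      (∑-subsets-false W g (∑-subsets W (g ∘ (false ∷_)))) ⟩
    g none + ∑ (map (false ∷_) (nonempty W)) g + ∑ ts g ≡⟨ ℚ.+-assoc (g none) _ _ ⟩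
    g none + (∑ (map (false ∷_) (nonempty W)) g + ∑ ts g) ≡⟨ cong (g none +_)
      (∑-++ (map (false ∷_) (nonempty W)) ts g) ⟨
    g none + ∑ (nonempty (true ∷ W)) g                  ∎
    where
    open ≡-Reasoning
    ts = map (true ∷_) (subsets W)

  sgn : ∀ {n} → Subset n → ℚ
  sgn []          = 1ℚ
  sgn (false ∷ A) = sgn A
  sgn (true ∷ A)  = - sgn A

  sgn-none : ∀ n → sgn (none {n}) ≡ 1ℚ
  sgn-none zero    = refl
  sgn-none (suc n) = sgn-none n

  ∖-none : ∀ {n} (W : Subset n) → W ∖ none ≡ W
  ∖-none []          = refl
  ∖-none (false ∷ W) = cong (false ∷_) (∖-none W)
  ∖-none (true ∷ W)  = cong (true ∷_) (∖-none W)

  infix 4 _⊆ᵇ_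
  -- Recursion on `A` lets the signed sums be evaluated head by head. The other set is a predicate,
  -- in use the set of sources of a digraph.
  _⊆ᵇ_ : ∀ {n} → Subset n → (Fin n → Bool) → Bool
  []      ⊆ᵇ s = true
  (a ∷ A) ⊆ᵇ s = (not a ∨ s zero) ∧ (A ⊆ᵇ s ∘ suc)

  none⊆ : ∀ n s → (none {n} ⊆ᵇ s) ≡ true
  none⊆ zero    s = refl
  none⊆ (suc n) s = none⊆ n (s ∘ suc)

  ⊆ᵇ⁻ : ∀ {n} (A : Subset n) {s} → T (A ⊆ᵇ s) → ∀ i → T (lookup A i) → T (s i)
  ⊆ᵇ⁻ (true ∷ A) {s} t zero _ with s zero
  ... | true = _
  ⊆ᵇ⁻ (false ∷ A) t (suc i) Ai = ⊆ᵇ⁻ A t i Ai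
  ⊆ᵇ⁻ (true ∷ A) {s} t (suc i) Ai with s zero
  ... | true = ⊆ᵇ⁻ A t i Ai

  ⊆ᵇ⁺ : ∀ {n} (A : Subset n) {s} → (∀ i → T (lookup A i) → T (s i)) → T (A ⊆ᵇ s)
  ⊆ᵇ⁺ []          h = _
  ⊆ᵇ⁺ (false ∷ A) h = ⊆ᵇ⁺ A (h ∘ suc)
  ⊆ᵇ⁺ (true ∷ A) {s} h with s zero | h zero _
  ... | true | _ = ⊆ᵇ⁺ A (h ∘ suc)

  hit : ∀ {n} → Subset n → (Fin n → Bool) → Bool
  hit []      s = false
  hit (w ∷ W) s = (w ∧ s zero) ∨ hit W (s ∘ suc)

  hit⁻ : ∀ {n} (W : Subset n) s → T (hit W s) → ∃[ i ] T (lookup W i) × T (s i)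
  hit⁻ (false ∷ W) s t = let i , Wi , si = hit⁻ W (s ∘ suc) t in suc i , Wi , si
  hit⁻ (true ∷ W)  s t with s zero in eq
  ... | true  = zero , _ , subst T (sym eq) _
  ... | false = let i , Wi , si = hit⁻ W (s ∘ suc) t in suc i , Wi , si

  hit⁺ : ∀ {n} (W : Subset n) s i → T (lookup W i) → T (s i) → T (hit W s)
  hit⁺ (true ∷ W) s zero _ si with s zero
  ... | true = _
  hit⁺ (false ∷ W) s (suc i) Wi si = hit⁺ W (s ∘ suc) i Wi si
  hit⁺ (true ∷ W) s (suc i) Wi si with s zero
  ... | true  = _
  ... | false = hit⁺ W (s ∘ suc) i Wi si

  -- The alternating sum over all subsets of W ∩ s vanishes unless W ∩ s = ∅.
  ∑-nonempty-sgn : ∀ {n} (W : Subset n) s → ∑ (nonempty W) (λ A → sgn A * χ (A ⊆ᵇ s)) ≡ - χ (hit W s)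
  ∑-nonempty-sgn []          s = refl
  ∑-nonempty-sgn (false ∷ W) s = trans (∑-map (false ∷_) (nonempty W) (λ A → sgn A * χ (A ⊆ᵇ s)))
    (∑-nonempty-sgn W (s ∘ suc))
  ∑-nonempty-sgn {suc n} (true ∷ W) s = begin
    ∑ (nonempty (true ∷ W)) (λ A → sgn A * χ (A ⊆ᵇ s))
      ≡⟨ ∑-++ (map (false ∷_) (nonempty W)) (map (true ∷_) (subsets W)) (λ A → sgn A * χ (A ⊆ᵇ s)) ⟩
    ∑ (map (false ∷_) (nonempty W)) (λ A → sgn A * χ (A ⊆ᵇ s)) + ∑ (map (true ∷_) (subsets W))
      (λ A → sgn A * χ (A ⊆ᵇ s))
      ≡⟨ cong₂ _+_ (trans (∑-map (false ∷_) (nonempty W) (λ A → sgn A * χ (A ⊆ᵇ s))) (∑-nonempty-sgn W (s ∘ suc)))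
        (∑-map (true ∷_) (subsets W) (λ A → sgn A * χ (A ⊆ᵇ s))) ⟩
    - χ (hit W (s ∘ suc)) + ∑ (subsets W) (λ A → - sgn A * χ (s zero ∧ (A ⊆ᵇ s ∘ suc)))
      ≡⟨ split (s zero) ⟩
    - χ (s zero ∨ hit W (s ∘ suc)) ∎
    where
    open ≡-Reasoning
    s′ = s ∘ suc
    -- If the head is outside `s`, the sets containing it contribute nothing. If it is inside, the
    -- sum over all subsets of the tail is `1ℚ - h`, and subtracting it cancels the `- h` coming
    -- from the sets that avoid the head.
    split : ∀ b → - χ (hit W s′) + ∑ (subsets W) (λ A → - sgn A * χ (b ∧ (A ⊆ᵇ s′))) ≡ - χ (b ∨ hit W s′)
    split false = trans (cong (- χ (hit W s′) +_)
      (trans (∑-cong (subsets W) (λ {A} _ → ℚ.*-zeroʳ (- sgn A))) (∑-zero (subsets W)))) (ℚ.+-identityʳ _)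
    split true = begin
      - h + ∑ (subsets W) (λ A → - sgn A * χ (A ⊆ᵇ s′))
        ≡⟨ cong (- h +_) (trans (∑-cong (subsets W) (λ {A} _ → sym (ℚ.neg-distribˡ-* (sgn A) (χ (A ⊆ᵇ s′)))))
             (∑-neg (subsets W) (λ A → sgn A * χ (A ⊆ᵇ s′)))) ⟩
      - h + - ∑ (subsets W) (λ A → sgn A * χ (A ⊆ᵇ s′))
        ≡⟨ cong (λ x → - h + - x) (trans (∑-subsets W (λ A → sgn A * χ (A ⊆ᵇ s′)))
             (cong₂ _+_ (cong₂ _*_ (sgn-none n) (cong χ (none⊆ n s′))) (∑-nonempty-sgn W s′))) ⟩
      - h + - (1ℚ * 1ℚ + - h)
        ≡⟨ solve 1 (λ h → :- h :+ :- (con 1ℚ :* con 1ℚ :+ :- h) := :- con 1ℚ) refl h ⟩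
      - 1ℚ ∎
      where h = χ (hit W s′)

  -- Families of subsets, one for each part, and their independent sets.

  Family : ∀ {r} → Vec ℕ r → Set
  Family = All Subset

  mem : Family λs → Fin (Vec.sum λs) → Bool
  mem (_∷_ {x = l} W Ws) = [ lookup W , mem Ws ]′ ∘ splitAt l

  data SplitView l m : Fin (l ℕ.+ m) → Set where
    left  : (i : Fin l) → SplitView l m (i ↑ˡ m)
    right : (j : Fin m) → SplitView l m (l ↑ʳ j)

  splitView : ∀ l m u → SplitView l m u
  splitView l m u with splitAt l u in eq
  ... | inj₁ i = subst (SplitView l m) (Fin.splitAt⁻¹-↑ˡ eq) (left i)
  ... | inj₂ j = subst (SplitView l m) (Fin.splitAt⁻¹-↑ʳ eq) (right j)

  module _ {l : ℕ} (W : Subset l) (Ws : Family λs) where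

    mem-left : ∀ i → mem (W ∷ Ws) (i ↑ˡ Vec.sum λs) ≡ lookup W i
    mem-left i = cong [ lookup W , mem Ws ]′ (Fin.splitAt-↑ˡ l i (Vec.sum λs))

    mem-right : ∀ j → mem (W ∷ Ws) (l ↑ʳ j) ≡ mem Ws j
    mem-right j = cong [ lookup W , mem Ws ]′ (Fin.splitAt-↑ʳ l (Vec.sum λs) j)

  part-left : ∀ l (λs : Vec ℕ r) i → part (l ∷ λs) (i ↑ˡ Vec.sum λs) ≡ zero
  part-left l λs i = cong [ (λ _ → zero) , suc ∘ part λs ]′ (Fin.splitAt-↑ˡ l i (Vec.sum λs))

  part-right : ∀ l (λs : Vec ℕ r) j → part (l ∷ λs) (l ↑ʳ j) ≡ suc (part λs j)
  part-right l λs j = cong [ (λ _ → zero) , suc ∘ part λs ]′ (Fin.splitAt-↑ʳ l (Vec.sum λs) j)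

  ∅ : Family λs
  ∅ {λs = []}     = []
  ∅ {λs = l ∷ λs} = none ∷ ∅

  infixl 7 _∖ᶠ_
  _∖ᶠ_ : Family λs → Family λs → Family λs
  []       ∖ᶠ []       = []
  (W ∷ Ws) ∖ᶠ (A ∷ As) = W ∖ A ∷ Ws ∖ᶠ As

  ∖ᶠ-∅ : (Ws : Family λs) → Ws ∖ᶠ ∅ ≡ Ws
  ∖ᶠ-∅ []       = refl
  ∖ᶠ-∅ (W ∷ Ws) = cong₂ _∷_ (∖-none W) (∖ᶠ-∅ Ws)

  mem-∅ : ∀ (λs : Vec ℕ r) u → mem (∅ {λs = λs}) u ≡ false
  mem-∅ (l ∷ λs) u with splitView l (Vec.sum λs) u
  ... | left i  = trans (mem-left (none {l}) (∅ {λs = λs}) i) (Vec.lookup-replicate i false)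
  ... | right j = trans (mem-right (none {l}) (∅ {λs = λs}) j) (mem-∅ λs j)

  mem-∖ : (Ws As : Family λs) → ∀ u → mem (Ws ∖ᶠ As) u ≡ mem Ws u ∧ not (mem As u)
  mem-∖ {λs = l ∷ λs} (W ∷ Ws) (A ∷ As) u with splitView l (Vec.sum λs) u
  ... | left i  = trans (mem-left (W ∖ A) (Ws ∖ᶠ As) i) (trans (Vec.lookup-zipWith _ i W A)
    (sym (cong₂ (λ w a → w ∧ not a) (mem-left W Ws i) (mem-left A As i))))
  ... | right j = trans (mem-right (W ∖ A) (Ws ∖ᶠ As) j) (trans (mem-∖ Ws As j)
    (sym (cong₂ (λ w a → w ∧ not a) (mem-right W Ws j) (mem-right A As j))))

  sgnᶠ : Family λs → ℚ
  sgnᶠ []       = 1ℚ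
  sgnᶠ (A ∷ As) = sgn A * sgnᶠ As

  sgnᶠ-∅ : (λs : Vec ℕ r) → sgnᶠ (∅ {λs = λs}) ≡ 1ℚ
  sgnᶠ-∅ []       = refl
  sgnᶠ-∅ (l ∷ λs) = cong₂ _*_ (sgn-none l) (sgnᶠ-∅ λs)

  -- The nonempty independent sets of the complete multipartite graph on Ws.
  independents : Family λs → List (Family λs)
  independents []       = []
  independents (W ∷ Ws) = map (_∷ ∅) (nonempty W) ++ map (none ∷_) (independents Ws)

  ∑-independents : ∀ {l} (W : Subset l) (Ws : Family λs) g →
    ∑ (independents (W ∷ Ws)) g ≡ ∑ (nonempty W) (λ A → g (A ∷ ∅)) + ∑ (independents Ws) (λ As → g (none ∷ As))
  ∑-independents W Ws g = trans (∑-++ (map (_∷ ∅) (nonempty W)) (map (none ∷_) (independents Ws)) g)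
    (cong₂ _+_ (∑-map (_∷ ∅) (nonempty W) g) (∑-map (none ∷_) (independents Ws) g))

  infix 4 _⊆ᶠ_
  _⊆ᶠ_ : Family λs → (Fin (Vec.sum λs) → Bool) → Bool
  []                ⊆ᶠ s = true
  _∷_ {x = l} A As ⊆ᶠ s = (A ⊆ᵇ s ∘ (_↑ˡ _)) ∧ (As ⊆ᶠ s ∘ (l ↑ʳ_))

  ∅⊆ : ∀ (λs : Vec ℕ r) s → (∅ {λs = λs} ⊆ᶠ s) ≡ true
  ∅⊆ []       s = refl
  ∅⊆ (l ∷ λs) s = cong₂ _∧_ (none⊆ l (s ∘ (_↑ˡ Vec.sum λs))) (∅⊆ λs (s ∘ (l ↑ʳ_)))

  T-∧⁻ : ∀ {a b} → T (a ∧ b) → T a × T b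
  T-∧⁻ {true} {true} _ = _

  T-∧⁺ : ∀ {a b} → T a → T b → T (a ∧ b)
  T-∧⁺ {true} {true} _ _ = _

  ⊆ᶠ⁻ : (As : Family λs) → ∀ {s} → T (As ⊆ᶠ s) → ∀ u → T (mem As u) → T (s u)
  ⊆ᶠ⁻ {λs = l ∷ λs} (A ∷ As) t u u∈ with splitView l (Vec.sum λs) u
  ... | left i  = ⊆ᵇ⁻ A (proj₁ (T-∧⁻ t)) i (subst T (mem-left A As i) u∈)
  ... | right j = ⊆ᶠ⁻ As (proj₂ (T-∧⁻ {A ⊆ᵇ _} t)) j (subst T (mem-right A As j) u∈)

  ⊆ᶠ⁺ : (As : Family λs) → ∀ {s} → (∀ u → T (mem As u) → T (s u)) → T (As ⊆ᶠ s)
  ⊆ᶠ⁺ []       h = _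
  ⊆ᶠ⁺ {λs = l ∷ λs} (A ∷ As) h = T-∧⁺
    (⊆ᵇ⁺ A λ i Ai → h (i ↑ˡ Vec.sum λs) (subst T (sym (mem-left A As i)) Ai))
    (⊆ᶠ⁺ As λ j Aj → h (l ↑ʳ j) (subst T (sym (mem-right A As j)) Aj))

  -- The number of parts in which `Ws` meets `s`.
  hits : Family λs → (Fin (Vec.sum λs) → Bool) → ℚ
  hits []                s = 0ℚ
  hits (_∷_ {x = l} W Ws) s = χ (hit W (s ∘ (_↑ˡ _))) + hits Ws (s ∘ (l ↑ʳ_))

  -- The sum splits by parts, because a nonempty independent set lies in a single one; each part
  -- that meets `s` contributes `- 1ℚ`.
  ∑-independents-sgn : (Ws : Family λs) → ∀ s → ∑ (independents Ws) (λ As → sgnᶠ As * χ (As ⊆ᶠ s)) ≡ - hits Ws s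
  ∑-independents-sgn [] s = refl
  ∑-independents-sgn {λs = l ∷ λs} (W ∷ Ws) s = begin
    ∑ (independents (W ∷ Ws)) (λ As → sgnᶠ As * χ (As ⊆ᶠ s))
      ≡⟨ ∑-independents W Ws (λ As → sgnᶠ As * χ (As ⊆ᶠ s)) ⟩
    ∑ (nonempty W) (λ A → sgnᶠ (A ∷ ∅ {λs = λs}) * χ ((A ⊆ᵇ s₁) ∧ (∅ {λs = λs} ⊆ᶠ s₂))) +
    ∑ (independents Ws) (λ As → sgnᶠ (none {l} ∷ As) * χ ((none {l} ⊆ᵇ s₁) ∧ (As ⊆ᶠ s₂)))
      ≡⟨ cong₂ _+_
           (∑-cong (nonempty W) λ {A} _ → cong₂ _*_
             (trans (cong (sgn A *_) (sgnᶠ-∅ λs)) (ℚ.*-identityʳ (sgn A)))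
             (trans (χ-∧ (A ⊆ᵇ s₁) (∅ {λs = λs} ⊆ᶠ s₂))
               (trans (cong (λ b → χ (A ⊆ᵇ s₁) * χ b) (∅⊆ λs s₂)) (ℚ.*-identityʳ (χ (A ⊆ᵇ s₁))))))
           (∑-cong (independents Ws) λ {As} _ → cong₂ _*_
             (trans (cong (_* sgnᶠ As) (sgn-none l)) (ℚ.*-identityˡ (sgnᶠ As)))
             (cong (λ b → χ (b ∧ (As ⊆ᶠ s₂))) (none⊆ l s₁))) ⟩
    ∑ (nonempty W) (λ A → sgn A * χ (A ⊆ᵇ s₁)) + ∑ (independents Ws) (λ As → sgnᶠ As * χ (As ⊆ᶠ s₂))
      ≡⟨ cong₂ _+_ (∑-nonempty-sgn W s₁) (∑-independents-sgn Ws s₂) ⟩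
    - χ (hit W s₁) + - hits Ws s₂
      ≡⟨ ℚ.neg-distrib-+ (χ (hit W s₁)) (hits Ws s₂) ⟨
    - hits (W ∷ Ws) s ∎
    where
    open ≡-Reasoning
    s₁ = s ∘ (_↑ˡ Vec.sum λs)
    s₂ = s ∘ (l ↑ʳ_)

  hits-none : (Ws : Family λs) → ∀ s → (∀ u → T (mem Ws u) → ¬ T (s u)) → hits Ws s ≡ 0ℚ
  hits-none [] s _ = refl
  hits-none {λs = l ∷ λs} (W ∷ Ws) s disjoint = cong₂ _+_
    (χ-false λ t → let i , Wi , si = hit⁻ W _ t in disjoint (i ↑ˡ Vec.sum λs) (subst T (sym (mem-left W Ws i)) Wi) si)
    (hits-none Ws (s ∘ (l ↑ʳ_)) λ j Wj → disjoint (l ↑ʳ j) (subst T (sym (mem-right W Ws j)) Wj))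

  hits-one : (Ws : Family λs) → ∀ s u → T (mem Ws u) → T (s u) →
    (∀ u v → T (mem Ws u) → T (mem Ws v) → T (s u) → T (s v) → part λs u ≡ part λs v) → hits Ws s ≡ 1ℚ
  hits-one {λs = l ∷ λs} (W ∷ Ws) s u u∈ su same with splitView l (Vec.sum λs) u
  ... | left i = cong₂ _+_ (χ-true (hit⁺ W _ i (subst T (mem-left W Ws i) u∈) su))
    (hits-none Ws (s ∘ (l ↑ʳ_)) λ j Wj sj → Fin.0≢1+n
      (trans (sym (part-left l λs i))
        (trans (same _ _ u∈ (subst T (sym (mem-right W Ws j)) Wj) su sj) (part-right l λs j))))
  ... | right j = cong₂ _+_
    (χ-false λ t → let i , Wi , si = hit⁻ W _ t in Fin.0≢1+n
      (trans (sym (part-left l λs i))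
        (trans (same _ _ (subst T (sym (mem-left W Ws i)) Wi) u∈ si su) (part-right l λs j))))
    (hits-one Ws (s ∘ (l ↑ʳ_)) j (subst T (mem-right W Ws j) u∈) su λ v w v∈ w∈ sv sw → Fin.suc-injective
      (trans (sym (part-right l λs v)) (trans
        (same _ _ (subst T (sym (mem-right W Ws v)) v∈) (subst T (sym (mem-right W Ws w)) w∈) sv sw)
          (part-right l λs w))))

  subsets-⊆ : ∀ {n} (W : Subset n) {A} → A ∈ subsets W → ∀ i → T (lookup A i) → T (lookup W i)
  subsets-⊆ (false ∷ W) A∈ i Ai with ∈-map⁻ (false ∷_) A∈
  subsets-⊆ (false ∷ W) A∈ (suc i) Ai | A , A∈′ , refl = subsets-⊆ W A∈′ i Ai
  subsets-⊆ (true ∷ W) A∈ zero Ai = _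
  subsets-⊆ (true ∷ W) A∈ (suc i) Ai with ∈-++⁻ (map (false ∷_) (subsets W)) A∈
  ... | inj₁ A∈₁ with ∈-map⁻ (false ∷_) A∈₁
  ... | A , A∈′ , refl = subsets-⊆ W A∈′ i Ai
  subsets-⊆ (true ∷ W) A∈ (suc i) Ai | inj₂ A∈₂ with ∈-map⁻ (true ∷_) A∈₂
  ... | A , A∈′ , refl = subsets-⊆ W A∈′ i Ai

  nonempty-⊆ : ∀ {n} (W : Subset n) {A} → A ∈ nonempty W → ∀ i → T (lookup A i) → T (lookup W i)
  nonempty-⊆ (false ∷ W) A∈ i Ai with ∈-map⁻ (false ∷_) A∈
  nonempty-⊆ (false ∷ W) A∈ (suc i) Ai | A , A∈′ , refl = nonempty-⊆ W A∈′ i Ai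
  nonempty-⊆ (true ∷ W) A∈ zero Ai = _
  nonempty-⊆ (true ∷ W) A∈ (suc i) Ai with ∈-++⁻ (map (false ∷_) (nonempty W)) A∈
  ... | inj₁ A∈₁ with ∈-map⁻ (false ∷_) A∈₁
  ... | A , A∈′ , refl = nonempty-⊆ W A∈′ i Ai
  nonempty-⊆ (true ∷ W) A∈ (suc i) Ai | inj₂ A∈₂ with ∈-map⁻ (true ∷_) A∈₂
  ... | A , A∈′ , refl = subsets-⊆ W A∈′ i Ai

  independents-⊆ : (Ws : Family λs) {As : Family λs} → As ∈ independents Ws → ∀ {u} → T (mem As u) → T (mem Ws u)
  independents-⊆ {λs = l ∷ λs} (W ∷ Ws) As∈ {u} u∈ with ∈-++⁻ (map (_∷ ∅) (nonempty W)) As∈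
  independents-⊆ {λs = l ∷ λs} (W ∷ Ws) As∈ {u} u∈ | inj₁ ∈₁ with ∈-map⁻ (_∷ ∅) ∈₁ | splitView l (Vec.sum λs) u
  ... | A , A∈ , refl | left i  = subst T (sym (mem-left W Ws i))
    (nonempty-⊆ W A∈ i (subst T (mem-left A (∅ {λs = λs}) i) u∈))
  ... | A , A∈ , refl | right j = ⊥-elim (subst T (trans (mem-right A (∅ {λs = λs}) j) (mem-∅ λs j)) u∈)
  independents-⊆ {λs = l ∷ λs} (W ∷ Ws) As∈ {u} u∈ | inj₂ ∈₂ with ∈-map⁻ (none ∷_) ∈₂ | splitView l (Vec.sum λs) u
  ... | As , As∈′ , refl | left i  = ⊥-elim
    (subst T (trans (mem-left (none {l}) As i) (Vec.lookup-replicate i false)) u∈)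
  ... | As , As∈′ , refl | right j = subst T (sym (mem-right W Ws j))
    (independents-⊆ Ws As∈′ (subst T (mem-right (none {l}) As j) u∈))

  independents-part : (Ws : Family λs) {As : Family λs} → As ∈ independents Ws → ∀ {u v} → T (mem As u) → T
    (mem As v) → part λs u ≡ part λs v
  independents-part {λs = l ∷ λs} (W ∷ Ws) As∈ {u} {v} u∈ v∈ with ∈-++⁻ (map (_∷ ∅) (nonempty W)) As∈
  independents-part {λs = l ∷ λs} (W ∷ Ws) As∈ {u} {v} u∈ v∈ | inj₁ ∈₁
    with ∈-map⁻ (_∷ ∅) ∈₁ | splitView l (Vec.sum λs) u | splitView l (Vec.sum λs) v
  ... | A , A∈ , refl | left i  | left i′ = trans (part-left l λs i) (sym (part-left l λs i′))
  ... | A , A∈ , refl | right j | _       = ⊥-elim (subst T (trans (mem-right A (∅ {λs = λs}) j) (mem-∅ λs j)) u∈)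
  ... | A , A∈ , refl | left _  | right j = ⊥-elim (subst T (trans (mem-right A (∅ {λs = λs}) j) (mem-∅ λs j)) v∈)
  independents-part {λs = l ∷ λs} (W ∷ Ws) As∈ {u} {v} u∈ v∈ | inj₂ ∈₂
    with ∈-map⁻ (none ∷_) ∈₂ | splitView l (Vec.sum λs) u | splitView l (Vec.sum λs) v
  ... | As , As∈′ , refl | left i  | _        = ⊥-elim
    (subst T (trans (mem-left (none {l}) As i) (Vec.lookup-replicate i false)) u∈)
  ... | As , As∈′ , refl | right _ | left i   = ⊥-elim
    (subst T (trans (mem-left (none {l}) As i) (Vec.lookup-replicate i false)) v∈)
  ... | As , As∈′ , refl | right j | right j′ = trans (part-right l λs j) (trans
    (cong suc (independents-part Ws As∈′ (subst T (mem-right (none {l}) As j) u∈)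
      (subst T (mem-right (none {l}) As j′) v∈)))
    (sym (part-right l λs j′)))

  -- Inclusion-exclusion over the sources.

  K∣ : Family λs → Graph (Vec.sum λs)
  K∣ {λs = λs} Ws = induced (K λs) (mem Ws)

  module _ {λs : Vec ℕ r} (Ws : Family λs) where

    private
      Ds : List (Digraph (Vec.sum λs))
      Ds = digraphs (Vec.sum λs)

      ao : Digraph (Vec.sum λs) → Bool
      ao D = does (acyclicOrientation? (K∣ Ws) D)

      source : Digraph (Vec.sum λs) → Fin (Vec.sum λs) → Bool
      source D u = does (noArcInto? D u)

      does⁻ : {X : Set} (d : Dec X) → T (does d) → X
      does⁻ (yes x) _ = x

      does⁺ : {X : Set} (d : Dec X) → X → T (does d)
      does⁺ (yes _) _ = _
      does⁺ (no ¬x) x = ¬x x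

    -- All these counts become sums over the same list of digraphs, so the sum over independent sets
    -- can be moved inside, to a fixed digraph and its sources.
    ao-without : ∀ {As} → As ∈ independents Ws → ι (AO (K∣ (Ws ∖ᶠ As))) ≡ ∑ Ds (λ D → χ (ao D) * χ (As ⊆ᶠ source D))
    ao-without {As} As∈ = begin
      ι (AO (K∣ (Ws ∖ᶠ As)))
        ≡⟨ cong ι (AO-cong (K∣ (Ws ∖ᶠ As)) (induced (K λs) (without (K λs) (mem Ws) (mem As)))
             (λ u v (a , u∈ , v∈) → a , subst T (mem-∖ Ws As u) u∈ , subst T (mem-∖ Ws As v) v∈)
             (λ u v (a , u∈ , v∈) → a , subst T (sym (mem-∖ Ws As u)) u∈ , subst T (sym (mem-∖ Ws As v)) v∈)) ⟩
      ι (AO (induced (K λs) (without (K λs) (mem Ws) (mem As))))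
        ≡⟨ cong ι (count-with-sources (K λs) (mem Ws) (mem As) (independents-⊆ Ws As∈)
             (λ u∈ v∈ u≁v → u≁v (independents-part Ws As∈ u∈ v∈))) ⟨
      ι (length (filter (λ D → acyclicOrientation? (K∣ Ws) D ×-dec sourcesContain? (mem As) D) Ds))
        ≡⟨ ι-length-filter (λ D → acyclicOrientation? (K∣ Ws) D ×-dec sourcesContain? (mem As) D) Ds ⟩
      ∑ Ds (λ D → χ (ao D ∧ does (sourcesContain? (mem As) D)))
        ≡⟨ ∑-cong Ds (λ {D} _ → trans (χ-∧ (ao D) (does (sourcesContain? (mem As) D)))
             (cong (λ b → χ (ao D) * χ b) (does-⇔
               (mk⇔ (λ h → ⊆ᶠ⁺ As λ u u∈ → does⁺ (noArcInto? D u) (h u u∈))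
                    (λ t u u∈ → does⁻ (noArcInto? D u) (⊆ᶠ⁻ As t u u∈)))
               (sourcesContain? (mem As) D) (T? (As ⊆ᶠ source D))))) ⟩
      ∑ Ds (λ D → χ (ao D) * χ (As ⊆ᶠ source D)) ∎
      where open ≡-Reasoning

    -- Inclusion–exclusion over the sources, which are nonempty and lie in one part.
    ao-recurrence : ∀ {u} → T (mem Ws u) →
      ι (AO (K∣ Ws)) ≡ - ∑ (independents Ws) (λ As → sgnᶠ As * ι (AO (K∣ (Ws ∖ᶠ As))))
    ao-recurrence {u} u∈ = sym (begin
      - ∑ Is (λ As → sgnᶠ As * ι (AO (K∣ (Ws ∖ᶠ As))))
        ≡⟨ cong -_ (∑-cong Is λ {As} As∈ → trans (cong (sgnᶠ As *_) (ao-without As∈)) (sym (∑-*ˡ Ds (sgnᶠ As) _))) ⟩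
      - ∑ Is (λ As → ∑ Ds (λ D → sgnᶠ As * (χ (ao D) * χ (As ⊆ᶠ source D))))
        ≡⟨ cong -_ (∑-swap Is Ds _) ⟩
      - ∑ Ds (λ D → ∑ Is (λ As → sgnᶠ As * (χ (ao D) * χ (As ⊆ᶠ source D))))
        ≡⟨ cong -_ (∑-cong Ds λ {D} _ → trans
             (∑-cong Is λ {As} _ → solve 3 (λ s a c → s :* (a :* c) := a :* (s :* c)) refl (sgnᶠ As) (χ (ao D))
               (χ (As ⊆ᶠ source D)))
             (trans (∑-*ˡ Is (χ (ao D)) _) (cong (χ (ao D) *_) (∑-independents-sgn Ws (source D))))) ⟩
      - ∑ Ds (λ D → χ (ao D) * - hits Ws (source D))
        ≡⟨ cong -_ (∑-cong Ds λ {D} _ → one D (acyclicOrientation? (K∣ Ws) D)) ⟩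
      - ∑ Ds (λ D → - χ (ao D))
        ≡⟨ cong -_ (∑-neg Ds (λ D → χ (ao D))) ⟩
      - - ∑ Ds (λ D → χ (ao D))
        ≡⟨ solve 1 (λ x → :- :- x := x) refl (∑ Ds (λ D → χ (ao D))) ⟩
      ∑ Ds (λ D → χ (ao D))
        ≡⟨ ι-length-filter (acyclicOrientation? (K∣ Ws)) Ds ⟨
      ι (AO (K∣ Ws)) ∎)
      where
      open ≡-Reasoning
      Is = independents Ws
      -- For an acyclic orientation the sources in `Ws` meet exactly one part; all other digraphs
      -- have weight 0.
      one : ∀ D (d : Dec (AcyclicOrientation (K∣ Ws) D)) → χ (does d) * - hits Ws (source D) ≡ - χ (does d)
      one D (no _)  = ℚ.*-zeroˡ (- hits Ws (source D))
      one D (yes o) = trans (ℚ.*-identityˡ (- hits Ws (source D)))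
        (let s , s∈ , no-arc = source-exists {G = K λs} {mem Ws} {D} o u∈ in
         cong -_ (hits-one Ws (source D) s s∈ (does⁺ (noArcInto? D s) no-arc) same))
        where
        same : ∀ u v → T (mem Ws u) → T (mem Ws v) → T (source D u) → T (source D v) → part λs u ≡ part λs v
        same u v u∈ v∈ su sv with part λs u Fin.≟ part λs v
        ... | yes eq = eq
        ... | no neq = ⊥-elim (sources-independent {G = K λs} {mem Ws} {D} o {u} {v} u∈ v∈
          (does⁻ (noArcInto? D u) su) (does⁻ (noArcInto? D v) sv) neq)

-- The coefficients of `P m` and their operator identities.

module PartPolynomials where

  open import Data.Rational.Base using (_+_; _*_; _-_; -_)
  open RawSemiringDefs ℚ.+-*-rawSemiring using (sum) renaming (_^_ to _^ℚ_)
  open Calculus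
  open Integration
  open SourceCounting
  open Multipartite

  private
    variable
      r : ℕ
      λs : Vec ℕ r

  toℚᵘ-/1 : ∀ i → toℚᵘ (i / 1) ℚᵘ.≃ ℚᵘ.mkℚᵘ i 0
  toℚᵘ-/1 i = ℚ.toℚᵘ-fromℚᵘ (ℚᵘ.mkℚᵘ i 0)

  /1-+ : ∀ i j → (i ℤ.+ j) / 1 ≡ i / 1 + j / 1
  /1-+ i j = ℚ.toℚᵘ-injective (ℚᵘ.≃-trans (toℚᵘ-/1 (i ℤ.+ j)) (ℚᵘ.≃-sym (ℚᵘ.≃-trans (ℚ.toℚᵘ-homo-+ (i / 1) (j / 1))
    (ℚᵘ.≃-trans (ℚᵘ.+-cong (toℚᵘ-/1 i) (toℚᵘ-/1 j))
      (ℚᵘ.*≡* (cong (ℤ._* pos 1) (cong₂ ℤ._+_ (ℤ.*-identityʳ i) (ℤ.*-identityʳ j))))))))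

  /1-* : ∀ i j → (i ℤ.* j) / 1 ≡ i / 1 * (j / 1)
  /1-* i j = ℚ.toℚᵘ-injective (ℚᵘ.≃-trans (toℚᵘ-/1 (i ℤ.* j)) (ℚᵘ.≃-sym (ℚᵘ.≃-trans (ℚ.toℚᵘ-homo-* (i / 1) (j / 1))
    (ℚᵘ.≃-trans (ℚᵘ.*-cong (toℚᵘ-/1 i) (toℚᵘ-/1 j)) (ℚᵘ.*≡* refl)))))

  coeff : ℕ → ℕ → ℚ
  coeff m j = (-1ℤ ℤ.^ (m ℕ.+ j) ℤ.* pos (S m j)) / 1

  coeff-S≡0 : ∀ m j → S m j ≡ 0 → coeff m j ≡ 0ℚ
  coeff-S≡0 m j eq = cong (_/ 1) (trans (cong (λ s → -1ℤ ℤ.^ (m ℕ.+ j) ℤ.* pos s) eq) (ℤ.*-zeroʳ (-1ℤ ℤ.^ (m ℕ.+ j))))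

  S-above : ∀ {m j} → m ℕ.< j → S m j ≡ 0
  S-above {zero}  {suc j} _         = refl
  S-above {suc m} {suc j} (ℕ.s≤s m<j) = trans
    (cong₂ (λ a b → suc j ℕ.* a ℕ.+ b) (S-above (ℕ.m≤n⇒m≤1+n m<j)) (S-above m<j))
    (trans (ℕ.+-identityʳ (suc j ℕ.* 0)) (ℕ.*-zeroʳ (suc j)))

  -- p ↦ p - p′ and p ↦ t (p - p′) on coefficient sequences.
  𝓛 𝓜 : (ℕ → ℚ) → ℕ → ℚ
  𝓛 q j = q j - ι (suc j) * q (suc j)
  𝓜 q zero    = 0ℚ
  𝓜 q (suc j) = 𝓛 q j

  -- This is the Stirling recurrence: the factor `suc j` matches the derivative of `t ^ (j + 1)`,
  -- and the minus sign comes from the odd shift in the exponent of `-1ℤ`.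
  coeff-suc : ∀ m j → coeff (suc m) j ≡ 𝓜 (coeff m) j
  coeff-suc m zero    = coeff-S≡0 (suc m) 0 refl
  coeff-suc m (suc j) = begin
    (-1ℤ ℤ.* t ℤ.* pos (suc j ℕ.* S m (suc j) ℕ.+ S m j)) / 1
      ≡⟨ cong (λ u → (-1ℤ ℤ.* t ℤ.* u) / 1)
           (trans (ℤ.pos-+ (suc j ℕ.* S m (suc j)) (S m j))
             (cong (ℤ._+ pos (S m j)) (ℤ.pos-* (suc j) (S m (suc j))))) ⟩
    (-1ℤ ℤ.* t ℤ.* (pos (suc j) ℤ.* pos (S m (suc j)) ℤ.+ pos (S m j))) / 1
      ≡⟨ cong (_/ 1) (trans
           (cong (λ t → -1ℤ ℤ.* t ℤ.* (pos (suc j) ℤ.* pos (S m (suc j)) ℤ.+ pos (S m j))) t≡)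
           (trans (ℤ.+-*-Solver.solve 4 (λ s J A B → (c- :*ℤ (c- :*ℤ s)) :*ℤ (J :*ℤ A :+ℤ B) :=ℤ s :*ℤ B :+ℤ
             (c- :*ℤ J) :*ℤ ((c- :*ℤ s) :*ℤ A))
             refl s (pos (suc j)) (pos (S m (suc j))) (pos (S m j)))
             (cong (λ t → s ℤ.* pos (S m j) ℤ.+ (-1ℤ ℤ.* pos (suc j)) ℤ.* (t ℤ.* pos (S m (suc j)))) (sym t≡)))) ⟩
    (s ℤ.* pos (S m j) ℤ.+ (-1ℤ ℤ.* pos (suc j)) ℤ.* (t ℤ.* pos (S m (suc j)))) / 1
      ≡⟨ trans (/1-+ (s ℤ.* pos (S m j)) ((-1ℤ ℤ.* pos (suc j)) ℤ.* (t ℤ.* pos (S m (suc j)))))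
           (cong (coeff m j +_) (trans (/1-* (-1ℤ ℤ.* pos (suc j)) (t ℤ.* pos (S m (suc j))))
             (cong (_* coeff m (suc j)) (/1-* -1ℤ (pos (suc j)))))) ⟩
    coeff m j + (- 1ℚ) * ι (suc j) * coeff m (suc j)
      ≡⟨ solve 3 (λ a i b → a :+ con (- 1ℚ) :* i :* b := a :- i :* b) refl (coeff m j) (ι (suc j)) (coeff m (suc j)) ⟩
    𝓛 (coeff m) j ∎
    where
    open ≡-Reasoning
    open ℤ.+-*-Solver using () renaming (_:*_ to _:*ℤ_; _:+_ to _:+ℤ_; _:=_ to _:=ℤ_; con to conℤ)
    c- : ∀ {n} → ℤ.+-*-Solver.Polynomial n
    c- = conℤ -1ℤ
    s t : ℤ
    s = -1ℤ ℤ.^ (m ℕ.+ j)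
    t = -1ℤ ℤ.^ (m ℕ.+ suc j)
    t≡ : t ≡ -1ℤ ℤ.* s
    t≡ = cong (-1ℤ ℤ.^_) (ℕ.+-suc m j)

  -- The coefficients of 𝓜ᵏ (𝓛 (P i)).  Taking differences in k shifts i, because
  -- 𝓛 𝓜 = (𝓜 - 1) 𝓛.
  iter : ℕ → ℕ → ℕ → ℚ
  iter zero    i = 𝓛 (coeff i)
  iter (suc k) i = 𝓜 (iter k i)

  iter-difference : ∀ k i j → iter (suc k) i j - iter k i j ≡ iter k (suc i) j
  iter-difference zero i zero = trans
    (solve 2 (λ a b → con 0ℚ :- (a :- con 1ℚ :* b) := con 0ℚ :- con 1ℚ :* (a :- con 1ℚ :* b)) refl (coeff i 0)
      (coeff i 1))
    (sym (cong₂ (λ a b → a - ι 1 * b) (coeff-suc i 0) (coeff-suc i 1)))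
  iter-difference zero i (suc j) = trans
    (trans (solve 3 (λ a k l → a :- k :* l :- l := a :- (k :+ con 1ℚ) :* l) refl (𝓛 (coeff i) j) (ι (suc j)) l)
      (cong (λ k → 𝓛 (coeff i) j - k * l) (sym (ι-suc (suc j)))))
    (sym (cong₂ (λ a b → a - ι (suc (suc j)) * b) (coeff-suc i (suc j)) (coeff-suc i (suc (suc j)))))
    where
    l : ℚ
    l = 𝓛 (coeff i) (suc j)
  iter-difference (suc k) i zero    = refl
  iter-difference (suc k) i (suc j) = trans
    (solve 5 (λ a b c d n → (a :- n :* b) :- (c :- n :* d) := (a :- c) :- n :* (b :- d)) refl
      (iter (suc k) i j) (iter (suc k) i (suc j)) (iter k i j) (iter k i (suc j)) (ι (suc j)))
    (cong₂ (λ a b → a - ι (suc j) * b) (iter-difference k i j) (iter-difference k i (suc j)))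

  -- `𝓛` fixes the constant polynomial 1, so this reads `𝓜ᵏ 1 = P k`.
  iter-0 : ∀ k j → iter k 0 j ≡ coeff k j
  iter-0 zero zero    = refl
  iter-0 zero (suc j) = trans
    (cong₂ (λ a b → a - ι (suc (suc j)) * b) (coeff-S≡0 0 (suc j) refl) (coeff-S≡0 0 (suc (suc j)) refl))
    (trans (solve 1 (λ i → con 0ℚ :- i :* con 0ℚ := con 0ℚ) refl (ι (suc (suc j)))) (sym (coeff-S≡0 0 (suc j) refl)))
  iter-0 (suc k) zero    = sym (coeff-suc k 0)
  iter-0 (suc k) (suc j) = trans (cong₂ (λ a b → a - ι (suc j) * b) (iter-0 k j) (iter-0 k (suc j)))
    (sym (coeff-suc k (suc j)))

  count : ∀ {n} → Subset n → ℕ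
  count []          = 0
  count (false ∷ W) = count W
  count (true ∷ W)  = suc (count W)

  -- The binomial expansion of `(𝓜 - 1)^|W|` applied to `𝓛 (P i)`, where each factor `𝓜 - 1` raises
  -- `i` by one.
  ∑-subsets-iter : ∀ {n} (W : Subset n) i j → ∑ (subsets W) (λ A → sgn A * iter (count (W ∖ A)) i j) ≡ iter 0
    (i ℕ.+ count W) j
  ∑-subsets-iter [] i j = trans (solve 1 (λ a → con 1ℚ :* a :+ con 0ℚ := a) refl (iter 0 i j))
    (cong (λ i → iter 0 i j) (sym (ℕ.+-identityʳ i)))
  ∑-subsets-iter (false ∷ W) i j = trans
    (∑-map (false ∷_) (subsets W) (λ A → sgn A * iter (count ((false ∷ W) ∖ A)) i j))
    (∑-subsets-iter W i j)
  ∑-subsets-iter (true ∷ W) i j = begin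
    ∑ (subsets (true ∷ W)) f
      ≡⟨ ∑-++ (map (false ∷_) (subsets W)) (map (true ∷_) (subsets W)) f ⟩
    ∑ (map (false ∷_) (subsets W)) f + ∑ (map (true ∷_) (subsets W)) f
      ≡⟨ cong₂ _+_ (∑-map (false ∷_) (subsets W) f) (∑-map (true ∷_) (subsets W) f) ⟩
    ∑ (subsets W) (λ A → sgn A * iter (suc (count (W ∖ A))) i j) + ∑ (subsets W)
      (λ A → - sgn A * iter (count (W ∖ A)) i j)
      ≡⟨ ∑-+ (subsets W) (λ A → sgn A * iter (suc (count (W ∖ A))) i j) (λ A → - sgn A * iter (count (W ∖ A)) i j) ⟨
    ∑ (subsets W) (λ A → sgn A * iter (suc (count (W ∖ A))) i j + - sgn A * iter (count (W ∖ A)) i j)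
      ≡⟨ ∑-cong (subsets W) (λ {A} _ → trans
           (solve 3 (λ s a b → s :* a :+ (:- s) :* b := s :* (a :- b)) refl (sgn A)
             (iter (suc (count (W ∖ A))) i j) (iter (count (W ∖ A)) i j))
           (cong (sgn A *_) (iter-difference (count (W ∖ A)) i j))) ⟩
    ∑ (subsets W) (λ A → sgn A * iter (count (W ∖ A)) (suc i) j)
      ≡⟨ ∑-subsets-iter W (suc i) j ⟩
    iter 0 (suc i ℕ.+ count W) j
      ≡⟨ cong (λ i → iter 0 i j) (ℕ.+-suc i (count W)) ⟨
    iter 0 (i ℕ.+ suc (count W)) j ∎
    where
    open ≡-Reasoning
    f : Subset _ → ℚ
    f A = sgn A * iter (count ((true ∷ W) ∖ A)) i j

  -- At `i = 0` the signed sum over all subsets is `𝓛` of `P (count W)`, that is `P - P′`. Its term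
  -- for the empty set is `P`, so the nonempty sets give `- P′`.
  coeff-derivative : ∀ {n} (W : Subset n) j →
    ι (suc j) * coeff (count W) (suc j) ≡ - ∑ (nonempty W) (λ A → sgn A * coeff (count (W ∖ A)) j)
  coeff-derivative {n} W j = begin
    i * c′                    ≡⟨ solve 3 (λ i c c′ → i :* c′ := :- ((c :- i :* c′) :- con 1ℚ :* c)) refl i c c′ ⟩
    - (𝓛 (coeff (count W)) j - 1ℚ * c)
      ≡⟨ cong (λ x → - (x - 1ℚ * c)) (trans (sym (∑-subsets-iter W 0 j))
           (∑-cong (subsets W) λ {A} _ → cong (sgn A *_) (iter-0 (count (W ∖ A)) j))) ⟩
    - (∑ (subsets W) f - 1ℚ * c)
      ≡⟨ cong₂ (λ x y → - (x - y)) (∑-subsets W f)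
           (sym (cong₂ _*_ (sgn-none n) (cong (λ W → coeff (count W) j) (∖-none W)))) ⟩
    - (f none + ∑ (nonempty W) f - f none)
      ≡⟨ solve 2 (λ a b → :- (a :+ b :- a) := :- b) refl (f none) (∑ (nonempty W) f) ⟩
    - ∑ (nonempty W) f        ∎
    where
    open ≡-Reasoning
    i c c′ : ℚ
    i = ι (suc j)
    c = coeff (count W) j
    c′ = coeff (count W) (suc j)
    f : Subset n → ℚ
    f A = sgn A * coeff (count (W ∖ A)) j

  -- Evaluation of coefficient sequences, and products over the parts.

  -- Terms are added at the far end, unlike in `sum`, so that raising the degree bound of `eval`
  -- only appends a term.
  partialSum : (ℕ → ℚ) → ℕ → ℚ
  partialSum f zero    = 0ℚ
  partialSum f (suc d) = partialSum f d + f d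

  partialSum-front : ∀ f d → partialSum f (suc d) ≡ f 0 + partialSum (f ∘ suc) d
  partialSum-front f zero    = ℚ.+-comm 0ℚ (f 0)
  partialSum-front f (suc d) = trans (cong (_+ f (suc d)) (partialSum-front f d)) (ℚ.+-assoc (f 0) _ (f (suc d)))

  partialSum-sum : ∀ f d → partialSum f d ≡ sum {d} (f ∘ toℕ)
  partialSum-sum f zero    = refl
  partialSum-sum f (suc d) = trans (partialSum-front f d) (cong (f 0 +_) (partialSum-sum (f ∘ suc) d))

  eval : (ℕ → ℚ) → ℕ → ℚ → ℚ
  eval q d t = partialSum (λ j → q j * t ^ℚ j) d

  eval-cong : ∀ {p q} → (∀ j → p j ≡ q j) → ∀ d t → eval p d t ≡ eval q d t
  eval-cong p≡q zero    t = refl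
  eval-cong p≡q (suc d) t = cong₂ _+_ (eval-cong p≡q d t) (cong (_* t ^ℚ d) (p≡q d))

  eval-∑ : {A : Set} (xs : List A) (g : A → ℚ) (q : A → ℕ → ℚ) → ∀ d t →
    eval (λ j → - ∑ xs (λ x → g x * q x j)) d t ≡ - ∑ xs (λ x → g x * eval (q x) d t)
  eval-∑ xs g q zero    t = sym (cong -_ (trans (∑-cong xs λ {x} _ → ℚ.*-zeroʳ (g x)) (∑-zero xs)))
  eval-∑ xs g q (suc d) t = begin
    eval (λ j → - ∑ xs (λ x → g x * q x j)) d t + (- ∑ xs (λ x → g x * q x d)) * t ^ℚ d
      ≡⟨ cong (_+ (- ∑ xs (λ x → g x * q x d)) * t ^ℚ d) (eval-∑ xs g q d t) ⟩
    - ∑ xs (λ x → g x * eval (q x) d t) + (- ∑ xs (λ x → g x * q x d)) * t ^ℚ d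
      ≡⟨ solve 3 (λ a b c → :- a :+ (:- b) :* c := :- (a :+ c :* b)) refl (∑ xs (λ x → g x * eval (q x) d t))
        (∑ xs (λ x → g x * q x d)) (t ^ℚ d) ⟩
    - (∑ xs (λ x → g x * eval (q x) d t) + t ^ℚ d * ∑ xs (λ x → g x * q x d))
      ≡⟨ cong (λ y → - (∑ xs (λ x → g x * eval (q x) d t) + y)) (∑-*ˡ xs (t ^ℚ d) (λ x → g x * q x d)) ⟨
    - (∑ xs (λ x → g x * eval (q x) d t) + ∑ xs (λ x → t ^ℚ d * (g x * q x d)))
      ≡⟨ cong -_ (∑-+ xs (λ x → g x * eval (q x) d t) (λ x → t ^ℚ d * (g x * q x d))) ⟨
    - ∑ xs (λ x → g x * eval (q x) d t + t ^ℚ d * (g x * q x d))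
      ≡⟨ cong -_ (∑-cong xs λ {x} _ → solve 4 (λ g e t q → g :* e :+ t :* (g :* q) := g :* (e :+ q :* t)) refl
        (g x) (eval (q x) d t) (t ^ℚ d) (q x d)) ⟩
    - ∑ xs (λ x → g x * (eval (q x) d t + q x d * t ^ℚ d)) ∎
    where open ≡-Reasoning

  power′ : ℕ → ℚ → ℚ
  power′ zero    t = 0ℚ
  power′ (suc k) t = ι (suc k) * t ^ℚ k

  polynomial-power : ∀ k → Polynomial (_^ℚ k) (power′ k)
  polynomial-power zero    = constant 1ℚ
  polynomial-power (suc k) = ext (λ _ → refl) (power′-suc k) (var ⊗ polynomial-power k)
    where
    power′-suc : ∀ k t → t * power′ k t + 1ℚ * t ^ℚ k ≡ power′ (suc k) t
    power′-suc zero    t = solve 1 (λ t → t :* con 0ℚ :+ con 1ℚ :* con 1ℚ := con 1ℚ :* con 1ℚ) refl t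
    power′-suc (suc k) t = trans
      (solve 3 (λ t i u → t :* (i :* u) :+ con 1ℚ :* (t :* u) := (i :+ con 1ℚ) :* (t :* u)) refl t (ι (suc k))
        (t ^ℚ k))
      (cong (_* t ^ℚ suc k) (sym (ι-suc (suc k))))

  eval′ : (ℕ → ℚ) → ℕ → ℚ → ℚ
  eval′ q d t = partialSum (λ j → q j * power′ j t) d

  polynomial-eval : ∀ q d → Polynomial (eval q d) (eval′ q d)
  polynomial-eval q zero    = constant 0ℚ
  polynomial-eval q (suc d) = polynomial-eval q d ⊕ ext (λ _ → refl)
    (λ t → solve 3 (λ c u v → c :* u :+ con 0ℚ :* v := c :* u) refl (q d) (power′ d t) (t ^ℚ d))
    (constant (q d) ⊗ polynomial-power d)

  eval′-suc : ∀ q d t → eval′ q (suc d) t ≡ eval (λ j → ι (suc j) * q (suc j)) d t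
  eval′-suc q zero    t = solve 1 (λ c → con 0ℚ :+ c :* con 0ℚ := con 0ℚ) refl (q 0)
  eval′-suc q (suc d) t = cong₂ _+_ (eval′-suc q d t)
    (solve 3 (λ c i u → c :* (i :* u) := i :* c :* u) refl (q (suc d)) (ι (suc d)) (t ^ℚ d))

  -- Unlike P, whose sum starts at j = 1, this includes the constant term, so 𝐏 0 = 1.
  𝐏 𝐏′ : ℕ → ℚ → ℚ
  𝐏  m = eval  (coeff m) (suc m)
  𝐏′ m = eval′ (coeff m) (suc m)

  eval-coeff : ∀ {m d} → m ℕ.<′ d → ∀ t → eval (coeff m) d t ≡ 𝐏 m t
  eval-coeff (ℕ.≤′-reflexive refl) t = refl
  eval-coeff {m} {suc d} (ℕ.≤′-step m<d) t = trans
    (cong₂ _+_ (eval-coeff m<d t)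
      (trans (cong (_* t ^ℚ d) (coeff-S≡0 m d (S-above (ℕ.≤′⇒≤ m<d)))) (ℚ.*-zeroˡ (t ^ℚ d))))
    (ℚ.+-identityʳ (𝐏 m t))

  𝐏-suc-at-0 : ∀ m → 𝐏 (suc m) 0ℚ ≡ 0ℚ
  𝐏-suc-at-0 m = go (suc (suc m))
    where
    go : ∀ d → eval (coeff (suc m)) d 0ℚ ≡ 0ℚ
    go zero          = refl
    go (suc zero)    = cong (λ c → 0ℚ + c * 1ℚ) (coeff-S≡0 (suc m) 0 refl)
    go (suc (suc d)) = cong₂ _+_ (go (suc d))
      (trans (cong (coeff (suc m) (suc d) *_) (ℚ.*-zeroˡ (0ℚ ^ℚ d))) (ℚ.*-zeroʳ (coeff (suc m) (suc d))))

  subsets-count : ∀ {n} (W : Subset n) {A} → A ∈ subsets W → count (W ∖ A) ℕ.≤ count W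
  subsets-count []          (here refl) = ℕ.z≤n
  subsets-count (false ∷ W) A∈ with ∈-map⁻ (false ∷_) A∈
  ... | _ , A∈′ , refl = subsets-count W A∈′
  subsets-count (true ∷ W)  A∈ with ∈-++⁻ (map (false ∷_) (subsets W)) A∈
  ... | inj₁ A∈₁ with ∈-map⁻ (false ∷_) A∈₁
  ... | _ , A∈′ , refl = ℕ.s≤s (subsets-count W A∈′)
  subsets-count (true ∷ W) A∈ | inj₂ A∈₂ with ∈-map⁻ (true ∷_) A∈₂
  ... | _ , A∈′ , refl = ℕ.m≤n⇒m≤1+n (subsets-count W A∈′)

  nonempty-count : ∀ {n} (W : Subset n) {A} → A ∈ nonempty W → count (W ∖ A) ℕ.< count W
  nonempty-count (false ∷ W) A∈ with ∈-map⁻ (false ∷_) A∈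
  ... | _ , A∈′ , refl = nonempty-count W A∈′
  nonempty-count (true ∷ W)  A∈ with ∈-++⁻ (map (false ∷_) (nonempty W)) A∈
  ... | inj₁ A∈₁ with ∈-map⁻ (false ∷_) A∈₁
  ... | _ , A∈′ , refl = ℕ.s≤s (nonempty-count W A∈′)
  nonempty-count (true ∷ W) A∈ | inj₂ A∈₂ with ∈-map⁻ (true ∷_) A∈₂
  ... | _ , A∈′ , refl = ℕ.s≤s (subsets-count W A∈′)

  𝐏′-recurrence : ∀ {n} (W : Subset n) t → 𝐏′ (count W) t ≡ - ∑ (nonempty W) (λ A → sgn A * 𝐏 (count (W ∖ A)) t)
  𝐏′-recurrence W t = begin
    𝐏′ (count W) t
      ≡⟨ eval′-suc (coeff (count W)) (count W) t ⟩
    eval (λ j → ι (suc j) * coeff (count W) (suc j)) (count W) t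
      ≡⟨ eval-cong (coeff-derivative W) (count W) t ⟩
    eval (λ j → - ∑ (nonempty W) (λ A → sgn A * coeff (count (W ∖ A)) j)) (count W) t
      ≡⟨ eval-∑ (nonempty W) sgn (λ A → coeff (count (W ∖ A))) (count W) t ⟩
    - ∑ (nonempty W) (λ A → sgn A * eval (coeff (count (W ∖ A))) (count W) t)
      -- Removing a nonempty set lowers the count, so all these polynomials fit under the one bound
      -- `count W` inherited from the derivative.
      ≡⟨ cong -_ (∑-cong (nonempty W) λ {A} A∈ → cong (sgn A *_) (eval-coeff (ℕ.≤⇒≤′ (nonempty-count W A∈)) t)) ⟩
    - ∑ (nonempty W) (λ A → sgn A * 𝐏 (count (W ∖ A)) t) ∎
    where open ≡-Reasoning

  ∏𝐏 ∏𝐏′ : Family λs → ℚ → ℚ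
  ∏𝐏 []       t = 1ℚ
  ∏𝐏 (W ∷ Ws) t = 𝐏 (count W) t * ∏𝐏 Ws t
  ∏𝐏′ []       t = 0ℚ
  ∏𝐏′ (W ∷ Ws) t = 𝐏 (count W) t * ∏𝐏′ Ws t + 𝐏′ (count W) t * ∏𝐏 Ws t

  polynomial-∏𝐏 : (Ws : Family λs) → Polynomial (∏𝐏 Ws) (∏𝐏′ Ws)
  polynomial-∏𝐏 []       = constant 1ℚ
  polynomial-∏𝐏 (W ∷ Ws) = polynomial-eval (coeff (count W)) (suc (count W)) ⊗ polynomial-∏𝐏 Ws

  -- The product rule differentiates one factor at a time, just as an independent set lives in one
  -- part; removing the empty set leaves the other factors as they are.
  ∏𝐏′-recurrence : (Ws : Family λs) → ∀ t →
    ∏𝐏′ Ws t ≡ - ∑ (independents Ws) (λ As → sgnᶠ As * ∏𝐏 (Ws ∖ᶠ As) t)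
  ∏𝐏′-recurrence []       t = refl
  ∏𝐏′-recurrence {λs = l ∷ λs} (W ∷ Ws) t = begin
    P₁ * ∏𝐏′ Ws t + 𝐏′ (count W) t * P₂
      ≡⟨ cong₂ (λ x y → P₁ * x + y * P₂) (∏𝐏′-recurrence Ws t) (𝐏′-recurrence W t) ⟩
    P₁ * - ∑ Is f₂ + (- ∑ Ns f₁) * P₂
      ≡⟨ solve 4 (λ p a b q → p :* (:- a) :+ (:- b) :* q := :- (q :* b :+ p :* a)) refl P₁ (∑ Is f₂) (∑ Ns f₁) P₂ ⟩
    - (P₂ * ∑ Ns f₁ + P₁ * ∑ Is f₂)
      ≡⟨ cong₂ (λ x y → - (x + y)) (∑-*ˡ Ns P₂ f₁) (∑-*ˡ Is P₁ f₂) ⟨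
    - (∑ Ns (λ A → P₂ * f₁ A) + ∑ Is (λ As → P₁ * f₂ As))
      ≡⟨ cong₂ (λ x y → - (x + y))
           (∑-cong Ns λ {A} _ → trans
             (solve 3 (λ p s u → p :* (s :* u) := s :* con 1ℚ :* (u :* p)) refl P₂ (sgn A) (𝐏 (count (W ∖ A)) t))
             (cong₂ (λ x Vs → sgn A * x * (𝐏 (count (W ∖ A)) t * ∏𝐏 Vs t)) (sym (sgnᶠ-∅ λs)) (sym (∖ᶠ-∅ Ws))))
           (∑-cong Is λ {As} _ → trans
             (solve 3 (λ p s u → p :* (s :* u) := con 1ℚ :* s :* (p :* u)) refl P₁ (sgnᶠ As) (∏𝐏 (Ws ∖ᶠ As) t))
             (cong₂ (λ x V → x * sgnᶠ As * (𝐏 (count V) t * ∏𝐏 (Ws ∖ᶠ As) t)) (sym (sgn-none l)) (sym (∖-none W)))) ⟩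
    - (∑ Ns (λ A → g (A ∷ ∅)) + ∑ Is (λ As → g (none ∷ As)))
      ≡⟨ cong -_ (∑-independents W Ws g) ⟨
    - ∑ (independents (W ∷ Ws)) g ∎
    where
    open ≡-Reasoning
    P₁ P₂ : ℚ
    P₁ = 𝐏 (count W) t
    P₂ = ∏𝐏 Ws t
    Ns = nonempty W
    Is = independents Ws
    f₁ : Subset l → ℚ
    f₁ A = sgn A * 𝐏 (count (W ∖ A)) t
    f₂ : Family λs → ℚ
    f₂ As = sgnᶠ As * ∏𝐏 (Ws ∖ᶠ As) t
    g : Family (l ∷ λs) → ℚ
    g As = sgnᶠ As * ∏𝐏 ((W ∷ Ws) ∖ᶠ As) t

  -- Induction on the number of vertices.

  size : Family λs → ℕ
  size []       = 0
  size (W ∷ Ws) = count W ℕ.+ size Ws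

  independents-size : (Ws : Family λs) {As : Family λs} → As ∈ independents Ws → size (Ws ∖ᶠ As) ℕ.< size Ws
  independents-size (W ∷ Ws) As∈ with ∈-++⁻ (map (_∷ ∅) (nonempty W)) As∈
  ... | inj₁ ∈₁ with ∈-map⁻ (_∷ ∅) ∈₁
  ... | A , A∈ , refl = subst (λ Vs → count (W ∖ A) ℕ.+ size Vs ℕ.< count W ℕ.+ size Ws) (sym (∖ᶠ-∅ Ws))
    (ℕ.+-monoˡ-< (size Ws) (nonempty-count W A∈))
  independents-size (W ∷ Ws) As∈ | inj₂ ∈₂ with ∈-map⁻ (none ∷_) ∈₂
  ... | As , As∈′ , refl = subst (λ V → count V ℕ.+ size (Ws ∖ᶠ As) ℕ.< count W ℕ.+ size Ws) (sym (∖-none W))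
    (ℕ.+-monoʳ-< (count W) (independents-size Ws As∈′))

  subset-cases : ∀ {n} (W : Subset n) → (count W ≡ 0 × ∀ i → ¬ T (lookup W i)) ⊎
    ((∃[ m ] count W ≡ suc m) × ∃[ i ] T (lookup W i))
  subset-cases []          = inj₁ (refl , λ ())
  subset-cases (true ∷ W)  = inj₂ ((count W , refl) , zero , _)
  subset-cases (false ∷ W) with subset-cases W
  ... | inj₁ (eq , W∅)       = inj₁ (eq , λ { (suc i) → W∅ i })
  ... | inj₂ (eq , i , Wi)   = inj₂ (eq , suc i , Wi)

  -- Separates the base case from the case where integration by parts has boundary term 0. One
  -- nonempty part suffices for the latter, since its factor vanishes at 0.
  family-cases : (Ws : Family λs) → ((∀ t → ∏𝐏 Ws t ≡ 1ℚ) × ∀ u → ¬ T (mem Ws u)) ⊎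
    (∏𝐏 Ws 0ℚ ≡ 0ℚ × ∃[ u ] T (mem Ws u))
  family-cases [] = inj₁ ((λ _ → refl) , λ ())
  family-cases {λs = l ∷ λs} (W ∷ Ws) with subset-cases W | family-cases Ws
  ... | inj₂ ((m , eq) , i , Wi) | _ = inj₂
    (trans (cong (_* ∏𝐏 Ws 0ℚ) (trans (cong (λ m → 𝐏 m 0ℚ) eq) (𝐏-suc-at-0 m))) (ℚ.*-zeroˡ (∏𝐏 Ws 0ℚ)) ,
     i ↑ˡ Vec.sum λs , subst T (sym (mem-left W Ws i)) Wi)
  ... | inj₁ _ | inj₂ (eq , u , u∈) = inj₂
    (trans (cong (𝐏 (count W) 0ℚ *_) eq) (ℚ.*-zeroʳ (𝐏 (count W) 0ℚ)) , l ↑ʳ u , subst T (sym (mem-right W Ws u)) u∈)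
  ... | inj₁ (eq , W∅) | inj₁ (eq′ , Ws∅) = inj₁ ((λ t → cong₂ _*_ (cong (λ m → 𝐏 m t) eq) (eq′ t)) , empty)
    where
    empty : ∀ u → ¬ T (mem (W ∷ Ws) u)
    empty u u∈ with splitView l (Vec.sum λs) u
    ... | left i  = W∅ i (subst T (mem-left W Ws i) u∈)
    ... | right j = Ws∅ j (subst T (mem-right W Ws j) u∈)

  -- Then - e⁻ᵗ Q(t) is a primitive of e⁻ᵗ p(t), so ∫₀^∞ e⁻ᵗ p(t) dt = L.
  record Laplace (p : ℚ → ℚ) (L : ℚ) : Set where
    constructor laplace
    field
      {Q Q′} : ℚ → ℚ
      poly   : Polynomial Q Q′
      Q-Q′≡p : ∀ t → Q t - Q′ t ≡ p t
      Q0≡L   : Q 0ℚ ≡ L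

  laplace-ext : ∀ {p q K L} → p ≗ q → K ≡ L → Laplace p K → Laplace q L
  laplace-ext p≗q K≡L (laplace Q eq Q0) = laplace Q (λ t → trans (eq t) (p≗q t)) (trans Q0 K≡L)

  laplace-+ : ∀ {p q K L} → Laplace p K → Laplace q L → Laplace (λ t → p t + q t) (K + L)
  laplace-+ (laplace {Q} {Q′} P eq P0) (laplace {R} {R′} P₁ eq₁ P₁0) = laplace (P ⊕ P₁)
    (λ t → trans (solve 4 (λ q q′ r r′ → q :+ r :- (q′ :+ r′) := (q :- q′) :+ (r :- r′)) refl (Q t) (Q′ t) (R t)
      (R′ t))
      (cong₂ _+_ (eq t) (eq₁ t))) (cong₂ _+_ P0 P₁0)

  laplace-scale : ∀ {p L} c → Laplace p L → Laplace (λ t → c * p t) (c * L)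
  laplace-scale c (laplace {Q} {Q′} P eq P0) = laplace (constant c ⊗ P)
    (λ t → trans (solve 3 (λ c q q′ → c :* q :- (c :* q′ :+ con 0ℚ :* q) := c :* (q :- q′)) refl c (Q t) (Q′ t))
      (cong (c *_) (eq t)))
    (cong (c *_) P0)

  laplace-∑ : {A : Set} (xs : List A) (g : A → ℚ) {p : A → ℚ → ℚ} {L : A → ℚ} →
    (∀ {x} → x ∈ xs → Laplace (p x) (L x)) → Laplace (λ t → ∑ xs (λ x → g x * p x t)) (∑ xs (λ x → g x * L x))
  laplace-∑ []       g h = laplace (constant 0ℚ) (λ _ → refl) refl
  laplace-∑ (x ∷ xs) g h = laplace-+ (laplace-scale (g x) (h (here refl))) (laplace-∑ xs g (h ∘ there))

  -- Integration by parts.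
  laplace-derivative : ∀ {p p′ L} → Polynomial p p′ → Laplace p′ L → Laplace p (p 0ℚ + L)
  laplace-derivative {p} {p′} P (laplace {Q} {Q′} R eq R0) = laplace (P ⊕ R)
    (λ t → trans (cong (λ x → p t + Q t - (x + Q′ t)) (sym (eq t)))
      (solve 3 (λ p q q′ → p :+ q :- (q :- q′ :+ q′) := p) refl (p t) (Q t) (Q′ t)))
    (cong (p 0ℚ +_) R0)

  -- The value is the right-hand side of `ao-recurrence` with `α` in place of the counts, so
  -- integrals and counts obey the same recursion.
  laplace-∏𝐏-step : (Ws : Family λs) (α : Family λs → ℚ) → ∏𝐏 Ws 0ℚ ≡ 0ℚ →
    (∀ {As} → As ∈ independents Ws → Laplace (∏𝐏 (Ws ∖ᶠ As)) (α As)) →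
    Laplace (∏𝐏 Ws) (- ∑ (independents Ws) (λ As → sgnᶠ As * α As))
  laplace-∏𝐏-step Ws α ∏0≡0 h = laplace-ext (λ _ → refl)
    (trans (cong (_+ - 1ℚ * X) ∏0≡0) (solve 1 (λ x → con 0ℚ :+ con (- 1ℚ) :* x := :- x) refl X))
    (laplace-derivative (polynomial-∏𝐏 Ws) (laplace-ext
      (λ t → trans (solve 1 (λ x → con (- 1ℚ) :* x := :- x) refl
        (∑ (independents Ws) (λ As → sgnᶠ As * ∏𝐏 (Ws ∖ᶠ As) t)))
        (sym (∏𝐏′-recurrence Ws t)))
      refl
      (laplace-scale (- 1ℚ) (laplace-∑ (independents Ws) sgnᶠ h))))
    where
    X : ℚ
    X = ∑ (independents Ws) (λ As → sgnᶠ As * α As)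

  laplace-∏𝐏 : (Ws : Family λs) → Acc ℕ._<_ (size Ws) → Laplace (∏𝐏 Ws) (ι (AO (K∣ Ws)))
  laplace-∏𝐏 Ws (acc rs) = [ edgeless , step ]′ (family-cases Ws)
    where
    edgeless : (∀ t → ∏𝐏 Ws t ≡ 1ℚ) × (∀ u → ¬ T (mem Ws u)) → Laplace (∏𝐏 Ws) (ι (AO (K∣ Ws)))
    edgeless (∏≡1 , empty) = laplace-ext (λ t → sym (∏≡1 t))
      (cong ι (sym (AO-edgeless (K∣ Ws) λ u _ (_ , u∈ , _) → empty u u∈)))
      -- The integral of e⁻ᵗ is 1, and an edgeless graph has one orientation.
      (laplace {Q′ = λ _ → 0ℚ} (constant 1ℚ) (λ _ → refl) refl)
    step : ∏𝐏 Ws 0ℚ ≡ 0ℚ × (∃[ u ] T (mem Ws u)) → Laplace (∏𝐏 Ws) (ι (AO (K∣ Ws)))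
    step (∏0≡0 , u , u∈) = subst (Laplace (∏𝐏 Ws)) (sym (ao-recurrence Ws {u} u∈))
      (laplace-∏𝐏-step Ws (λ As → ι (AO (K∣ (Ws ∖ᶠ As)))) ∏0≡0
        λ {As} As∈ → laplace-∏𝐏 (Ws ∖ᶠ As) (rs (independents-size Ws As∈)))

  -- From families back to the complete multipartite graph.

  full : ∀ n → Subset n
  full n = Vec.replicate n true

  fullᶠ : (λs : Vec ℕ r) → Family λs
  fullᶠ []       = []
  fullᶠ (l ∷ λs) = full l ∷ fullᶠ λs

  mem-fullᶠ : ∀ (λs : Vec ℕ r) u → T (mem (fullᶠ λs) u)
  mem-fullᶠ (l ∷ λs) u with splitView l (Vec.sum λs) u
  ... | left i  = subst T (sym (trans (mem-left (full l) (fullᶠ λs) i) (Vec.lookup-replicate i true))) _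
  ... | right j = subst T (sym (mem-right (full l) (fullᶠ λs) j)) (mem-fullᶠ λs j)

  count-full : ∀ n → count (full n) ≡ n
  count-full zero    = refl
  count-full (suc n) = cong suc (count-full n)

  AO-full : (λs : Vec ℕ r) → AO (K∣ (fullᶠ λs)) ≡ AO (K λs)
  AO-full λs = AO-cong (K∣ (fullᶠ λs)) (K λs) (λ _ _ → proj₁) λ u v u≁v → u≁v , mem-fullᶠ λs u , mem-fullᶠ λs v

  seq-^ : ∀ t j n → seq (t Real.^ j) n ≡ seq t n ^ℚ j
  seq-^ t zero    n = refl
  seq-^ t (suc j) n = cong (seq t n *_) (seq-^ t j n)

  -- `P 0` is an empty sum while `𝐏 0` is 1, so `m` has to be positive; then the extra term of `𝐏 m`
  -- at `j = 0` vanishes because `S m 0` is 0.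
  seq-P : ∀ m .{{_ : NonZero m}} t n → seq (P m t) n ≡ 𝐏 m (seq t n)
  seq-P (suc m) t n = begin
    seq (P (suc m) t) n
      ≡⟨ seq-sum {suc m} (λ i → fromℚ (coeff (suc m) (suc (toℕ i))) Real.* t Real.^ suc (toℕ i)) n ⟩
    sum {suc m} (λ i → coeff (suc m) (suc (toℕ i)) * seq (t Real.^ suc (toℕ i)) n)
      ≡⟨ sum-cong {suc m} (λ i → cong (coeff (suc m) (suc (toℕ i)) *_) (seq-^ t (suc (toℕ i)) n)) ⟩
    sum {suc m} (λ i → f (suc (toℕ i)))
      ≡⟨ partialSum-sum (f ∘ suc) (suc m) ⟨
    partialSum (f ∘ suc) (suc m)
      ≡⟨ ℚ.+-identityˡ (partialSum (f ∘ suc) (suc m)) ⟨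
    0ℚ + partialSum (f ∘ suc) (suc m)
      ≡⟨ cong (_+ partialSum (f ∘ suc) (suc m)) (cong (_* 1ℚ) (coeff-S≡0 (suc m) 0 refl)) ⟨
    f 0 + partialSum (f ∘ suc) (suc m)
      ≡⟨ partialSum-front f (suc m) ⟨
    𝐏 (suc m) (seq t n) ∎
    where
    open ≡-Reasoning
    f : ℕ → ℚ
    f j = coeff (suc m) j * seq t n ^ℚ j

  seq-∏P : (λs : Vec ℕ r) → All NonZero λs → ∀ t n →
    seq (Real.product (λ i → P (lookup λs i) t)) n ≡ ∏𝐏 (fullᶠ λs) (seq t n)
  seq-∏P []       []         t n = refl
  seq-∏P (l ∷ λs) (l≢0 ∷ nz) t n = cong₂ _*_
    (trans (seq-P l {{l≢0}} t n) (cong (λ m → 𝐏 m (seq t n)) (sym (count-full l)))) (seq-∏P λs nz t n)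

  integrand : Vec ℕ r → ℝ → ℝ
  integrand λs t = exp (Real.- t) Real.* Real.product (λ i → P (lookup λs i) t)

  integral-AO : (λs : Vec ℕ r) → All NonZero λs → ∫₀^∞ integrand λs ≈ fromℕ (AO (K λs))
  integral-AO λs nz = subst (λ L → ∫₀^∞ integrand λs ≈ fromℚ L) (trans Q0≡L (cong ι (AO-full λs)))
    (LaplaceIntegral.integral poly Q-Q′≡p (integrand λs) (λ t n → cong (E n (- seq t n) *_) (seq-∏P λs nz t n)))
    where open Laplace (laplace-∏𝐏 (fullᶠ λs) (<-wellFounded (size (fullᶠ λs))))

open import Defs
open import Data.Vec.Base using (Vec; lookup)

proposition1 : ∀ {r : ℕ} .{{_ : NonZero r}} (λs : Vec ℕ r) → All NonZero λs →
    ∫₀^∞ (λ t → exp (- t) * product (λ i → P (lookup λs i) t)) ≈ fromℕ (AO (K λs))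
proposition1 = PartPolynomials.integral-AO
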